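{- Fix $n \geq 0$ and let $B \subseteq \omega$ be a set which is not $\emptyset^{(n)}$-computable. Then every set $A \subseteq \omega$ has an infinite subset $H$ with $H \subseteq A$ or $H \subseteq \overline{A}$ such that $B$ is not $H^{(n)}$-computable.
   Context: $X^{(n)}$ denotes the $n$-th Turing jump of $X$ (with $X^{(0)} = X$), and $\overline{A} = \omega \setminus A$. -}

module Defs where

open import Data.Nat using (ℕ; zero; suc; _+_; _*_; _∸_; _^_; _≤_; _<_; _%_; ⌊_/2⌋)
open import Data.Product using (Σ; _×_; _,_; proj₁; proj₂)
open import Data.Sum using (_⊎_)
open import Data.Empty using (⊥)
open import Relation.Nullary using (¬_)

SetOf : Set₁
SetOf = ℕ → Set

∅ : SetOf
∅ _ = ⊥

∁ : SetOf → SetOf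
∁ A x = ¬ A x

_⊆_ : SetOf → SetOf → Set
H ⊆ A = ∀ x → H x → A x

Infinite : SetOf → Set
Infinite H = ∀ m → Σ ℕ λ k → (m ≤ k) × H k

-- A computable pairing bijection ℕ × ℕ → ℕ :  ⟨a , b⟩ = 2^a (2b+1) - 1

pair : ℕ → ℕ → ℕ
pair a b = (2 ^ a) * (2 * b + 1) ∸ 1

-- 2-adic valuation and odd part (with fuel; fuel ≥ m suffices)
val2 : ℕ → ℕ → ℕ
val2 zero    _ = 0
val2 (suc f) m with m % 2 | m
... | 0 | suc _ = suc (val2 f ⌊ m /2⌋)
... | _ | _     = 0

oddPart : ℕ → ℕ → ℕ
oddPart zero    m = m
oddPart (suc f) m with m % 2 | m
... | 0 | suc _ = oddPart f ⌊ m /2⌋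
... | _ | _     = m

unpair₁ : ℕ → ℕ
unpair₁ n = val2 (suc n) (suc n)

unpair₂ : ℕ → ℕ
unpair₂ n = ⌊ oddPart (suc n) (suc n) ∸ 1 /2⌋

-- Oracle partial recursive functions (unary, using the pairing above).

data Code : Set where
  zeroC succC idC fstC sndC oracC : Code
  compC  : Code → Code → Code
  pairC  : Code → Code → Code
  primC  : Code → Code → Code
  muC    : Code → Code

mutual
  data Eval (X : SetOf) : Code → ℕ → ℕ → Set where
    ev-zero : ∀ {x} → Eval X zeroC x 0
    ev-succ : ∀ {x} → Eval X succC x (suc x)
    ev-id   : ∀ {x} → Eval X idC x x
    ev-fst  : ∀ {x} → Eval X fstC x (unpair₁ x)
    ev-snd  : ∀ {x} → Eval X sndC x (unpair₂ x)
    ev-or1  : ∀ {x} → X x → Eval X oracC x 1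
    ev-or0  : ∀ {x} → ¬ X x → Eval X oracC x 0
    ev-comp : ∀ {f g x y z} → Eval X g x y → Eval X f y z → Eval X (compC f g) x z
    ev-pair : ∀ {f g x a b} → Eval X f x a → Eval X g x b → Eval X (pairC f g) x (pair a b)
    ev-prim : ∀ {f g x y v} → PrimRec X f g x y v → Eval X (primC f g) (pair x y) v
    ev-mu   : ∀ {f x y} → Eval X f (pair x y) 0
              → (∀ z → z < y → Σ ℕ λ w → Eval X f (pair x z) (suc w))
              → Eval X (muC f) x y

  data PrimRec (X : SetOf) (f g : Code) (x : ℕ) : ℕ → ℕ → Set where
    pr-zero : ∀ {v} → Eval X f x v → PrimRec X f g x 0 v
    pr-suc  : ∀ {y v w} → PrimRec X f g x y v → Eval X g (pair x (pair y v)) w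
              → PrimRec X f g x (suc y) w

decodeF : ℕ → ℕ → Code
decodeF zero    _ = zeroC
decodeF (suc f) n with unpair₁ n
... | 0 = zeroC
... | 1 = succC
... | 2 = idC
... | 3 = fstC
... | 4 = sndC
... | 5 = oracC
... | 6 = compC (decodeF f (unpair₁ (unpair₂ n))) (decodeF f (unpair₂ (unpair₂ n)))
... | 7 = pairC (decodeF f (unpair₁ (unpair₂ n))) (decodeF f (unpair₂ (unpair₂ n)))
... | 8 = primC (decodeF f (unpair₁ (unpair₂ n))) (decodeF f (unpair₂ (unpair₂ n)))
... | 9 = muC (decodeF f (unpair₂ n))
... | _ = zeroC

decode : ℕ → Code
decode n = decodeF (suc n) n

Halts : SetOf → Code → ℕ → Set
Halts X c x = Σ ℕ λ y → Eval X c x y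

jump : SetOf → SetOf
jump X e = Halts X (decode e) e

jumpN : ℕ → SetOf → SetOf
jumpN zero    X = X
jumpN (suc n) X = jump (jumpN n X)

Computable : SetOf → SetOf → Set
Computable X B = Σ Code λ c → ∀ x → (B x → Eval X c x 1) × (¬ B x → Eval X c x 0)

{-# OPTIONS --safe #-}

-- One of B and ∁ B is not c.e. in ∅⁽ⁿ⁾; calling it B, it suffices to build H such that B is not c.e. in H⁽ⁿ⁾.
--
-- H is built by finite strings σ with a reservoir X.  To control its jumps, n partition regular classes
-- 𝓛₀ ⊇ 𝓛₁ ⊇ … are fixed in advance, together with oracles Z₀ = ∅, Z₁, …, where Zₘ₊₁ computes Zₘ′ and B stays
-- not c.e. in the remaining jump of Zₘ.  Over Zₘ, a sequence of sets splits every cell produced so far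
-- into two pieces avoiding the e-th open class, whenever this is possible; by the low basis theorem it
-- may be taken low over Zₘ.  A path through the cells that stays in 𝓛ₘ, taken low (or avoiding B, at the last
-- level) over the jump, gives a decreasing sequence X₀ ⊇ X₁ ⊇ … such that each open class either contains
-- every Xₛ, and then is a requirement for 𝓛ₘ₊₁, or omits some Xₜ, to which the reservoir may be shrunk.
-- Hence the strings σ that may be extended inside the reservoir to make k ∈ H⁽ᵐ⁺¹⁾ true are co-c.e. in Zₘ₊₁,
-- which makes the forcing of Σₙ₊₁ statements about H a c.e. matter in Zₙ.
--
-- At the top level, "for every partition X = X₀ ∪ X₁, one of the Xᵢ contains an extension putting x into the
-- eᵢ-th c.e. set of the i-th side" is c.e. in Zₙ ⊕ X by compactness, so it differs from B at some x.
-- Either way one of the two sides A and ∁ A diagonalises; if A cannot be completed because of some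
-- condition and some index, that pair makes every requirement on the side ∁ A achievable.

module Submission where

open import Defs
open import Level using (Level; 0ℓ)
open import Axiom.ExcludedMiddle using (ExcludedMiddle)
open import Data.Bool using (Bool; true; false)
open import Data.Empty using (⊥; ⊥-elim)
open import Data.Fin using (Fin; zero; suc)
open import Data.List using (List; []; _∷_; _++_; length)
open import Data.List.Membership.Propositional using (_∈_)
open import Data.List.Membership.Propositional.Properties using (∈-++⁺ˡ; ∈-++⁺ʳ)
open import Data.List.Relation.Unary.Any using (here; there)
open import Data.Nat using (ℕ; zero; suc; _+_; _*_; _∸_; _^_; _≤_; _<_; _%_; ⌊_/2⌋; z≤n; s≤s; pred)
open import Data.Nat.DivMod using ([m+kn]%n≡m%n; m*n%n≡0)
open import Data.Nat.Induction using (<-rec)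
open import Data.Nat.Properties
open import Data.Product using (Σ; _×_; _,_; proj₁; proj₂)
open import Data.Sum using (_⊎_; inj₁; inj₂; [_,_]′; swap)
open import Data.Unit using (⊤; tt)
open import Data.Vec using (Vec; []; _∷_; lookup; head; tail)
open import Function using (_∘_; id; _⇔_; mk⇔)
open import Function.Bundles using (module Equivalence)
open import Relation.Binary using (tri<; tri≈; tri>)
open import Relation.Binary.PropositionalEquality using (_≡_; refl; sym; trans; cong; cong₂; subst; subst₂)
open import Relation.Nullary using (¬_; Dec; yes; no; toSum)
open import Relation.Nullary.Decidable using (⌊_⌋)
open Equivalence using (to; from)

-- Being non-c.e. is the useful form of hardness because the questions asked about extensions have
-- c.e. sets of yes-instances: such a set differs from B at some x, and a difference in either
-- direction can be turned into a win. The first obstacle is that A has no complexity bound, so no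
-- question may mention it. Instead the questions quantify over all partitions of a reservoir, of
-- which A and ∁ A induce just one. The second obstacle appears for n > 0. Forcing a negative fact
-- about a jump speaks of all extensions inside an infinite reservoir, and asking this about
-- arbitrary reservoirs would cost too many jumps. Largeness for 𝓛ₘ removes it: for each open class
-- the answer is read off from one sequence of cells, fixed independently of A, and it is valid for
-- all large sets at once. Partition regularity is what allows A or ∁ A to stay large while
-- reservoirs shrink. The budget is exact: each level spends one jump, so that after n levels B is
-- still not c.e. in the last oracle.

-- Arithmetic of the pairing function.

half-double : ∀ m → ⌊ 2 * m /2⌋ ≡ m
half-double m rewrite +-identityʳ m = sym (n≡⌊n+n/2⌋ m)

double%2 : ∀ m → (2 * m) % 2 ≡ 0
double%2 m = trans (cong (_% 2) (*-comm 2 m)) (m*n%n≡0 m 2)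

suc-double%2 : ∀ m → suc (2 * m) % 2 ≡ 1
suc-double%2 m = trans (cong (λ z → suc z % 2) (*-comm 2 m)) ([m+kn]%n≡m%n 1 m 2)

val2-even : ∀ f m → val2 (suc f) (2 * suc m) ≡ suc (val2 f (suc m))
val2-even f m with (2 * suc m) % 2 | double%2 (suc m)
... | .0 | refl = cong (λ z → suc (val2 f z)) (half-double (suc m))

val2-odd : ∀ f m → val2 (suc f) (suc (2 * m)) ≡ 0
val2-odd f m with suc (2 * m) % 2 | suc-double%2 m
... | .1 | refl = refl

oddPart-even : ∀ f m → oddPart (suc f) (2 * suc m) ≡ oddPart f (suc m)
oddPart-even f m with (2 * suc m) % 2 | double%2 (suc m)
... | .0 | refl = cong (oddPart f) (half-double (suc m))

oddPart-odd : ∀ f m → oddPart (suc f) (suc (2 * m)) ≡ suc (2 * m)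
oddPart-odd f m with suc (2 * m) % 2 | suc-double%2 m
... | .1 | refl = refl

-- This is `suc (pair a b)` without powers and truncated subtraction, in the shape on which `val2`
-- and `oddPart` recurse.
pairPos : ℕ → ℕ → ℕ
pairPos zero    b = suc (2 * b)
pairPos (suc a) b = 2 * pairPos a b

pairPos-suc : ∀ a b → Σ ℕ λ m → pairPos a b ≡ suc m
pairPos-suc zero    b = 2 * b , refl
pairPos-suc (suc a) b with pairPos-suc a b
... | m , eq rewrite eq = _ , refl

pairPos-formula : ∀ a b → (2 ^ a) * (2 * b + 1) ≡ pairPos a b
pairPos-formula zero    b = trans (*-identityˡ (2 * b + 1)) (+-comm (2 * b) 1)
pairPos-formula (suc a) b = trans (*-assoc 2 (2 ^ a) (2 * b + 1)) (cong (2 *_) (pairPos-formula a b))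

suc-pair : ∀ a b → suc (pair a b) ≡ pairPos a b
suc-pair a b with pairPos-suc a b
... | m , eq = trans (cong (λ z → suc (z ∸ 1)) (trans (pairPos-formula a b) eq)) (sym eq)

val2-pairPos : ∀ f a b → a < f → val2 f (pairPos a b) ≡ a
val2-pairPos (suc f) zero    b _ = val2-odd f b
val2-pairPos (suc f) (suc a) b (s≤s a<f) with pairPos-suc a b | val2-pairPos f a b a<f
... | m , eq | ih rewrite eq = trans (val2-even f m) (cong suc ih)

oddPart-pairPos : ∀ f a b → a < f → oddPart f (pairPos a b) ≡ suc (2 * b)
oddPart-pairPos (suc f) zero    b _ = oddPart-odd f b
oddPart-pairPos (suc f) (suc a) b (s≤s a<f) with pairPos-suc a b | oddPart-pairPos f a b a<f
... | m , eq | ih rewrite eq = trans (oddPart-even f m) ih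

m≤2*m : ∀ m → m ≤ 2 * m
m≤2*m m = m≤m+n m (m + 0)

a<pairPos : ∀ a b → a < pairPos a b
a<pairPos zero    b = s≤s z≤n
a<pairPos (suc a) b = ≤-trans (s≤s (a<pairPos a b))
  (≤-trans (+-monoˡ-≤ (pairPos a b) (≤-trans (s≤s z≤n) (a<pairPos a b))) (+-monoʳ-≤ (pairPos a b) (m≤m+n (pairPos a b) 0)))

b<pairPos : ∀ a b → b < pairPos a b
b<pairPos zero    b = s≤s (m≤2*m b)
b<pairPos (suc a) b = ≤-trans (b<pairPos a b) (m≤2*m _)

unpair₁-pair : ∀ a b → unpair₁ (pair a b) ≡ a
unpair₁-pair a b = trans (cong (val2 (suc (pair a b))) (suc-pair a b))
  (val2-pairPos (suc (pair a b)) a b (subst (a <_) (sym (suc-pair a b)) (a<pairPos a b)))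

unpair₂-pair : ∀ a b → unpair₂ (pair a b) ≡ b
unpair₂-pair a b = trans (cong (λ z → ⌊ z ∸ 1 /2⌋) (trans (cong (oddPart (suc (pair a b))) (suc-pair a b))
  (oddPart-pairPos (suc (pair a b)) a b (subst (a <_) (sym (suc-pair a b)) (a<pairPos a b))))) (half-double b)

parity-split : ∀ n → Σ ℕ λ k → (n ≡ 2 * k) ⊎ (n ≡ suc (2 * k))
parity-split zero = 0 , inj₁ refl
parity-split (suc n) with parity-split n
... | k , inj₁ eq = k , inj₂ (cong suc eq)
... | k , inj₂ eq = suc k , inj₁ (cong suc (trans eq (sym (+-suc k (k + 0)))))

pairPos-surjective : ∀ n → 0 < n → Σ ℕ λ a → Σ ℕ λ b → pairPos a b ≡ n
pairPos-surjective = <-rec _ go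
  where
  go : ∀ n → (∀ {m} → m < n → 0 < m → Σ ℕ λ a → Σ ℕ λ b → pairPos a b ≡ m) → 0 < n → Σ ℕ λ a → Σ ℕ λ b → pairPos a b ≡ n
  go n ih 0<n with parity-split n
  ... | k , inj₂ eq = 0 , k , sym eq
  ... | zero , inj₁ refl = ⊥-elim (<-irrefl refl 0<n)
  ... | suc k , inj₁ refl with ih {suc k} (s≤s (m<m+n k (s≤s z≤n))) (s≤s z≤n)
  ...   | a , b , eq = suc a , b , cong (2 *_) eq

pair-surjective : ∀ n → Σ ℕ λ a → Σ ℕ λ b → pair a b ≡ n
pair-surjective n with pairPos-surjective (suc n) (s≤s z≤n)
... | a , b , eq = a , b , suc-injective (trans (suc-pair a b) eq)

pair-unpair : ∀ n → pair (unpair₁ n) (unpair₂ n) ≡ n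
pair-unpair n with pair-surjective n
... | a , b , refl = cong₂ pair (unpair₁-pair a b) (unpair₂-pair a b)

unpair₁-≤ : ∀ n → unpair₁ n ≤ n
unpair₁-≤ n with pair-surjective n
... | a , b , refl = subst (_≤ pair a b) (sym (unpair₁-pair a b)) (≤-pred (subst (a <_) (sym (suc-pair a b)) (a<pairPos a b)))

unpair₂-≤ : ∀ n → unpair₂ n ≤ n
unpair₂-≤ n with pair-surjective n
... | a , b , refl = subst (_≤ pair a b) (sym (unpair₂-pair a b)) (≤-pred (subst (b <_) (sym (suc-pair a b)) (b<pairPos a b)))

-- Strictness for nonzero tags is what makes decoding well founded: compound programs have tags 6 to
-- 9.
unpair₂-< : ∀ n {a} → unpair₁ n ≡ suc a → unpair₂ n < n
unpair₂-< n {a} eq with pair-surjective n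
... | a' , b , refl with trans (sym (unpair₁-pair a' b)) eq
...   | refl = subst (_< pair (suc a) b) (sym (unpair₂-pair (suc a) b)) (≤-pred (subst (suc b <_) (sym (suc-pair (suc a) b)) lem))
  where
  lem : suc b < 2 * pairPos a b
  lem = ≤-trans (s≤s (b<pairPos a b)) (≤-trans (+-monoˡ-≤ (pairPos a b) (≤-trans (s≤s z≤n) (b<pairPos a b))) (+-monoʳ-≤ (pairPos a b) (m≤m+n (pairPos a b) 0)))

-- Code numbers

decodeF-fuel : ∀ f g n → n < f → n < g → decodeF f n ≡ decodeF g n
decodeF-fuel (suc f) (suc g) n (s≤s n≤f) (s≤s n≤g) with unpair₁ n | inspect′
  where
  inspect′ : ∀ {a} → unpair₁ n ≡ suc a → (unpair₂ n < f) × (unpair₂ n < g)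
  inspect′ eq = ≤-trans (unpair₂-< n eq) n≤f , ≤-trans (unpair₂-< n eq) n≤g
... | 0 | _ = refl
... | 1 | _ = refl
... | 2 | _ = refl
... | 3 | _ = refl
... | 4 | _ = refl
... | 5 | _ = refl
... | 6 | h = cong₂ compC (decodeF-fuel f g _ (≤-trans (s≤s (unpair₁-≤ _)) (proj₁ (h refl))) (≤-trans (s≤s (unpair₁-≤ _)) (proj₂ (h refl))))
                          (decodeF-fuel f g _ (≤-trans (s≤s (unpair₂-≤ _)) (proj₁ (h refl))) (≤-trans (s≤s (unpair₂-≤ _)) (proj₂ (h refl))))
... | 7 | h = cong₂ pairC (decodeF-fuel f g _ (≤-trans (s≤s (unpair₁-≤ _)) (proj₁ (h refl))) (≤-trans (s≤s (unpair₁-≤ _)) (proj₂ (h refl))))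
                          (decodeF-fuel f g _ (≤-trans (s≤s (unpair₂-≤ _)) (proj₁ (h refl))) (≤-trans (s≤s (unpair₂-≤ _)) (proj₂ (h refl))))
... | 8 | h = cong₂ primC (decodeF-fuel f g _ (≤-trans (s≤s (unpair₁-≤ _)) (proj₁ (h refl))) (≤-trans (s≤s (unpair₁-≤ _)) (proj₂ (h refl))))
                          (decodeF-fuel f g _ (≤-trans (s≤s (unpair₂-≤ _)) (proj₁ (h refl))) (≤-trans (s≤s (unpair₂-≤ _)) (proj₂ (h refl))))
... | 9 | h = cong muC (decodeF-fuel f g _ (proj₁ (h refl)) (proj₂ (h refl)))
... | suc (suc (suc (suc (suc (suc (suc (suc (suc (suc _))))))))) | _ = refl

fst₂ snd₂ : ℕ → ℕ
fst₂ n = unpair₁ (unpair₂ n)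
snd₂ n = unpair₂ (unpair₂ n)

decodeStep : ℕ → ℕ → Code
decodeStep 0 n = zeroC
decodeStep 1 n = succC
decodeStep 2 n = idC
decodeStep 3 n = fstC
decodeStep 4 n = sndC
decodeStep 5 n = oracC
decodeStep 6 n = compC (decode (fst₂ n)) (decode (snd₂ n))
decodeStep 7 n = pairC (decode (fst₂ n)) (decode (snd₂ n))
decodeStep 8 n = primC (decode (fst₂ n)) (decode (snd₂ n))
decodeStep 9 n = muC (decode (unpair₂ n))
decodeStep (suc (suc (suc (suc (suc (suc (suc (suc (suc (suc _)))))))))) n = zeroC

decode-step : ∀ n → decode n ≡ decodeStep (unpair₁ n) n
decode-step n with unpair₁ n | inspect′
  where
  inspect′ : ∀ {a} → unpair₁ n ≡ suc a → unpair₂ n < n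
  inspect′ = unpair₂-< n
... | 0 | _ = refl
... | 1 | _ = refl
... | 2 | _ = refl
... | 3 | _ = refl
... | 4 | _ = refl
... | 5 | _ = refl
... | 6 | h = cong₂ compC (decodeF-fuel n _ _ (≤-trans (s≤s (unpair₁-≤ _)) (h refl)) ≤-refl) (decodeF-fuel n _ _ (≤-trans (s≤s (unpair₂-≤ _)) (h refl)) ≤-refl)
... | 7 | h = cong₂ pairC (decodeF-fuel n _ _ (≤-trans (s≤s (unpair₁-≤ _)) (h refl)) ≤-refl) (decodeF-fuel n _ _ (≤-trans (s≤s (unpair₂-≤ _)) (h refl)) ≤-refl)
... | 8 | h = cong₂ primC (decodeF-fuel n _ _ (≤-trans (s≤s (unpair₁-≤ _)) (h refl)) ≤-refl) (decodeF-fuel n _ _ (≤-trans (s≤s (unpair₂-≤ _)) (h refl)) ≤-refl)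
... | 9 | h = cong muC (decodeF-fuel n _ _ (h refl) ≤-refl)
... | suc (suc (suc (suc (suc (suc (suc (suc (suc (suc _))))))))) | _ = refl

decode-pair : ∀ t b → decode (pair t b) ≡ decodeStep t (pair t b)
decode-pair t b = trans (decode-step (pair t b)) (cong (λ z → decodeStep z (pair t b)) (unpair₁-pair t b))

node : ℕ → ℕ → ℕ → ℕ
node t a b = pair t (pair a b)

fst₂-node : ∀ t a b → fst₂ (node t a b) ≡ a
fst₂-node t a b = trans (cong unpair₁ (unpair₂-pair t (pair a b))) (unpair₁-pair a b)

snd₂-node : ∀ t a b → snd₂ (node t a b) ≡ b
snd₂-node t a b = trans (cong unpair₂ (unpair₂-pair t (pair a b))) (unpair₂-pair a b)

encode : Code → ℕ
encode zeroC       = pair 0 0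
encode succC       = pair 1 0
encode idC         = pair 2 0
encode fstC        = pair 3 0
encode sndC        = pair 4 0
encode oracC       = pair 5 0
encode (compC f g) = node 6 (encode f) (encode g)
encode (pairC f g) = node 7 (encode f) (encode g)
encode (primC f g) = node 8 (encode f) (encode g)
encode (muC f)     = pair 9 (encode f)

decode-encode : ∀ c → decode (encode c) ≡ c
decode-encode zeroC = decode-pair 0 0
decode-encode succC = decode-pair 1 0
decode-encode idC   = decode-pair 2 0
decode-encode fstC  = decode-pair 3 0
decode-encode sndC  = decode-pair 4 0
decode-encode oracC = decode-pair 5 0
decode-encode (compC f g) = trans (decode-pair 6 (pair (encode f) (encode g))) (cong₂ compC
  (trans (cong decode (fst₂-node 6 (encode f) (encode g))) (decode-encode f)) (trans (cong decode (snd₂-node 6 (encode f) (encode g))) (decode-encode g)))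
decode-encode (pairC f g) = trans (decode-pair 7 (pair (encode f) (encode g))) (cong₂ pairC
  (trans (cong decode (fst₂-node 7 (encode f) (encode g))) (decode-encode f)) (trans (cong decode (snd₂-node 7 (encode f) (encode g))) (decode-encode g)))
decode-encode (primC f g) = trans (decode-pair 8 (pair (encode f) (encode g))) (cong₂ primC
  (trans (cong decode (fst₂-node 8 (encode f) (encode g))) (decode-encode f)) (trans (cong decode (snd₂-node 8 (encode f) (encode g))) (decode-encode g)))
decode-encode (muC f) = trans (decode-pair 9 (encode f)) (cong muC (trans (cong decode (unpair₂-pair 9 (encode f))) (decode-encode f)))

-- Computations from partial oracle information.

-- Yes-answers come from `P` and no-answers from `N`, which may be neither total nor complementary.
-- One datatype thus serves for true evaluation, for evaluation along a finite string, and for what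
-- a condition suggests or forces about a jump.
data Run (P N : SetOf) : Code → ℕ → ℕ → Set where
  r-zero : ∀ {x} → Run P N zeroC x 0
  r-succ : ∀ {x} → Run P N succC x (suc x)
  r-id   : ∀ {x} → Run P N idC x x
  r-fst  : ∀ {x} → Run P N fstC x (unpair₁ x)
  r-snd  : ∀ {x} → Run P N sndC x (unpair₂ x)
  r-or1  : ∀ {x} → P x → Run P N oracC x 1
  r-or0  : ∀ {x} → N x → Run P N oracC x 0
  r-comp : ∀ {f g x y z} → Run P N g x y → Run P N f y z → Run P N (compC f g) x z
  r-pair : ∀ {f g x a b} → Run P N f x a → Run P N g x b → Run P N (pairC f g) x (pair a b)
  r-pr0  : ∀ {f g x v} → Run P N f x v → Run P N (primC f g) (pair x 0) v
  r-prS  : ∀ {f g x y v w} → Run P N (primC f g) (pair x y) v → Run P N g (pair x (pair y v)) w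
           → Run P N (primC f g) (pair x (suc y)) w
  r-mu   : ∀ {f x y} → Run P N f (pair x y) 0 → (∀ z → z < y → Σ ℕ λ w → Run P N f (pair x z) (suc w))
           → Run P N (muC f) x y

module _ {X : SetOf} where

  eval→run : ∀ {c x y} → Eval X c x y → Run X (∁ X) c x y
  prim→run : ∀ {f g x y v} → PrimRec X f g x y v → Run X (∁ X) (primC f g) (pair x y) v
  eval→run ev-zero       = r-zero
  eval→run ev-succ       = r-succ
  eval→run ev-id         = r-id
  eval→run ev-fst        = r-fst
  eval→run ev-snd        = r-snd
  eval→run (ev-or1 p)    = r-or1 p
  eval→run (ev-or0 p)    = r-or0 p
  eval→run (ev-comp d e) = r-comp (eval→run d) (eval→run e)
  eval→run (ev-pair d e) = r-pair (eval→run d) (eval→run e)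
  eval→run (ev-prim p)   = prim→run p
  eval→run (ev-mu d h)   = r-mu (eval→run d) (λ z z<y → proj₁ (h z z<y) , eval→run (proj₂ (h z z<y)))
  prim→run (pr-zero d)   = r-pr0 (eval→run d)
  prim→run {x = x} (pr-suc {y = y} p d) = r-prS {x = x} {y = y} (prim→run p) (eval→run d)

  eval-prim-inv : ∀ {f g x y v} → Eval X (primC f g) (pair x y) v → PrimRec X f g x y v
  eval-prim-inv {f} {g} {x} {y} {v} e = subst₂ (λ a b → PrimRec X f g a b v) (unpair₁-pair x y) (unpair₂-pair x y) (go e)
    where
    go : ∀ {n v} → Eval X (primC f g) n v → PrimRec X f g (unpair₁ n) (unpair₂ n) v
    go (ev-prim {x = x} {y = y} {v = v} p) = subst₂ (λ a b → PrimRec X f g a b v) (sym (unpair₁-pair x y)) (sym (unpair₂-pair x y)) p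

  run→eval : ∀ {c x y} → Run X (∁ X) c x y → Eval X c x y
  run→eval r-zero       = ev-zero
  run→eval r-succ       = ev-succ
  run→eval r-id         = ev-id
  run→eval r-fst        = ev-fst
  run→eval r-snd        = ev-snd
  run→eval (r-or1 p)    = ev-or1 p
  run→eval (r-or0 p)    = ev-or0 p
  run→eval (r-comp d e) = ev-comp (run→eval d) (run→eval e)
  run→eval (r-pair d e) = ev-pair (run→eval d) (run→eval e)
  run→eval (r-pr0 d)    = ev-prim (pr-zero (run→eval d))
  run→eval (r-prS {x = x} {y = y} d e) = ev-prim (pr-suc (eval-prim-inv {x = x} {y = y} (run→eval d)) (run→eval e))
  run→eval (r-mu d h)   = ev-mu (run→eval d) (λ z z<y → proj₁ (h z z<y) , run→eval (proj₂ (h z z<y)))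

run-mono : ∀ {P N P' N' c x y} → P ⊆ P' → N ⊆ N' → Run P N c x y → Run P' N' c x y
run-mono p n r-zero       = r-zero
run-mono p n r-succ       = r-succ
run-mono p n r-id         = r-id
run-mono p n r-fst        = r-fst
run-mono p n r-snd        = r-snd
run-mono p n (r-or1 q)    = r-or1 (p _ q)
run-mono p n (r-or0 q)    = r-or0 (n _ q)
run-mono p n (r-comp d e) = r-comp (run-mono p n d) (run-mono p n e)
run-mono p n (r-pair d e) = r-pair (run-mono p n d) (run-mono p n e)
run-mono p n (r-pr0 d)    = r-pr0 (run-mono p n d)
run-mono p n (r-prS {x = x} {y = y} d e) = r-prS {x = x} {y = y} (run-mono p n d) (run-mono p n e)
run-mono p n (r-mu d h)   = r-mu (run-mono p n d) (λ z z<y → proj₁ (h z z<y) , run-mono p n (proj₂ (h z z<y)))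

-- A computation asks finitely many questions, so it already runs with the answers of one member of a directed family.
module Directed {a : Level} {I : Set a} (P N : I → SetOf)
  (ub : ∀ i j → Σ I λ k → ((P i ⊆ P k) × (N i ⊆ N k)) × ((P j ⊆ P k) × (N j ⊆ N k))) (i₀ : I) where

  collect : (R : I → ℕ → Set) → (∀ {i j z} → P i ⊆ P j → N i ⊆ N j → R i z → R j z) → ∀ y
    → (∀ z → z < y → Σ I λ i → R i z) → Σ I λ i → ∀ z → z < y → R i z
  collect R mono zero    h = i₀ , λ z ()
  collect R mono (suc y) h with collect R mono y (λ z z<y → h z (m<n⇒m<1+n z<y)) | h y ≤-refl
  ... | i , hi | j , hj with ub i j
  ...   | k , (pi , ni) , (pj , nj) = k , go
    where
    go : ∀ z → z < suc y → R k z
    go z (s≤s z≤y) with m≤n⇒m<n∨m≡n z≤y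
    ... | inj₁ z<y  = mono pi ni (hi z z<y)
    ... | inj₂ refl = mono pj nj hj

  run-finite : ∀ {P∞ N∞} → (∀ x → P∞ x → Σ I λ i → P i x) → (∀ x → N∞ x → Σ I λ i → N i x)
    → ∀ {c x y} → Run P∞ N∞ c x y → Σ I λ i → Run (P i) (N i) c x y
  run-finite {P∞} {N∞} p n = go
    where
    both : ∀ {c x y c' x' y'} → Σ I (λ i → Run (P i) (N i) c x y) → Σ I (λ i → Run (P i) (N i) c' x' y')
      → Σ I λ i → Run (P i) (N i) c x y × Run (P i) (N i) c' x' y'
    both (i , d) (j , e) with ub i j
    ... | k , (pi , ni) , (pj , nj) = k , run-mono pi ni d , run-mono pj nj e
    go : ∀ {c x y} → Run P∞ N∞ c x y → Σ I λ i → Run (P i) (N i) c x y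
    go r-zero = i₀ , r-zero
    go r-succ = i₀ , r-succ
    go r-id   = i₀ , r-id
    go r-fst  = i₀ , r-fst
    go r-snd  = i₀ , r-snd
    go (r-or1 q) with p _ q
    ... | i , pi = i , r-or1 pi
    go (r-or0 q) with n _ q
    ... | i , ni = i , r-or0 ni
    go (r-comp d e) with both (go d) (go e)
    ... | i , d' , e' = i , r-comp d' e'
    go (r-pair d e) with both (go d) (go e)
    ... | i , d' , e' = i , r-pair d' e'
    go (r-pr0 d) with go d
    ... | i , d' = i , r-pr0 d'
    go (r-prS {x = x} {y = y} d e) with both (go d) (go e)
    ... | i , d' , e' = i , r-prS {x = x} {y = y} d' e'
    go (r-mu {f} {x} {y} d h) with go d | collect (λ i z → Σ ℕ λ w → Run (P i) (N i) f (pair x z) (suc w))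
                                             (λ pp nn r → proj₁ r , run-mono pp nn (proj₂ r)) y
                                             (λ z z<y → let i , r = go (proj₂ (h z z<y)) in i , proj₁ (h z z<y) , r)
    ... | i , d' | j , h' with ub i j
    ...   | k , (pi , ni) , (pj , nj) = k , r-mu (run-mono pi ni d') (λ z z<y → proj₁ (h' z z<y) , run-mono pj nj (proj₂ (h' z z<y)))

run-eventually : ∀ {P N : SetOf} (P' N' : ℕ → SetOf)
  → (∀ x → P x → Σ ℕ λ i → ∀ j → i ≤ j → P' j x) → (∀ x → N x → Σ ℕ λ i → ∀ j → i ≤ j → N' j x)
  → ∀ {c x y} → Run P N c x y → Σ ℕ λ i → ∀ j → i ≤ j → Run (P' j) (N' j) c x y
run-eventually P' N' p n r with Directed.run-finite P∞ N∞ ub 0 p n r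
  where
  -- `P'` and `N'` need not increase with the stage; the facts that are permanent from `i` on do, so
  -- these form the directed family.
  P∞ N∞ : ℕ → SetOf
  P∞ i x = ∀ j → i ≤ j → P' j x
  N∞ i x = ∀ j → i ≤ j → N' j x
  ub : ∀ i j → Σ ℕ λ k → ((P∞ i ⊆ P∞ k) × (N∞ i ⊆ N∞ k)) × ((P∞ j ⊆ P∞ k) × (N∞ j ⊆ N∞ k))
  ub i j = i + j , ((λ _ h k le → h k (≤-trans (m≤m+n i j) le)) , (λ _ h k le → h k (≤-trans (m≤m+n i j) le)))
                 , ((λ _ h k le → h k (≤-trans (m≤n+m j i) le)) , (λ _ h k le → h k (≤-trans (m≤n+m j i) le)))
... | i , d = i , λ j i≤j → run-mono (λ _ h → h j i≤j) (λ _ h → h j i≤j) d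

pair-injectiveˡ : ∀ {a b c d} → pair a b ≡ pair c d → a ≡ c
pair-injectiveˡ {a} {b} {c} {d} eq = trans (sym (unpair₁-pair a b)) (trans (cong unpair₁ eq) (unpair₁-pair c d))

pair-injectiveʳ : ∀ {a b c d} → pair a b ≡ pair c d → b ≡ d
pair-injectiveʳ {a} {b} {c} {d} eq = trans (sym (unpair₂-pair a b)) (trans (cong unpair₂ eq) (unpair₂-pair c d))

-- The inputs are two variables tied by an equation because those of `r-pr0` and `r-prS` are values
-- of `pair`, which matching cannot invert. For `muC`, the smaller of two different outputs would
-- give both a zero and a nonzero value.
run-deterministic : ∀ {P N} → (∀ x → P x → N x → ⊥) → ∀ {c x y x' y'} → Run P N c x y → Run P N c x' y' → x ≡ x' → y ≡ y'
run-deterministic {P} {N} dis = go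
  where
  go : ∀ {c x y x' y'} → Run P N c x y → Run P N c x' y' → x ≡ x' → y ≡ y'
  go r-zero r-zero _ = refl
  go r-succ r-succ refl = refl
  go r-id r-id refl = refl
  go r-fst r-fst refl = refl
  go r-snd r-snd refl = refl
  go (r-or1 _) (r-or1 _) _ = refl
  go (r-or1 p) (r-or0 n) refl = ⊥-elim (dis _ p n)
  go (r-or0 n) (r-or1 p) refl = ⊥-elim (dis _ p n)
  go (r-or0 _) (r-or0 _) _ = refl
  go (r-comp d e) (r-comp d' e') eq = go e e' (go d d' eq)
  go (r-pair d e) (r-pair d' e') eq = cong₂ pair (go d d' eq) (go e e' eq)
  go (r-pr0 d) (r-pr0 d') eq = go d d' (pair-injectiveˡ {b = 0} {d = 0} eq)
  go (r-pr0 {x = x} d) (r-prS {x = x'} {y = y} d' e') eq = ⊥-elim (0≢1+n (pair-injectiveʳ {x} {0} {x'} {suc y} eq))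
  go (r-prS {x = x} {y = y} d e) (r-pr0 {x = x'} d') eq = ⊥-elim (0≢1+n (sym (pair-injectiveʳ {x} {suc y} {x'} {0} eq)))
  go (r-prS {x = x} {y = y} d e) (r-prS {x = x'} {y = y'} d' e') eq = go e e' (cong₂ pair ex (cong₂ pair ey (go d d' (cong₂ pair ex ey))))
    where
    ex : x ≡ x'
    ex = pair-injectiveˡ {x} {suc y} {x'} {suc y'} eq
    ey : y ≡ y'
    ey = suc-injective (pair-injectiveʳ {x} {suc y} {x'} {suc y'} eq)
  go (r-mu {y = y} d h) (r-mu {y = y'} d' h') refl with <-cmp y y'
  ... | tri< lt _ _ = ⊥-elim (0≢1+n (go d (proj₂ (h' y lt)) refl))
  ... | tri≈ _ eq _ = eq
  ... | tri> _ _ gt = ⊥-elim (0≢1+n (sym (go (proj₂ (h y' gt)) d' refl)))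

eval-deterministic : ∀ {X c x y z} → Eval X c x y → Eval X c x z → y ≡ z
eval-deterministic d e = run-deterministic (λ _ p n → n p) (eval→run d) (eval→run e) refl

-- Computable and c.e. relations over an oracle.

enc : ∀ {k} → Vec ℕ k → ℕ
enc []      = 0
enc (x ∷ ρ) = pair x (enc ρ)

record Comp (Z : SetOf) {k : ℕ} (F : Vec ℕ k → ℕ) : Set where
  constructor comp
  field
    code : Code
    computes : ∀ ρ → Eval Z code (enc ρ) (F ρ)

record CompV (Z : SetOf) {n k : ℕ} (G : Vec ℕ n → Vec ℕ k) : Set where
  constructor compV
  field
    code : Code
    computes : ∀ ρ → Eval Z code (enc ρ) (enc (G ρ))

-- Truth is the value 0: conjunction becomes a sum, disjunction a product, bounded quantification a
-- `sum<`, and a c.e. relation is a search for a zero.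
record Rec (Z : SetOf) {k : ℕ} (R : Vec ℕ k → Set) : Set where
  constructor rec
  field
    {fun} : Vec ℕ k → ℕ
    isComp : Comp Z fun
    spec : ∀ ρ → R ρ ⇔ (fun ρ ≡ 0)

record CE (Z : SetOf) {k : ℕ} (R : Vec ℕ k → Set) : Set where
  constructor ce
  field
    {fun} : Vec ℕ (suc k) → ℕ
    isComp : Comp Z fun
    spec : ∀ ρ → R ρ ⇔ (Σ ℕ λ y → fun (y ∷ ρ) ≡ 0)

prec : ∀ {k} → (Vec ℕ k → ℕ) → (Vec ℕ (suc (suc k)) → ℕ) → Vec ℕ (suc k) → ℕ
prec f g (zero  ∷ ρ) = f ρ
prec f g (suc y ∷ ρ) = g (y ∷ prec f g (y ∷ ρ) ∷ ρ)

sum< : ∀ {k} → (Vec ℕ (suc k) → ℕ) → Vec ℕ (suc k) → ℕ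
sum< D = prec (λ _ → 0) (λ { (y ∷ v ∷ ρ) → v + D (y ∷ ρ) })

sum<-zero : ∀ {k} (D : Vec ℕ (suc k) → ℕ) b ρ → sum< D (b ∷ ρ) ≡ 0 ⇔ (∀ y → y < b → D (y ∷ ρ) ≡ 0)
sum<-zero D zero    ρ = mk⇔ (λ _ y ()) (λ _ → refl)
sum<-zero D (suc b) ρ = mk⇔
  (λ eq y y<b → [ to (sum<-zero D b ρ) (m+n≡0⇒m≡0 _ eq) y , (λ { refl → m+n≡0⇒n≡0 (sum< D (b ∷ ρ)) eq }) ]′ (m≤n⇒m<n∨m≡n (≤-pred y<b)))
  (λ h → cong₂ _+_ (from (sum<-zero D b ρ) (λ y y<b → h y (m<n⇒m<1+n y<b))) (h b ≤-refl))

-- Repeated unpairing reads every number as an infinite sequence, so no length is stored and any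
-- finite list of values is a prefix of some code.
seqTail : ℕ → ℕ → ℕ
seqTail w zero    = w
seqTail w (suc i) = unpair₂ (seqTail w i)

seqAt : ℕ → ℕ → ℕ
seqAt w i = unpair₁ (seqTail w i)

seqAt-suc : ∀ a w i → seqAt (pair a w) (suc i) ≡ seqAt w i
seqAt-suc a w i = cong unpair₁ (go i)
  where
  go : ∀ i → seqTail (pair a w) (suc i) ≡ seqTail w i
  go zero    = unpair₂-pair a w
  go (suc i) = cong unpair₂ (go i)

-- Parity and halving by structural recursion, so that they are visibly primitive recursive.
par half : ℕ → ℕ
par zero    = 0
par (suc n) = 1 ∸ par n
half zero    = 0
half (suc n) = half n + par n

shift : ℕ → ℕ → ℕ
shift E zero    = E
shift E (suc x) = half (shift E x)

module _ {Z : SetOf} where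

  comp-ext : ∀ {k} {F G : Vec ℕ k → ℕ} → (∀ ρ → F ρ ≡ G ρ) → Comp Z F → Comp Z G
  comp-ext eq (comp c h) = comp c (λ ρ → subst (Eval Z c (enc ρ)) (eq ρ) (h ρ))

  constC : ℕ → Code
  constC zero    = zeroC
  constC (suc n) = compC succC (constC n)

  constC-eval : ∀ n x → Eval Z (constC n) x n
  constC-eval zero    x = ev-zero
  constC-eval (suc n) x = ev-comp (constC-eval n x) ev-succ

  litᶜ : ∀ {k} n → Comp Z {k} (λ _ → n)
  litᶜ n = comp (constC n) (λ ρ → constC-eval n (enc ρ))

  encᶜ : ∀ {k} → Comp Z {k} enc
  encᶜ = comp idC (λ ρ → ev-id)

  varᶜ : ∀ {k} (i : Fin k) → Comp Z (λ ρ → lookup ρ i)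
  varᶜ i = comp (varC i) (go i)
    where
    varC : ∀ {k} → Fin k → Code
    varC zero    = fstC
    varC (suc i) = compC (varC i) sndC
    go : ∀ {k} (i : Fin k) ρ → Eval Z (varC i) (enc ρ) (lookup ρ i)
    go zero    (x ∷ ρ) = subst (Eval Z fstC (pair x (enc ρ))) (unpair₁-pair x (enc ρ)) ev-fst
    go (suc i) (x ∷ ρ) = ev-comp (subst (Eval Z sndC (pair x (enc ρ))) (unpair₂-pair x (enc ρ)) ev-snd) (go i ρ)

  idᵛ : ∀ {k} → CompV Z {k} id
  idᵛ = compV idC (λ ρ → ev-id)

  tailᵛ : ∀ {n k} {G : Vec ℕ n → Vec ℕ (suc k)} → CompV Z G → CompV Z (λ ρ → tail (G ρ))
  tailᵛ {G = G} (compV c h) = compV (compC sndC c) (λ ρ → ev-comp (h ρ) (go (G ρ)))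
    where
    go : ∀ {k} (ρ : Vec ℕ (suc k)) → Eval Z sndC (enc ρ) (enc (tail ρ))
    go (x ∷ ρ) = subst (Eval Z sndC (pair x (enc ρ))) (unpair₂-pair x (enc ρ)) ev-snd

  []ᵛ : ∀ {n} → CompV Z {n} (λ _ → [])
  []ᵛ = compV zeroC (λ ρ → ev-zero)

  infixr 5 _∷ᵛ_
  _∷ᵛ_ : ∀ {n k} {F : Vec ℕ n → ℕ} {G : Vec ℕ n → Vec ℕ k} → Comp Z F → CompV Z G → CompV Z (λ ρ → F ρ ∷ G ρ)
  comp c h ∷ᵛ compV d g = compV (pairC c d) (λ ρ → ev-pair (h ρ) (g ρ))

  subᶜ : ∀ {n k} {F : Vec ℕ k → ℕ} {G : Vec ℕ n → Vec ℕ k} → Comp Z F → CompV Z G → Comp Z (λ ρ → F (G ρ))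
  subᶜ {G = G} (comp c h) (compV d g) = comp (compC c d) (λ ρ → ev-comp (g ρ) (h (G ρ)))

  sucᶜ : ∀ {k} {F : Vec ℕ k → ℕ} → Comp Z F → Comp Z (λ ρ → suc (F ρ))
  sucᶜ (comp c h) = comp (compC succC c) (λ ρ → ev-comp (h ρ) ev-succ)

  fstᶜ : ∀ {k} {F : Vec ℕ k → ℕ} → Comp Z F → Comp Z (λ ρ → unpair₁ (F ρ))
  fstᶜ (comp c h) = comp (compC fstC c) (λ ρ → ev-comp (h ρ) ev-fst)

  sndᶜ : ∀ {k} {F : Vec ℕ k → ℕ} → Comp Z F → Comp Z (λ ρ → unpair₂ (F ρ))
  sndᶜ (comp c h) = comp (compC sndC c) (λ ρ → ev-comp (h ρ) ev-snd)

  pairᶜ : ∀ {k} {F G : Vec ℕ k → ℕ} → Comp Z F → Comp Z G → Comp Z (λ ρ → pair (F ρ) (G ρ))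
  pairᶜ (comp c h) (comp d g) = comp (pairC c d) (λ ρ → ev-pair (h ρ) (g ρ))

  precᶜ : ∀ {k} {f : Vec ℕ k → ℕ} {g : Vec ℕ (suc (suc k)) → ℕ} → Comp Z f → Comp Z g → Comp Z (prec f g)
  precᶜ {k} {f} {g} (comp c h) (comp d e) = comp (compC (primC c step) (pairC sndC fstC)) run
    where
    step : Code
    step = compC d (pairC (compC fstC sndC) (pairC (compC sndC sndC) fstC))
    stepEval : ∀ y v (ρ : Vec ℕ k) → Eval Z step (pair (enc ρ) (pair y v)) (g (y ∷ v ∷ ρ))
    stepEval y v ρ = ev-comp (ev-pair (ev-comp s (subst (Eval Z fstC (pair y v)) (unpair₁-pair y v) ev-fst))
      (ev-pair (ev-comp s (subst (Eval Z sndC (pair y v)) (unpair₂-pair y v) ev-snd))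
               (subst (Eval Z fstC (pair (enc ρ) (pair y v))) (unpair₁-pair (enc ρ) (pair y v)) ev-fst))) (e (y ∷ v ∷ ρ))
      where
      s : Eval Z sndC (pair (enc ρ) (pair y v)) (pair y v)
      s = subst (Eval Z sndC (pair (enc ρ) (pair y v))) (unpair₂-pair (enc ρ) (pair y v)) ev-snd
    loop : ∀ y (ρ : Vec ℕ k) → PrimRec Z c step (enc ρ) y (prec f g (y ∷ ρ))
    loop zero    ρ = pr-zero (h ρ)
    loop (suc y) ρ = pr-suc (loop y ρ) (stepEval y (prec f g (y ∷ ρ)) ρ)
    run : ∀ ρ → Eval Z (compC (primC c step) (pairC sndC fstC)) (enc ρ) (prec f g ρ)
    run (y ∷ ρ) = ev-comp (ev-pair (subst (Eval Z sndC (pair y (enc ρ))) (unpair₂-pair y (enc ρ)) ev-snd)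
      (subst (Eval Z fstC (pair y (enc ρ))) (unpair₁-pair y (enc ρ)) ev-fst)) (ev-prim (loop y ρ))

  v0 : ∀ {k} → Comp Z {suc k} (λ ρ → lookup ρ zero)
  v0 = varᶜ zero
  v1 : ∀ {k} → Comp Z {suc (suc k)} (λ ρ → lookup ρ (suc zero))
  v1 = varᶜ (suc zero)
  v2 : ∀ {k} → Comp Z {suc (suc (suc k))} (λ ρ → lookup ρ (suc (suc zero)))
  v2 = varᶜ (suc (suc zero))
  v3 : ∀ {k} → Comp Z {suc (suc (suc (suc k)))} (λ ρ → lookup ρ (suc (suc (suc zero))))
  v3 = varᶜ (suc (suc (suc zero)))
  v4 : ∀ {k} → Comp Z {suc (suc (suc (suc (suc k))))} (λ ρ → lookup ρ (suc (suc (suc (suc zero)))))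
  v4 = varᶜ (suc (suc (suc (suc zero))))
  v5 : ∀ {k} → Comp Z {suc (suc (suc (suc (suc (suc k)))))} (λ ρ → lookup ρ (suc (suc (suc (suc (suc zero))))))
  v5 = varᶜ (suc (suc (suc (suc (suc zero)))))
  v6 : ∀ {k} → Comp Z {suc (suc (suc (suc (suc (suc (suc k))))))} (λ ρ → lookup ρ (suc (suc (suc (suc (suc (suc zero)))))))
  v6 = varᶜ (suc (suc (suc (suc (suc (suc zero))))))

  lift₁ : ∀ {k} {h : ℕ → ℕ} → Comp Z {1} (λ ρ → h (head ρ)) → {F : Vec ℕ k → ℕ} → Comp Z F → Comp Z (λ ρ → h (F ρ))
  lift₁ ch cf = subᶜ ch (cf ∷ᵛ []ᵛ)

  lift₂ : ∀ {k} {h : ℕ → ℕ → ℕ} → Comp Z {2} (λ ρ → h (head ρ) (head (tail ρ))) → {F G : Vec ℕ k → ℕ} → Comp Z F → Comp Z G → Comp Z (λ ρ → h (F ρ) (G ρ))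
  lift₂ ch cf cg = subᶜ ch (cf ∷ᵛ cg ∷ᵛ []ᵛ)

  infixl 6 _+ᶜ_ _∸ᶜ_
  infixl 7 _*ᶜ_

  _+ᶜ_ : ∀ {k} {F G : Vec ℕ k → ℕ} → Comp Z F → Comp Z G → Comp Z (λ ρ → F ρ + G ρ)
  _+ᶜ_ = lift₂ {h = _+_} (comp-ext (λ { (a ∷ b ∷ []) → go a b }) (precᶜ v0 (sucᶜ v1)))
    where
    go : ∀ a b → prec (λ ρ → lookup ρ zero) (λ ρ → suc (lookup ρ (suc zero))) (a ∷ b ∷ []) ≡ a + b
    go zero    b = refl
    go (suc a) b = cong suc (go a b)

  _*ᶜ_ : ∀ {k} {F G : Vec ℕ k → ℕ} → Comp Z F → Comp Z G → Comp Z (λ ρ → F ρ * G ρ)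
  _*ᶜ_ = lift₂ {h = _*_} (comp-ext (λ { (a ∷ b ∷ []) → go a b }) (precᶜ (litᶜ 0) (v2 +ᶜ v1)))
    where
    go : ∀ a b → prec (λ ρ → 0) (λ ρ → lookup ρ (suc (suc zero)) + lookup ρ (suc zero)) (a ∷ b ∷ []) ≡ a * b
    go zero    b = refl
    go (suc a) b = cong (b +_) (go a b)

  predᶜ : ∀ {k} {F : Vec ℕ k → ℕ} → Comp Z F → Comp Z (λ ρ → pred (F ρ))
  predᶜ = lift₁ {h = pred} (comp-ext (λ { (zero ∷ []) → refl ; (suc a ∷ []) → refl }) (precᶜ (litᶜ 0) v0))

  _∸ᶜ_ : ∀ {k} {F G : Vec ℕ k → ℕ} → Comp Z F → Comp Z G → Comp Z (λ ρ → F ρ ∸ G ρ)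
  F ∸ᶜ G = lift₂ {h = λ b a → a ∸ b} (comp-ext (λ { (b ∷ a ∷ []) → go b a }) (precᶜ v0 (predᶜ v1))) G F
    where
    go : ∀ b a → prec (λ ρ → lookup ρ zero) (λ ρ → pred (lookup ρ (suc zero))) (b ∷ a ∷ []) ≡ a ∸ b
    go zero    a = refl
    go (suc b) a = trans (cong pred (go b a)) (pred[m∸n]≡m∸[1+n] a b)

  2^ᶜ : ∀ {k} {F : Vec ℕ k → ℕ} → Comp Z F → Comp Z (λ ρ → 2 ^ F ρ)
  2^ᶜ = lift₁ {h = 2 ^_} (comp-ext (λ { (a ∷ []) → go a }) (precᶜ (litᶜ 1) (litᶜ 2 *ᶜ v1)))
    where
    go : ∀ a → prec (λ ρ → 1) (λ ρ → 2 * lookup ρ (suc zero)) (a ∷ []) ≡ 2 ^ a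
    go zero    = refl
    go (suc a) = cong (2 *_) (go a)

  seqAtᶜ : ∀ {k} {F G : Vec ℕ k → ℕ} → Comp Z F → Comp Z G → Comp Z (λ ρ → seqAt (F ρ) (G ρ))
  seqAtᶜ cf cg = lift₂ {h = λ i w → seqAt w i} (fstᶜ (comp-ext (λ { (i ∷ w ∷ []) → go i w }) (precᶜ v0 (sndᶜ v1)))) cg cf
    where
    go : ∀ i w → prec (λ ρ → lookup ρ zero) (λ ρ → unpair₂ (lookup ρ (suc zero))) (i ∷ w ∷ []) ≡ seqTail w i
    go zero    w = refl
    go (suc i) w = cong unpair₂ (go i w)

  parᶜ : ∀ {k} {F : Vec ℕ k → ℕ} → Comp Z F → Comp Z (λ ρ → par (F ρ))
  parᶜ = lift₁ {h = par} (comp-ext (λ { (a ∷ []) → go a }) (precᶜ (litᶜ 0) (litᶜ 1 ∸ᶜ v1)))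
    where
    go : ∀ a → prec (λ ρ → 0) (λ ρ → 1 ∸ lookup ρ (suc zero)) (a ∷ []) ≡ par a
    go zero    = refl
    go (suc a) = cong (1 ∸_) (go a)

  halfᶜ : ∀ {k} {F : Vec ℕ k → ℕ} → Comp Z F → Comp Z (λ ρ → half (F ρ))
  halfᶜ = lift₁ {h = half} (comp-ext (λ { (a ∷ []) → go a }) (precᶜ (litᶜ 0) (v1 +ᶜ parᶜ v0)))
    where
    go : ∀ a → prec (λ ρ → 0) (λ ρ → lookup ρ (suc zero) + par (lookup ρ zero)) (a ∷ []) ≡ half a
    go zero    = refl
    go (suc a) = cong (_+ par a) (go a)

  shiftᶜ : ∀ {k} {F G : Vec ℕ k → ℕ} → Comp Z F → Comp Z G → Comp Z (λ ρ → shift (F ρ) (G ρ))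
  shiftᶜ cf cg = lift₂ {h = λ i w → shift w i} (comp-ext (λ { (i ∷ w ∷ []) → go i w }) (precᶜ v0 (halfᶜ v1))) cg cf
    where
    go : ∀ i w → prec (λ ρ → lookup ρ zero) (λ ρ → half (lookup ρ (suc zero))) (i ∷ w ∷ []) ≡ shift w i
    go zero    w = refl
    go (suc i) w = cong half (go i w)

  sum<ᶜ : ∀ {k} {D : Vec ℕ (suc k) → ℕ} → Comp Z D → Comp Z (sum< D)
  sum<ᶜ {k} {D} cd = comp-ext (λ { (b ∷ ρ) → go b ρ }) (precᶜ (litᶜ 0) (v1 +ᶜ subᶜ cd (v0 ∷ᵛ tailᵛ (tailᵛ idᵛ))))
    where
    go : ∀ b ρ → prec (λ _ → 0) (λ ρ → lookup ρ (suc zero) + D (lookup ρ zero ∷ tail (tail ρ))) (b ∷ ρ) ≡ sum< D (b ∷ ρ)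
    go zero    ρ = refl
    go (suc b) ρ = cong (_+ D (b ∷ ρ)) (go b ρ)

  rec-ext : ∀ {k} {R S : Vec ℕ k → Set} → (∀ ρ → R ρ ⇔ S ρ) → Rec Z R → Rec Z S
  rec-ext eq (rec c s) = rec c (λ ρ → mk⇔ (to (s ρ) ∘ from (eq ρ)) (to (eq ρ) ∘ from (s ρ)))

  _=ʳ_ : ∀ {k} {F G : Vec ℕ k → ℕ} → Comp Z F → Comp Z G → Rec Z (λ ρ → F ρ ≡ G ρ)
  _=ʳ_ {F = F} {G} cf cg = rec ((cf ∸ᶜ cg) +ᶜ (cg ∸ᶜ cf)) (λ ρ → mk⇔
    (λ eq → cong₂ _+_ (m≤n⇒m∸n≡0 (≤-reflexive eq)) (m≤n⇒m∸n≡0 (≤-reflexive (sym eq))))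
    (λ eq → ≤-antisym (m∸n≡0⇒m≤n (m+n≡0⇒m≡0 (F ρ ∸ G ρ) eq)) (m∸n≡0⇒m≤n (m+n≡0⇒n≡0 (F ρ ∸ G ρ) eq))))

  _<ʳ_ : ∀ {k} {F G : Vec ℕ k → ℕ} → Comp Z F → Comp Z G → Rec Z (λ ρ → F ρ < G ρ)
  _<ʳ_ {F = F} {G} cf cg = rec (sucᶜ cf ∸ᶜ cg) (λ ρ → mk⇔ m≤n⇒m∸n≡0 (m∸n≡0⇒m≤n))

  _≤ʳ_ : ∀ {k} {F G : Vec ℕ k → ℕ} → Comp Z F → Comp Z G → Rec Z (λ ρ → F ρ ≤ G ρ)
  _≤ʳ_ {F = F} {G} cf cg = rec (cf ∸ᶜ cg) (λ ρ → mk⇔ m≤n⇒m∸n≡0 (m∸n≡0⇒m≤n))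

  infixr 3 _×ʳ_ _×ᵉ_
  infixr 2 _⊎ʳ_ _⊎ᵉ_
  infix 4 _=ʳ_ _<ʳ_ _≤ʳ_

  _×ʳ_ : ∀ {k} {R S : Vec ℕ k → Set} → Rec Z R → Rec Z S → Rec Z (λ ρ → R ρ × S ρ)
  rec {D} c s ×ʳ rec d t = rec (c +ᶜ d) (λ ρ → mk⇔ (λ { (a , b) → cong₂ _+_ (to (s ρ) a) (to (t ρ) b) })
    (λ eq → from (s ρ) (m+n≡0⇒m≡0 _ eq) , from (t ρ) (m+n≡0⇒n≡0 (D ρ) eq)))

  _⊎ʳ_ : ∀ {k} {R S : Vec ℕ k → Set} → Rec Z R → Rec Z S → Rec Z (λ ρ → R ρ ⊎ S ρ)
  rec {D} c s ⊎ʳ rec {E} d t = rec (c *ᶜ d) (λ ρ → mk⇔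
    (λ { (inj₁ a) → cong (_* E ρ) (to (s ρ) a) ; (inj₂ b) → trans (cong (D ρ *_) (to (t ρ) b)) (*-zeroʳ (D ρ)) })
    (λ eq → [ inj₁ ∘ from (s ρ) , inj₂ ∘ from (t ρ) ]′ (m*n≡0⇒m≡0∨n≡0 (D ρ) eq)))

  ¬ʳ_ : ∀ {k} {R : Vec ℕ k → Set} → Rec Z R → Rec Z (λ ρ → ¬ R ρ)
  ¬ʳ_ {R = R} (rec {D} c s) = rec (litᶜ 1 ∸ᶜ c) (λ ρ → mk⇔ (λ nr → go (D ρ) (λ eq → nr (from (s ρ) eq))) (λ eq r → 1+n≢0 (trans (cong (1 ∸_) (sym (to (s ρ) r))) eq)))
    where
    go : ∀ d → ¬ (d ≡ 0) → 1 ∸ d ≡ 0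
    go zero    h = ⊥-elim (h refl)
    go (suc d) h = 0∸n≡0 d

  ∀<ʳ : ∀ {k} {R : Vec ℕ (suc k) → Set} {b : Vec ℕ k → ℕ} → Comp Z b → Rec Z R → Rec Z (λ ρ → ∀ y → y < b ρ → R (y ∷ ρ))
  ∀<ʳ {b = b} cb (rec {D} c s) = rec (subᶜ (sum<ᶜ c) (cb ∷ᵛ idᵛ)) (λ ρ → mk⇔
    (λ h → from (sum<-zero D (b ρ) ρ) (λ y y<b → to (s (y ∷ ρ)) (h y y<b)))
    (λ eq y y<b → from (s (y ∷ ρ)) (to (sum<-zero D (b ρ) ρ) eq y y<b)))

  subʳ : ∀ {n k} {R : Vec ℕ k → Set} {G : Vec ℕ n → Vec ℕ k} → Rec Z R → CompV Z G → Rec Z (λ ρ → R (G ρ))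
  subʳ {G = G} (rec c s) g = rec (subᶜ c g) (λ ρ → s (G ρ))

  ce-ext : ∀ {k} {R S : Vec ℕ k → Set} → (∀ ρ → R ρ ⇔ S ρ) → CE Z R → CE Z S
  ce-ext eq (ce c s) = ce c (λ ρ → mk⇔ (to (s ρ) ∘ from (eq ρ)) (to (eq ρ) ∘ from (s ρ)))

  rec→ce : ∀ {k} {R : Vec ℕ k → Set} → Rec Z R → CE Z R
  rec→ce (rec {D} c s) = ce {fun = λ ρ → D (tail ρ)} (subᶜ c (tailᵛ idᵛ)) (λ ρ → mk⇔ (λ r → 0 , to (s ρ) r) (λ { (_ , eq) → from (s ρ) eq }))

  subᵉ : ∀ {n k} {R : Vec ℕ k → Set} {G : Vec ℕ n → Vec ℕ k} → CE Z R → CompV Z G → CE Z (λ ρ → R (G ρ))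
  subᵉ {G = G} (ce {D} c s) g = ce {fun = λ ρ → D (head ρ ∷ G (tail ρ))} (subᶜ c (headᶜ ∷ᵛ subᵛ g)) (λ ρ → s (G ρ))
    where
    headᶜ : ∀ {k} → Comp Z {suc k} head
    headᶜ = comp-ext (λ { (x ∷ ρ) → refl }) v0
    subᵛ : ∀ {n k} {G : Vec ℕ n → Vec ℕ k} → CompV Z G → CompV Z {suc n} (λ ρ → G (tail ρ))
    subᵛ {n} {k} {G} (compV c h) with tailᵛ {suc n} idᵛ
    ... | compV d g = compV (compC c d) (λ ρ → ev-comp (g ρ) (h (tail ρ)))

  _×ᵉ_ : ∀ {k} {R S : Vec ℕ k → Set} → CE Z R → CE Z S → CE Z (λ ρ → R ρ × S ρ)
  ce {D} c s ×ᵉ ce {E} d t = ce (subᶜ c (fstᶜ v0 ∷ᵛ tailᵛ idᵛ) +ᶜ subᶜ d (sndᶜ v0 ∷ᵛ tailᵛ idᵛ)) (λ ρ → mk⇔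
    (λ { (a , b) → let y , p = to (s ρ) a ; z , q = to (t ρ) b in pair y z ,
      cong₂ _+_ (trans (cong (λ u → D (u ∷ ρ)) (unpair₁-pair y z)) p) (trans (cong (λ u → E (u ∷ ρ)) (unpair₂-pair y z)) q) })
    (λ { (y , eq) → from (s ρ) (unpair₁ y , m+n≡0⇒m≡0 _ eq) , from (t ρ) (unpair₂ y , m+n≡0⇒n≡0 (D (unpair₁ y ∷ ρ)) eq) }))

  _⊎ᵉ_ : ∀ {k} {R S : Vec ℕ k → Set} → CE Z R → CE Z S → CE Z (λ ρ → R ρ ⊎ S ρ)
  ce {D} c s ⊎ᵉ ce {E} d t = ce (c *ᶜ d) (λ ρ → mk⇔
    (λ { (inj₁ a) → let y , p = to (s ρ) a in y , cong (_* E (y ∷ ρ)) p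
       ; (inj₂ b) → let y , p = to (t ρ) b in y , trans (cong (D (y ∷ ρ) *_) p) (*-zeroʳ (D (y ∷ ρ))) })
    (λ { (y , eq) → [ (λ p → inj₁ (from (s ρ) (y , p))) , (λ p → inj₂ (from (t ρ) (y , p))) ]′ (m*n≡0⇒m≡0∨n≡0 (D (y ∷ ρ)) eq) }))

  ∃ᵉ : ∀ {k} {R : Vec ℕ (suc k) → Set} → CE Z R → CE Z (λ ρ → Σ ℕ λ y → R (y ∷ ρ))
  ∃ᵉ (ce {D} c s) = ce (subᶜ c (fstᶜ v0 ∷ᵛ sndᶜ v0 ∷ᵛ tailᵛ idᵛ)) (λ ρ → mk⇔
    (λ { (y , r) → let w , p = to (s (y ∷ ρ)) r in pair w y ,
       trans (cong₂ (λ a b → D (a ∷ b ∷ ρ)) (unpair₁-pair w y) (unpair₂-pair w y)) p })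
    (λ { (w , eq) → unpair₂ w , from (s (unpair₂ w ∷ ρ)) (unpair₁ w , eq) }))

seq-exists : (g : ℕ → ℕ) (n : ℕ) → Σ ℕ λ w → ∀ i → i < n → seqAt w i ≡ g i
seq-exists g zero    = 0 , λ i ()
seq-exists g (suc n) with seq-exists (g ∘ suc) n
... | w , h = pair (g 0) w , go
  where
  go : ∀ i → i < suc n → seqAt (pair (g 0) w) i ≡ g i
  go zero    _         = unpair₁-pair (g 0) w
  go (suc i) (s≤s i<n) = trans (seqAt-suc (g 0) w i) (h i i<n)

choose< : {R : ℕ → ℕ → Set} (b : ℕ) → (∀ y → y < b → Σ ℕ (R y)) → Σ (ℕ → ℕ) λ g → ∀ y → y < b → R y (g y)
choose< zero    h = (λ _ → 0) , λ y ()
choose< {R} (suc b) h with choose< {λ y → R (suc y)} b (λ y y<b → h (suc y) (s≤s y<b)) | h 0 (s≤s z≤n)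
... | g , hg | w , hw = (λ { zero → w ; (suc y) → g y }) , λ { zero _ → hw ; (suc y) (s≤s y<b) → hg y y<b }

module _ {Z : SetOf} where

  -- The witnesses for all `y` below the bound are gathered in one number through `seqAt`, so a
  -- single unbounded search remains.
  ∀<ᵉ : ∀ {k} {R : Vec ℕ (suc k) → Set} {b : Vec ℕ k → ℕ} → Comp Z b → CE Z R → CE Z (λ ρ → ∀ y → y < b ρ → R (y ∷ ρ))
  ∀<ᵉ {k} {R} {b} cb (ce {D} c s) = ce {fun = λ ρ → sum< D' (b (tail ρ) ∷ ρ)} (subᶜ (sum<ᶜ cD') (subᶜ cb (tailᵛ idᵛ) ∷ᵛ idᵛ)) (λ ρ → mk⇔ (fwd ρ)
      (λ { (w , eq) y y<b → from (s (y ∷ ρ)) (seqAt w y , to (sum<-zero D' (b ρ) (w ∷ ρ)) eq y y<b) }))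
    where
    D' : Vec ℕ (suc (suc k)) → ℕ
    D' ρ = D (seqAt (lookup ρ (suc zero)) (lookup ρ zero) ∷ lookup ρ zero ∷ tail (tail ρ))
    cD' : Comp Z D'
    cD' = subᶜ c (seqAtᶜ v1 v0 ∷ᵛ v0 ∷ᵛ tailᵛ (tailᵛ idᵛ))
    fwd : ∀ ρ → (∀ y → y < b ρ → R (y ∷ ρ)) → Σ ℕ λ w → sum< D' (b ρ ∷ w ∷ ρ) ≡ 0
    fwd ρ h with choose< {λ y w → D (w ∷ y ∷ ρ) ≡ 0} (b ρ) (λ y y<b → to (s (y ∷ ρ)) (h y y<b))
    ... | g , hg with seq-exists g (b ρ)
    ...   | w , hw = w , from (sum<-zero D' (b ρ) (w ∷ ρ)) (λ y y<b → trans (cong (λ u → D (u ∷ y ∷ ρ)) (hw y y<b)) (hg y y<b))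

-- Evaluation is uniformly c.e.

-- Tags above 9 also decode to `zeroC`, so a program does not determine its number. An induction on
-- runs has to carry along the number from which the program was read.
data View (c : ℕ) : Code → Set where
  w-zero : (unpair₁ c ≡ 0) ⊎ (9 < unpair₁ c) → View c zeroC
  w-succ : unpair₁ c ≡ 1 → View c succC
  w-id   : unpair₁ c ≡ 2 → View c idC
  w-fst  : unpair₁ c ≡ 3 → View c fstC
  w-snd  : unpair₁ c ≡ 4 → View c sndC
  w-orac : unpair₁ c ≡ 5 → View c oracC
  w-comp : unpair₁ c ≡ 6 → View c (compC (decode (fst₂ c)) (decode (snd₂ c)))
  w-pair : unpair₁ c ≡ 7 → View c (pairC (decode (fst₂ c)) (decode (snd₂ c)))
  w-prim : unpair₁ c ≡ 8 → View c (primC (decode (fst₂ c)) (decode (snd₂ c)))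
  w-mu   : unpair₁ c ≡ 9 → View c (muC (decode (unpair₂ c)))

view : ∀ c → View c (decode c)
view c = subst (View c) (sym (decode-step c)) (go (unpair₁ c) refl)
  where
  go : ∀ t → unpair₁ c ≡ t → View c (decodeStep t c)
  go 0 e = w-zero (inj₁ e)
  go 1 e = w-succ e
  go 2 e = w-id e
  go 3 e = w-fst e
  go 4 e = w-snd e
  go 5 e = w-orac e
  go 6 e = w-comp e
  go 7 e = w-pair e
  go 8 e = w-prim e
  go 9 e = w-mu e
  go (suc (suc (suc (suc (suc (suc (suc (suc (suc (suc t)))))))))) e =
    w-zero (inj₂ (subst (9 <_) (sym e) (m≤m+n 10 t)))

-- A run is coded by a finite sequence of triples, each justified by later ones through a Step; checking such a
-- sequence needs only bounded quantifiers, which makes evaluation uniformly c.e. without an interpreter.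
data Step (H : ℕ → ℕ → ℕ → Set) (P N : SetOf) (c x y : ℕ) : Set where
  s-zero : (unpair₁ c ≡ 0) ⊎ (9 < unpair₁ c) → y ≡ 0 → Step H P N c x y
  s-succ : unpair₁ c ≡ 1 → y ≡ suc x → Step H P N c x y
  s-id   : unpair₁ c ≡ 2 → y ≡ x → Step H P N c x y
  s-fst  : unpair₁ c ≡ 3 → y ≡ unpair₁ x → Step H P N c x y
  s-snd  : unpair₁ c ≡ 4 → y ≡ unpair₂ x → Step H P N c x y
  s-orac : unpair₁ c ≡ 5 → ((y ≡ 1) × P x) ⊎ ((y ≡ 0) × N x) → Step H P N c x y
  s-comp : unpair₁ c ≡ 6 → Σ ℕ (λ m → H (snd₂ c) x m × H (fst₂ c) m y) → Step H P N c x y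
  s-pair : unpair₁ c ≡ 7 → H (fst₂ c) x (unpair₁ y) × H (snd₂ c) x (unpair₂ y) → Step H P N c x y
  s-pr0  : unpair₁ c ≡ 8 → (unpair₂ x ≡ 0) × H (fst₂ c) (unpair₁ x) y → Step H P N c x y
  s-prS  : unpair₁ c ≡ 8 → Σ ℕ (λ z → Σ ℕ λ v → (unpair₂ x ≡ suc z) × H c (pair (unpair₁ x) z) v
           × H (snd₂ c) (pair (unpair₁ x) (pair z v)) y) → Step H P N c x y
  s-mu   : unpair₁ c ≡ 9 → H (unpair₂ c) (pair x y) 0 × (∀ z → z < y → Σ ℕ λ v → H (unpair₂ c) (pair x z) (suc v)) → Step H P N c x y

step-mono : ∀ {H H' P N c x y} → (∀ {c x y} → H c x y → H' c x y) → Step H P N c x y → Step H' P N c x y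
step-mono m (s-zero e f) = s-zero e f
step-mono m (s-succ e f) = s-succ e f
step-mono m (s-id e f)   = s-id e f
step-mono m (s-fst e f)  = s-fst e f
step-mono m (s-snd e f)  = s-snd e f
step-mono m (s-orac e f) = s-orac e f
step-mono m (s-comp e (w , p , q)) = s-comp e (w , m p , m q)
step-mono m (s-pair e (p , q)) = s-pair e (m p , m q)
step-mono m (s-pr0 e (a , p)) = s-pr0 e (a , m p)
step-mono m (s-prS e (z , v , a , p , q)) = s-prS e (z , v , a , m p , m q)
step-mono m (s-mu e (p , q)) = s-mu e (m p , λ z l → proj₁ (q z l) , m (proj₂ (q z l)))

RunN : SetOf → SetOf → ℕ → ℕ → ℕ → Set
RunN P N c = Run P N (decode c)

step-sound : ∀ {P N c x y} → Step (RunN P N) P N c x y → RunN P N c x y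
step-sound {P} {N} {c} {x} {y} s = subst (λ C → Run P N C x y) (sym (decode-step c)) (go s)
  where
  as : ∀ {t} → unpair₁ c ≡ t → Run P N (decodeStep t c) x y → Run P N (decodeStep (unpair₁ c) c) x y
  as e = subst (λ t → Run P N (decodeStep t c) x y) (sym e)
  big : ∀ t → 9 < t → decodeStep t c ≡ zeroC
  big _ (s≤s (s≤s (s≤s (s≤s (s≤s (s≤s (s≤s (s≤s (s≤s (s≤s _)))))))))) = refl
  prim : ∀ z → unpair₂ x ≡ z → Run P N (decodeStep 8 c) (pair (unpair₁ x) z) y → Run P N (decodeStep 8 c) x y
  prim z e = subst (λ u → Run P N (decodeStep 8 c) u y) (trans (cong (pair (unpair₁ x)) (sym e)) (pair-unpair x))
  go : Step (RunN P N) P N c x y → Run P N (decodeStep (unpair₁ c) c) x y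
  go (s-zero (inj₁ e) refl) = as e r-zero
  go (s-zero (inj₂ l) refl) = subst (λ C → Run P N C x 0) (sym (big (unpair₁ c) l)) r-zero
  go (s-succ e refl) = as e r-succ
  go (s-id e refl)   = as e r-id
  go (s-fst e refl)  = as e r-fst
  go (s-snd e refl)  = as e r-snd
  go (s-orac e (inj₁ (refl , p))) = as e (r-or1 p)
  go (s-orac e (inj₂ (refl , n))) = as e (r-or0 n)
  go (s-comp e (m , p , q)) = as e (r-comp p q)
  go (s-pair e (p , q)) = as e (subst (Run P N (decodeStep 7 c) x) (pair-unpair y) (r-pair p q))
  go (s-pr0 e (a , p)) = as e (prim 0 a (r-pr0 p))
  go (s-prS e (z , v , a , p , q)) = as e (prim (suc z) a (r-prS {x = unpair₁ x} {y = z} (subst (λ C → Run P N C (pair (unpair₁ x) z) v) (trans (decode-step c) (cong (λ t → decodeStep t c) e)) p) q))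
  go (s-mu e (p , q)) = as e (r-mu p q)

triple : ℕ → ℕ → ℕ → ℕ
triple c x y = pair c (pair x y)

InList : List ℕ → ℕ → ℕ → ℕ → Set
InList l c x y = triple c x y ∈ l

StepAt : (ℕ → ℕ → ℕ → Set) → SetOf → SetOf → ℕ → Set
StepAt H P N t = Step H P N (unpair₁ t) (fst₂ t) (snd₂ t)

module _ {P N : SetOf} where

  data Justified : List ℕ → Set where
    []  : Justified []
    _∷_ : ∀ {t l} → StepAt (InList l) P N t → Justified l → Justified (t ∷ l)

  justified-++ : ∀ {l l'} → Justified l → Justified l' → Justified (l ++ l')
  justified-++ []      j' = j'
  justified-++ (_∷_ {l = l} s j) j' = step-mono (∈-++⁺ˡ {xs = l}) s ∷ justified-++ j j'

  justify : ∀ c x y {l} → Justified l → Step (InList l) P N c x y → Σ (List ℕ) λ l → Justified l × InList l c x y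
  justify c x y {l} j s = triple c x y ∷ l , subst id eq s ∷ j , here refl
    where
    eq : Step (InList l) P N c x y ≡ StepAt (InList l) P N (triple c x y)
    eq rewrite unpair₁-pair c (pair x y) | unpair₂-pair c (pair x y) | unpair₁-pair x y | unpair₂-pair x y = refl

  Derivable : ℕ → ℕ → ℕ → Set
  Derivable c x y = Σ (List ℕ) λ l → Justified l × InList l c x y

  derivable-all : (c : ℕ) (x y : ℕ) → (∀ z → z < y → Σ ℕ λ v → Derivable c (pair x z) (suc v))
    → Σ (List ℕ) λ l → Justified l × (∀ z → z < y → Σ ℕ λ v → InList l c (pair x z) (suc v))
  derivable-all c x zero    h = [] , [] , λ z ()
  derivable-all c x (suc y) h with derivable-all c x y (λ z z<y → h z (m<n⇒m<1+n z<y)) | h y ≤-refl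
  ... | l , j , q | v , l' , j' , q' = l ++ l' , justified-++ j j' , go
    where
    go : ∀ z → z < suc y → Σ ℕ λ v → InList (l ++ l') c (pair x z) (suc v)
    go z (s≤s z≤y) with m≤n⇒m<n∨m≡n z≤y
    ... | inj₁ z<y  = proj₁ (q z z<y) , ∈-++⁺ˡ (proj₂ (q z z<y))
    ... | inj₂ refl = v , ∈-++⁺ʳ l q'

  run-derivable : ∀ {C x y} → Run P N C x y → ∀ c → View c C → Derivable c x y
  run-derivable {x = x} {y} r-zero c (w-zero e) = justify c x y [] (s-zero e refl)
  run-derivable {x = x} {y} r-succ c (w-succ e) = justify c x y [] (s-succ e refl)
  run-derivable {x = x} {y} r-id c (w-id e) = justify c x y [] (s-id e refl)
  run-derivable {x = x} {y} r-fst c (w-fst e) = justify c x y [] (s-fst e refl)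
  run-derivable {x = x} {y} r-snd c (w-snd e) = justify c x y [] (s-snd e refl)
  run-derivable {x = x} {y} (r-or1 p) c (w-orac e) = justify c x y [] (s-orac e (inj₁ (refl , p)))
  run-derivable {x = x} {y} (r-or0 n) c (w-orac e) = justify c x y [] (s-orac e (inj₂ (refl , n)))
  run-derivable {x = x} {z} (r-comp {y = y} d d') c (w-comp e) with run-derivable d (snd₂ c) (view _) | run-derivable d' (fst₂ c) (view _)
  ... | l , j , q | l' , j' , q' = justify c x z (justified-++ j j') (s-comp e (y , ∈-++⁺ˡ q , ∈-++⁺ʳ l q'))
  run-derivable {x = x} (r-pair {a = a} {b = b} d d') c (w-pair e) with run-derivable d (fst₂ c) (view _) | run-derivable d' (snd₂ c) (view _)
  ... | l , j , q | l' , j' , q' = justify c x (pair a b) (justified-++ j j') (s-pair e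
      ( subst (InList (l ++ l') (fst₂ c) x) (sym (unpair₁-pair a b)) (∈-++⁺ˡ q)
      , subst (InList (l ++ l') (snd₂ c) x) (sym (unpair₂-pair a b)) (∈-++⁺ʳ l q')))
  run-derivable (r-pr0 {x = x} {v = v} d) c (w-prim e) with run-derivable d (fst₂ c) (view _)
  ... | l , j , q = justify c (pair x 0) v j (s-pr0 e (unpair₂-pair x 0 , subst (λ u → InList l (fst₂ c) u v) (sym (unpair₁-pair x 0)) q))
  run-derivable (r-prS {x = x} {y = y} {v = v} {w = w} d d') c (w-prim e) with run-derivable d c (w-prim e) | run-derivable d' (snd₂ c) (view _)
  ... | l , j , q | l' , j' , q' = justify c (pair x (suc y)) w (justified-++ j j') (s-prS e (y , v , unpair₂-pair x (suc y)
      , subst (λ u → InList (l ++ l') c (pair u y) v) (sym (unpair₁-pair x (suc y))) (∈-++⁺ˡ q)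
      , subst (λ u → InList (l ++ l') (snd₂ c) (pair u (pair y v)) w) (sym (unpair₁-pair x (suc y))) (∈-++⁺ʳ l q')))
  run-derivable {x = x} {y} (r-mu d h) c (w-mu e) with run-derivable d (unpair₂ c) (view _)
      | derivable-all (unpair₂ c) x y (λ z z<y → proj₁ (h z z<y) , run-derivable (proj₂ (h z z<y)) (unpair₂ c) (view _))
  ... | l , j , q | l' , j' , q' = justify c x y (justified-++ j j') (s-mu e (∈-++⁺ˡ q , λ z z<y → proj₁ (q' z z<y) , ∈-++⁺ʳ l (proj₂ (q' z z<y))))

Has : ℕ → ℕ → ℕ → ℕ → ℕ → ℕ → Set
Has w n i c x y = Σ ℕ λ j → (i < j) × (j < n) × (seqAt w j ≡ triple c x y)

Checked : SetOf → SetOf → ℕ → ℕ → Set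
Checked P N w n = ∀ i → i < n → StepAt (Has w n i) P N (seqAt w i)

encodeList : List ℕ → ℕ
encodeList []      = 0
encodeList (t ∷ l) = pair t (encodeList l)

module _ {P N : SetOf} where

  inList-position : ∀ l {t} → t ∈ l → Σ ℕ λ j → (j < length l) × (seqAt (encodeList l) j ≡ t)
  inList-position (t ∷ l) (here refl) = 0 , s≤s z≤n , unpair₁-pair t (encodeList l)
  inList-position (t ∷ l) (there p) with inList-position l p
  ... | j , j<n , eq = suc j , s≤s j<n , trans (seqAt-suc t (encodeList l) j) eq

  justified-checked : ∀ l → Justified {P} {N} l → Checked P N (encodeList l) (length l)
  justified-checked (t ∷ l) (s ∷ j) zero _ = subst (StepAt (Has (pair t (encodeList l)) (suc (length l)) 0) P N) (sym (unpair₁-pair t (encodeList l)))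
    (step-mono (λ p → let j , j<n , eq = inList-position l p in suc j , s≤s z≤n , s≤s j<n , trans (seqAt-suc t (encodeList l) j) eq) s)
  justified-checked (t ∷ l) (s ∷ j) (suc i) (s≤s i<n) = subst (StepAt (Has (pair t (encodeList l)) (suc (length l)) (suc i)) P N) (sym (seqAt-suc t (encodeList l) i))
    (step-mono (λ { (j , i<j , j<n , eq) → suc j , s≤s i<j , s≤s j<n , trans (seqAt-suc t (encodeList l) j) eq }) (justified-checked l j i i<n))

  -- Induction on `d`, which bounds the number of entries from position `i` to the end: an entry is
  -- justified only by entries at later positions.
  checked-sound : ∀ w n → Checked P N w n → ∀ d i → n ≤ d + i → i < n → RunN P N (unpair₁ (seqAt w i)) (fst₂ (seqAt w i)) (snd₂ (seqAt w i))
  checked-sound w n ch zero    i n≤i i<n = ⊥-elim (<-irrefl refl (≤-trans i<n n≤i))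
  checked-sound w n ch (suc d) i n≤ i<n = step-sound (step-mono sub (ch i i<n))
    where
    sub : ∀ {c x y} → Has w n i c x y → RunN P N c x y
    sub {c} {x} {y} (j , i<j , j<n , eq) = subst id eq' (checked-sound w n ch d j (≤-trans n≤ (≤-trans (≤-reflexive (sym (+-suc d i))) (+-monoʳ-≤ d i<j))) j<n)
      where
      eq' : RunN P N (unpair₁ (seqAt w j)) (fst₂ (seqAt w j)) (snd₂ (seqAt w j)) ≡ RunN P N c x y
      eq' rewrite eq | unpair₁-pair c (pair x y) | unpair₂-pair c (pair x y) | unpair₁-pair x y | unpair₂-pair x y = refl

  run⇔checked : ∀ c x y → RunN P N c x y ⇔ (Σ ℕ λ w → Σ ℕ λ n → Checked P N w n × Σ ℕ λ j → (j < n) × (seqAt w j ≡ triple c x y))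
  run⇔checked c x y = mk⇔
    (λ r → let l , j , q = run-derivable r c (view c) in encodeList l , length l , justified-checked l j , inList-position l q)
    (λ { (w , n , ch , j , j<n , eq) → subst id (eq' w j eq) (checked-sound w n ch n j (m≤m+n n j) j<n) })
    where
    eq' : ∀ w j → seqAt w j ≡ triple c x y → RunN P N (unpair₁ (seqAt w j)) (fst₂ (seqAt w j)) (snd₂ (seqAt w j)) ≡ RunN P N c x y
    eq' w j eq rewrite eq | unpair₁-pair c (pair x y) | unpair₂-pair c (pair x y) | unpair₁-pair x y | unpair₂-pair x y = refl

-- `Step` as a nested sum of products, the form to which the closure properties of c.e. relations
-- apply.
StepSum : (ℕ → ℕ → ℕ → Set) → SetOf → SetOf → ℕ → ℕ → ℕ → Set
StepSum H P N c x y =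
    (((unpair₁ c ≡ 0) ⊎ (9 < unpair₁ c)) × (y ≡ 0))
  ⊎ ((unpair₁ c ≡ 1) × (y ≡ suc x))
  ⊎ ((unpair₁ c ≡ 2) × (y ≡ x))
  ⊎ ((unpair₁ c ≡ 3) × (y ≡ unpair₁ x))
  ⊎ ((unpair₁ c ≡ 4) × (y ≡ unpair₂ x))
  ⊎ ((unpair₁ c ≡ 5) × (((y ≡ 1) × P x) ⊎ ((y ≡ 0) × N x)))
  ⊎ ((unpair₁ c ≡ 6) × Σ ℕ (λ m → H (snd₂ c) x m × H (fst₂ c) m y))
  ⊎ ((unpair₁ c ≡ 7) × H (fst₂ c) x (unpair₁ y) × H (snd₂ c) x (unpair₂ y))
  ⊎ ((unpair₁ c ≡ 8) × (unpair₂ x ≡ 0) × H (fst₂ c) (unpair₁ x) y)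
  ⊎ ((unpair₁ c ≡ 8) × Σ ℕ (λ z → Σ ℕ λ v → (unpair₂ x ≡ suc z) × H c (pair (unpair₁ x) z) v
       × H (snd₂ c) (pair (unpair₁ x) (pair z v)) y))
  ⊎ ((unpair₁ c ≡ 9) × H (unpair₂ c) (pair x y) 0 × (∀ z → z < y → Σ ℕ λ v → H (unpair₂ c) (pair x z) (suc v)))

step⇔sum : ∀ {H P N c x y} → StepSum H P N c x y ⇔ Step H P N c x y
step⇔sum {H} {P} {N} {c} {x} {y} = mk⇔ f g
  where
  f : StepSum H P N c x y → Step H P N c x y
  f (inj₁ (e , p)) = s-zero e p
  f (inj₂ (inj₁ (e , p))) = s-succ e p
  f (inj₂ (inj₂ (inj₁ (e , p)))) = s-id e p
  f (inj₂ (inj₂ (inj₂ (inj₁ (e , p))))) = s-fst e p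
  f (inj₂ (inj₂ (inj₂ (inj₂ (inj₁ (e , p)))))) = s-snd e p
  f (inj₂ (inj₂ (inj₂ (inj₂ (inj₂ (inj₁ (e , p))))))) = s-orac e p
  f (inj₂ (inj₂ (inj₂ (inj₂ (inj₂ (inj₂ (inj₁ (e , p)))))))) = s-comp e p
  f (inj₂ (inj₂ (inj₂ (inj₂ (inj₂ (inj₂ (inj₂ (inj₁ (e , p))))))))) = s-pair e p
  f (inj₂ (inj₂ (inj₂ (inj₂ (inj₂ (inj₂ (inj₂ (inj₂ (inj₁ (e , p)))))))))) = s-pr0 e p
  f (inj₂ (inj₂ (inj₂ (inj₂ (inj₂ (inj₂ (inj₂ (inj₂ (inj₂ (inj₁ (e , p))))))))))) = s-prS e p
  f (inj₂ (inj₂ (inj₂ (inj₂ (inj₂ (inj₂ (inj₂ (inj₂ (inj₂ (inj₂ (e , p))))))))))) = s-mu e p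
  g : Step H P N c x y → StepSum H P N c x y
  g (s-zero e p) = inj₁ (e , p)
  g (s-succ e p) = inj₂ (inj₁ (e , p))
  g (s-id e p)   = inj₂ (inj₂ (inj₁ (e , p)))
  g (s-fst e p)  = inj₂ (inj₂ (inj₂ (inj₁ (e , p))))
  g (s-snd e p)  = inj₂ (inj₂ (inj₂ (inj₂ (inj₁ (e , p)))))
  g (s-orac e p) = inj₂ (inj₂ (inj₂ (inj₂ (inj₂ (inj₁ (e , p))))))
  g (s-comp e p) = inj₂ (inj₂ (inj₂ (inj₂ (inj₂ (inj₂ (inj₁ (e , p)))))))
  g (s-pair e p) = inj₂ (inj₂ (inj₂ (inj₂ (inj₂ (inj₂ (inj₂ (inj₁ (e , p))))))))
  g (s-pr0 e p)  = inj₂ (inj₂ (inj₂ (inj₂ (inj₂ (inj₂ (inj₂ (inj₂ (inj₁ (e , p)))))))))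
  g (s-prS e p)  = inj₂ (inj₂ (inj₂ (inj₂ (inj₂ (inj₂ (inj₂ (inj₂ (inj₂ (inj₁ (e , p))))))))))
  g (s-mu e p)   = inj₂ (inj₂ (inj₂ (inj₂ (inj₂ (inj₂ (inj₂ (inj₂ (inj₂ (inj₂ (e , p))))))))))

module _ {Z : SetOf} where

  hasᵉ : CE Z {6} (λ { (w ∷ n ∷ i ∷ c ∷ x ∷ y ∷ []) → Has w n i c x y })
  hasᵉ = ce-ext (λ { (w ∷ n ∷ i ∷ c ∷ x ∷ y ∷ []) → mk⇔ id id })
    (∃ᵉ (rec→ce ((v3 <ʳ v0) ×ʳ (v0 <ʳ v2) ×ʳ (seqAtᶜ v1 v0 =ʳ pairᶜ v4 (pairᶜ v5 v6)))))

  module Terms {m : ℕ} {fi fn fw : Vec ℕ m → ℕ} (I : Comp Z fi) (L : Comp Z fn) (W : Comp Z fw) where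
    T = seqAtᶜ W I
    C = fstᶜ T
    X = fstᶜ (sndᶜ T)
    Y = sndᶜ (sndᶜ T)
    tag = fstᶜ C
    A = fstᶜ (sndᶜ C)
    B = sndᶜ (sndᶜ C)
    H : ∀ {f g h : Vec ℕ m → ℕ} → Comp Z f → Comp Z g → Comp Z h → CE Z (λ ρ → Has (fw ρ) (fn ρ) (fi ρ) (f ρ) (g ρ) (h ρ))
    H a b c = subᵉ hasᵉ (W ∷ᵛ L ∷ᵛ I ∷ᵛ a ∷ᵛ b ∷ᵛ c ∷ᵛ []ᵛ)

  module _ {k : ℕ} {P N : Vec ℕ (suc k) → Set} (cP : CE Z P) (cN : CE Z N) where

    stepᵉ : CE Z (λ { (i ∷ n ∷ w ∷ ρ) → StepAt (Has w n i) (λ a → P (a ∷ ρ)) (λ a → N (a ∷ ρ)) (seqAt w i) })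
    stepᵉ = ce-ext (λ { (i ∷ n ∷ w ∷ ρ) → step⇔sum })
      (   rec→ce ((T₀.tag =ʳ litᶜ 0 ⊎ʳ litᶜ 9 <ʳ T₀.tag) ×ʳ (T₀.Y =ʳ litᶜ 0))
      ⊎ᵉ rec→ce (T₀.tag =ʳ litᶜ 1 ×ʳ T₀.Y =ʳ sucᶜ T₀.X)
      ⊎ᵉ rec→ce (T₀.tag =ʳ litᶜ 2 ×ʳ T₀.Y =ʳ T₀.X)
      ⊎ᵉ rec→ce (T₀.tag =ʳ litᶜ 3 ×ʳ T₀.Y =ʳ fstᶜ T₀.X)
      ⊎ᵉ rec→ce (T₀.tag =ʳ litᶜ 4 ×ʳ T₀.Y =ʳ sndᶜ T₀.X)
      ⊎ᵉ (rec→ce (T₀.tag =ʳ litᶜ 5) ×ᵉ ((rec→ce (T₀.Y =ʳ litᶜ 1) ×ᵉ subᵉ cP (T₀.X ∷ᵛ tailᵛ (tailᵛ (tailᵛ idᵛ))))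
                                      ⊎ᵉ (rec→ce (T₀.Y =ʳ litᶜ 0) ×ᵉ subᵉ cN (T₀.X ∷ᵛ tailᵛ (tailᵛ (tailᵛ idᵛ))))))
      ⊎ᵉ (rec→ce (T₀.tag =ʳ litᶜ 6) ×ᵉ ∃ᵉ (T₁.H T₁.B T₁.X v0 ×ᵉ T₁.H T₁.A v0 T₁.Y))
      ⊎ᵉ (rec→ce (T₀.tag =ʳ litᶜ 7) ×ᵉ T₀.H T₀.A T₀.X (fstᶜ T₀.Y) ×ᵉ T₀.H T₀.B T₀.X (sndᶜ T₀.Y))
      ⊎ᵉ (rec→ce (T₀.tag =ʳ litᶜ 8) ×ᵉ rec→ce (sndᶜ T₀.X =ʳ litᶜ 0) ×ᵉ T₀.H T₀.A (fstᶜ T₀.X) T₀.Y)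
      ⊎ᵉ (rec→ce (T₀.tag =ʳ litᶜ 8) ×ᵉ ∃ᵉ (∃ᵉ (rec→ce (sndᶜ T₂.X =ʳ sucᶜ v1) ×ᵉ T₂.H T₂.C (pairᶜ (fstᶜ T₂.X) v1) v0
                                          ×ᵉ T₂.H T₂.B (pairᶜ (fstᶜ T₂.X) (pairᶜ v1 v0)) T₂.Y)))
      ⊎ᵉ (rec→ce (T₀.tag =ʳ litᶜ 9) ×ᵉ T₀.H (sndᶜ T₀.C) (pairᶜ T₀.X T₀.Y) (litᶜ 0)
          ×ᵉ ∀<ᵉ T₀.Y (∃ᵉ (T₂.H (sndᶜ T₂.C) (pairᶜ T₂.X v1) (sucᶜ v0)))))
      where
      module T₀ = Terms {m = suc (suc (suc k))} v0 v1 v2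
      module T₁ = Terms {m = suc (suc (suc (suc k)))} v1 v2 v3
      module T₂ = Terms {m = suc (suc (suc (suc (suc k))))} v2 v3 v4

    -- The oracle answers may depend on the parameters `ρ`. With a finite string as parameter this
    -- yields the use principle, and with a string of the forcing it yields the suggested facts
    -- about the next jump.
    runᵉ : CE Z (λ { (c ∷ x ∷ y ∷ ρ) → RunN (λ a → P (a ∷ ρ)) (λ a → N (a ∷ ρ)) c x y })
    runᵉ = ce-ext (λ { (c ∷ x ∷ y ∷ ρ) → mk⇔ (from (run⇔checked c x y)) (to (run⇔checked c x y)) })
      (∃ᵉ (∃ᵉ (∀<ᵉ v0 (subᵉ stepᵉ (v0 ∷ᵛ v1 ∷ᵛ v2 ∷ᵛ tailᵛ (tailᵛ (tailᵛ (tailᵛ (tailᵛ (tailᵛ idᵛ)))))))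
         ×ᵉ ∃ᵉ (rec→ce (v0 <ʳ v1) ×ᵉ rec→ce (seqAtᶜ v2 v0 =ʳ pairᶜ v3 (pairᶜ v4 v5))))))

-- Finite sets as binary numbers

par-01 : ∀ n → (par n ≡ 0) ⊎ (par n ≡ 1)
par-01 zero = inj₁ refl
par-01 (suc n) with par-01 n
... | inj₁ e = inj₂ (cong (1 ∸_) e)
... | inj₂ e = inj₁ (cong (1 ∸_) e)

par-half : ∀ n → n ≡ par n + (half n + half n)
par-half zero = refl
par-half (suc n) with par n | par-01 n | par-half n
... | .0 | inj₁ refl | ih = cong suc (trans ih (cong₂ _+_ (sym (+-identityʳ (half n))) (sym (+-identityʳ (half n)))))
... | .1 | inj₂ refl | ih = trans (cong suc ih) (sym (trans (cong₂ _+_ (+-comm (half n) 1) (+-comm (half n) 1)) (cong suc (+-suc (half n) (half n)))))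

par-suc-suc : ∀ n → par (suc (suc n)) ≡ par n
par-suc-suc n with par n | par-01 n
... | .0 | inj₁ refl = refl
... | .1 | inj₂ refl = refl

half-suc-suc : ∀ n → half (suc (suc n)) ≡ suc (half n)
half-suc-suc n with par n | par-01 n
... | .0 | inj₁ refl = trans (cong (_+ 1) (+-identityʳ (half n))) (+-comm (half n) 1)
... | .1 | inj₂ refl = trans (+-identityʳ (half n + 1)) (+-comm (half n) 1)

bitℕ : Bool → ℕ
bitℕ true  = 1
bitℕ false = 0

bit-suc : ∀ b m → bitℕ b + (suc m + suc m) ≡ suc (suc (bitℕ b + (m + m)))
bit-suc true  m = cong (λ z → suc (suc z)) (+-suc m m)
bit-suc false m = cong suc (+-suc m m)

par-bit : ∀ b m → par (bitℕ b + (m + m)) ≡ bitℕ b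
par-bit true  zero = refl
par-bit false zero = refl
par-bit b (suc m) = trans (cong par (bit-suc b m)) (trans (par-suc-suc (bitℕ b + (m + m))) (par-bit b m))

half-bit : ∀ b m → half (bitℕ b + (m + m)) ≡ m
half-bit true  zero = refl
half-bit false zero = refl
half-bit b (suc m) = trans (cong half (bit-suc b m)) (trans (half-suc-suc (bitℕ b + (m + m))) (cong suc (half-bit b m)))

Bit : ℕ → SetOf
Bit E x = par (shift E x) ≡ 1

Bit? : ∀ E x → Dec (Bit E x)
Bit? E x = par (shift E x) ≟ 1

shift-suc : ∀ E x → shift E (suc x) ≡ shift (half E) x
shift-suc E zero    = refl
shift-suc E (suc x) = cong half (shift-suc E x)

res : (ℕ → Bool) → ℕ → ℕ
res p zero    = 0
res p (suc ℓ) = bitℕ (p 0) + (res (p ∘ suc) ℓ + res (p ∘ suc) ℓ)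

shift-0 : ∀ x → shift 0 x ≡ 0
shift-0 zero = refl
shift-0 (suc x) = cong half (shift-0 x)

res-bit : ∀ p ℓ x → Bit (res p ℓ) x ⇔ ((x < ℓ) × (p x ≡ true))
res-bit p zero x = mk⇔ (λ b → ⊥-elim (0≢1+n (trans (cong par (sym (shift-0 x))) b))) (λ ())
res-bit p (suc ℓ) zero = mk⇔ (λ b → s≤s z≤n , bt (trans (sym (par-bit (p 0) m)) b)) (λ { (_ , e) → trans (par-bit (p 0) m) (cong bitℕ e) })
  where
  m : ℕ
  m = res (p ∘ suc) ℓ
  bt : ∀ {b} → bitℕ b ≡ 1 → b ≡ true
  bt {true} _ = refl
res-bit p (suc ℓ) (suc x) = mk⇔
  (λ b → let l , e = to (res-bit (p ∘ suc) ℓ x) (subst (λ z → par z ≡ 1) sh b) in s≤s l , e)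
  (λ { (s≤s l , e) → subst (λ z → par z ≡ 1) (sym sh) (from (res-bit (p ∘ suc) ℓ x) (l , e)) })
  where
  sh : shift (res p (suc ℓ)) (suc x) ≡ shift (res (p ∘ suc) ℓ) x
  sh = trans (shift-suc (res p (suc ℓ)) x) (cong (λ z → shift z x) (half-bit (p 0) (res (p ∘ suc) ℓ)))

res-< : ∀ p ℓ → res p ℓ < 2 ^ ℓ
res-< p zero    = s≤s z≤n
res-< p (suc ℓ) = ≤-trans (s≤s (+-monoˡ-≤ (r + r) (b≤1 (p 0)))) (≤-trans (≤-reflexive (cong suc (sym (+-suc r r))))
    (≤-trans (+-mono-≤ (res-< (p ∘ suc) ℓ) (res-< (p ∘ suc) ℓ)) (≤-reflexive (cong (2 ^ ℓ +_) (sym (+-identityʳ (2 ^ ℓ)))))))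
  where
  r : ℕ
  r = res (p ∘ suc) ℓ
  b≤1 : ∀ b → bitℕ b ≤ 1
  b≤1 true  = s≤s z≤n
  b≤1 false = z≤n

res-cong : ∀ {p q : ℕ → Bool} ℓ → (∀ x → x < ℓ → p x ≡ q x) → res p ℓ ≡ res q ℓ
res-cong zero    h = refl
res-cong (suc ℓ) h = cong₂ (λ b r → bitℕ b + (r + r)) (h 0 (s≤s z≤n)) (res-cong ℓ (λ x l → h (suc x) (s≤s l)))

-- This crude bound turns quantification over the elements of a finite set into bounded
-- quantification.
Bit-< : ∀ E x → Bit E x → x < E
Bit-< zero    x       b = ⊥-elim (0≢1+n (trans (cong par (sym (shift-0 x))) b))
Bit-< (suc E) zero    b = s≤s z≤n
Bit-< (suc E) (suc x) b = ≤-trans (s≤s le) (≤-trans (+-monoˡ-≤ h (≤-trans (s≤s z≤n) le)) (≤-trans (m≤n+m (h + h) (par (suc E))) (≤-reflexive (sym (par-half (suc E))))))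
  where
  h : ℕ
  h = half (suc E)
  le : suc x ≤ h
  le = Bit-< h x (trans (cong par (sym (shift-suc (suc E) x))) b)

module _ {Z : SetOf} where

  bitʳ : ∀ {k} {F G : Vec ℕ k → ℕ} → Comp Z F → Comp Z G → Rec Z (λ ρ → Bit (F ρ) (G ρ))
  bitʳ cf cg = parᶜ (shiftᶜ cf cg) =ʳ litᶜ 1

  ∀bitᵉ : ∀ {k} {G : Vec ℕ k → ℕ} {R : Vec ℕ (suc k) → Set} → Comp Z G → CE Z R → CE Z (λ ρ → ∀ x → Bit (G ρ) x → R (x ∷ ρ))
  ∀bitᵉ {G = G} {R} cg cr = ce-ext (λ ρ → mk⇔
      (λ h x b → [ (λ nb → ⊥-elim (nb b)) , id ]′ (h x (Bit-< (G ρ) x b)))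
      (λ h x _ → [ (λ b → inj₂ (h x b)) , inj₁ ]′ (toSum (Bit? (G ρ) x))))
    (∀<ᵉ cg (rec→ce (¬ʳ bitʳ (subᶜ cg (tailᵛ idᵛ)) v0) ⊎ᵉ cr))

  ∀bitʳ : ∀ {k} {G : Vec ℕ k → ℕ} {R : Vec ℕ (suc k) → Set} → Comp Z G → Rec Z R → Rec Z (λ ρ → ∀ x → Bit (G ρ) x → R (x ∷ ρ))
  ∀bitʳ {G = G} {R} cg cr = rec-ext (λ ρ → mk⇔
      (λ h x b → [ (λ nb → ⊥-elim (nb b)) , id ]′ (h x (Bit-< (G ρ) x b)))
      (λ h x _ → [ (λ b → inj₂ (h x b)) , inj₁ ]′ (toSum (Bit? (G ρ) x))))
    (∀<ʳ cg ((¬ʳ bitʳ (subᶜ cg (tailᵛ idᵛ)) v0) ⊎ʳ cr))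

-- Unbounded search, indices and the jump

least-zero : (d : ℕ → ℕ) (y : ℕ) → d y ≡ 0 → Σ ℕ λ m → (d m ≡ 0) × (∀ z → z < m → Σ ℕ λ w → d z ≡ suc w)
least-zero d y e with d 0 in eq
... | zero = 0 , eq , λ z ()
least-zero d zero    e | suc w = ⊥-elim (0≢1+n (trans (sym e) eq))
least-zero d (suc y) e | suc w with least-zero (d ∘ suc) y e
... | m , em , h = suc m , em , λ { zero _ → w , eq ; (suc z) (s≤s l) → h z l }

module _ {Z : SetOf} where

  searchC : Code → Code
  searchC d = muC (compC d (pairC sndC fstC))

  swap-eval : ∀ {k} {D : Vec ℕ (suc k) → ℕ} (c : Comp Z D) y ρ → Eval Z (compC (Comp.code c) (pairC sndC fstC)) (pair (enc ρ) y) (D (y ∷ ρ))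
  swap-eval (comp c h) y ρ = ev-comp (ev-pair (subst (Eval Z sndC (pair (enc ρ) y)) (unpair₂-pair (enc ρ) y) ev-snd)
    (subst (Eval Z fstC (pair (enc ρ) y)) (unpair₁-pair (enc ρ) y) ev-fst)) (h (y ∷ ρ))

  search-eval : ∀ {k} {D : Vec ℕ (suc k) → ℕ} (c : Comp Z D) ρ → (Σ ℕ λ y → D (y ∷ ρ) ≡ 0)
    → Σ ℕ λ m → (D (m ∷ ρ) ≡ 0) × Eval Z (searchC (Comp.code c)) (enc ρ) m
  search-eval {D = D} c ρ (y , e) with least-zero (λ y → D (y ∷ ρ)) y e
  ... | m , em , h = m , em , ev-mu (subst (Eval Z _ (pair (enc ρ) m)) em (swap-eval c m ρ))
                                    (λ z l → proj₁ (h z l) , subst (Eval Z _ (pair (enc ρ) z)) (proj₂ (h z l)) (swap-eval c z ρ))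

  searchᶜ : ∀ {k} {D : Vec ℕ (suc k) → ℕ} → Comp Z D → (∀ ρ → Σ ℕ λ y → D (y ∷ ρ) ≡ 0) → Σ (Vec ℕ k → ℕ) λ g → Comp Z g × (∀ ρ → D (g ρ ∷ ρ) ≡ 0)
  searchᶜ c tot = (λ ρ → proj₁ (s ρ)) , comp (searchC (Comp.code c)) (λ ρ → proj₂ (proj₂ (s ρ))) , (λ ρ → proj₁ (proj₂ (s ρ)))
    where
    s = λ ρ → search-eval c ρ (tot ρ)

  halting-index : ∀ {k} {R : Vec ℕ k → Set} → CE Z R → Σ ℕ λ e → ∀ ρ → R ρ ⇔ Halts Z (decode e) (enc ρ)
  halting-index {R = R} (ce {D} c s) = encode (searchC (Comp.code c)) , λ ρ → subst (λ C → R ρ ⇔ Halts Z C (enc ρ)) (sym (decode-encode (searchC (Comp.code c))))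
    (mk⇔ (λ r → let m , _ , ev = search-eval c ρ (to (s ρ) r) in m , ev) (λ { (m , ev-mu ev _) → from (s ρ) (m , eval-deterministic (swap-eval c m ρ) ev) }))

-- `node 6 c (constN n)` codes the program that ignores its input and runs `c` on `n`. It reduces
-- halting at an arbitrary input to `jump`, whose programs run on their own index.
constN : ℕ → ℕ
constN zero    = encode zeroC
constN (suc n) = node 6 (encode succC) (constN n)

constN-halts : ∀ {Z} c n x → Halts Z (decode (node 6 c (constN n))) x ⇔ Halts Z (decode c) n
constN-halts {Z} c n x = subst (λ C → Halts Z C x ⇔ Halts Z (decode c) n) (sym eq) (mk⇔
    (λ { (y , ev-comp d e) → y , subst (λ m → Eval Z (decode c) m y) (eval-deterministic d (const-eval n)) e })
    (λ { (y , e) → y , ev-comp (const-eval n) e }))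
  where
  node-decode : ∀ a b → decode (node 6 a b) ≡ compC (decode a) (decode b)
  node-decode a b = trans (decode-pair 6 (pair a b)) (cong₂ (λ u v → compC (decode u) (decode v)) (fst₂-node 6 a b) (snd₂-node 6 a b))
  eq : decode (node 6 c (constN n)) ≡ compC (decode c) (decode (constN n))
  eq = node-decode c (constN n)
  const-eval : ∀ n → Eval Z (decode (constN n)) x n
  const-eval zero    = ev-zero
  const-eval (suc n) = subst (λ C → Eval Z C x (suc n)) (sym (node-decode (encode succC) (constN n)))
    (ev-comp (const-eval n) (subst (λ C → Eval Z C n (suc n)) (sym (decode-encode succC)) ev-succ))

constNᶜ : ∀ {Z k} {F : Vec ℕ k → ℕ} → Comp Z F → Comp Z (λ ρ → constN (F ρ))
constNᶜ = lift₁ {h = constN} (comp-ext (λ { (a ∷ []) → go a }) (precᶜ (litᶜ (encode zeroC)) (pairᶜ (litᶜ 6) (pairᶜ (litᶜ (encode succC)) v1))))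
  where
  go : ∀ a → prec (λ ρ → encode zeroC) (λ ρ → pair 6 (pair (encode succC) (lookup ρ (suc zero)))) (a ∷ []) ≡ constN a
  go zero    = refl
  go (suc a) = cong (node 6 (encode succC)) (go a)

-- Classical logic, Turing reducibility, jumps and joins.

module Classical (em : ExcludedMiddle 0ℓ) where

  χ : SetOf → ℕ → Bool
  χ S x = ⌊ em {S x} ⌋

  χ-spec : ∀ S x → (χ S x ≡ true) ⇔ S x
  χ-spec S x with em {S x}
  ... | yes s = mk⇔ (λ _ → s) (λ _ → refl)
  ... | no ns = mk⇔ (λ ()) (λ s → ⊥-elim (ns s))

  dne : {A : Set} → ¬ ¬ A → A
  dne {A} nn with em {A}
  ... | yes a = a
  ... | no na = ⊥-elim (nn na)

  ¬∀→∃¬ : {A : Set} {P : A → Set} → ¬ (∀ x → P x) → Σ A λ x → ¬ P x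
  ¬∀→∃¬ {A} {P} h with em {Σ A λ x → ¬ P x}
  ... | yes p = p
  ... | no np = ⊥-elim (h (λ x → dne (λ n → np (x , n))))

  fin : SetOf → ℕ → ℕ
  fin S ℓ = res (χ S) ℓ

  fin-bit : ∀ S ℓ x → Bit (fin S ℓ) x ⇔ ((x < ℓ) × S x)
  fin-bit S ℓ x = mk⇔ (λ b → let l , e = to (res-bit (χ S) ℓ x) b in l , to (χ-spec S x) e)
                      (λ { (l , s) → from (res-bit (χ S) ℓ x) (l , from (χ-spec S x) s) })

  fin-< : ∀ S ℓ → fin S ℓ < 2 ^ ℓ
  fin-< S ℓ = res-< (χ S) ℓ

  oracleʳ : ∀ {Z k} {F : Vec ℕ k → ℕ} → Comp Z F → Rec Z (λ ρ → Z (F ρ))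
  oracleʳ {Z} {F = F} (comp c h) = rec (litᶜ 1 ∸ᶜ comp {F = λ ρ → bitℕ (χ Z (F ρ))} (compC oracC c) (λ ρ → ev-comp (h ρ) (ans (F ρ)))) (λ ρ → spec (F ρ))
    where
    ans : ∀ x → Eval Z oracC x (bitℕ (χ Z x))
    ans x with em {Z x}
    ... | yes z = ev-or1 z
    ... | no nz = ev-or0 nz
    spec : ∀ x → Z x ⇔ (1 ∸ bitℕ (χ Z x) ≡ 0)
    spec x with em {Z x}
    ... | yes z = mk⇔ (λ _ → refl) (λ _ → z)
    ... | no nz = mk⇔ (λ z → ⊥-elim (nz z)) (λ ())

  rec→computable : ∀ {Z} {R : Vec ℕ 1 → Set} → Rec Z R → Computable Z (λ x → R (x ∷ []))
  rec→computable {Z} {R} (rec {D} c s) = compC (Comp.code d) (pairC idC zeroC) ,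
      λ x → (λ r → ev x (cong (1 ∸_) (to (s (x ∷ [])) r))) , (λ nr → ev x (pos (D (x ∷ [])) (λ e → nr (from (s (x ∷ [])) e))))
    where
    d : Comp Z (λ ρ → 1 ∸ D ρ)
    d = litᶜ 1 ∸ᶜ c
    ev : ∀ x {v} → 1 ∸ D (x ∷ []) ≡ v → Eval Z (compC (Comp.code d) (pairC idC zeroC)) x v
    ev x refl = ev-comp (ev-pair ev-id ev-zero) (Comp.computes d (x ∷ []))
    pos : ∀ n → ¬ (n ≡ 0) → 1 ∸ n ≡ 0
    pos zero    h = ⊥-elim (h refl)
    pos (suc n) h = 0∸n≡0 n

  -- Post's theorem. The search for a zero of the product terminates because one of the two
  -- relations holds; testing the first factor at the number found tells which.
  ce-co-ce→rec : ∀ {Z k} {R : Vec ℕ k → Set} → CE Z R → CE Z (λ ρ → ¬ R ρ) → Rec Z R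
  ce-co-ce→rec {Z} {k} {R} (ce {D} c s) (ce {E} d t) with searchᶜ (c *ᶜ d) total
    where
    total : ∀ ρ → Σ ℕ λ y → D (y ∷ ρ) * E (y ∷ ρ) ≡ 0
    total ρ with em {R ρ}
    ... | yes r = let y , p = to (s ρ) r in y , cong (_* E (y ∷ ρ)) p
    ... | no nr = let y , p = to (t ρ) nr in y , trans (cong (D (y ∷ ρ) *_) p) (*-zeroʳ (D (y ∷ ρ)))
  ... | g , cg , hg = rec (subᶜ c (cg ∷ᵛ idᵛ)) (λ ρ → mk⇔
      (λ r → [ id , (λ e → ⊥-elim (from (t ρ) (g ρ , e) r)) ]′ (m*n≡0⇒m≡0∨n≡0 (D (g ρ ∷ ρ)) (hg ρ)))
      (λ e → from (s ρ) (g ρ , e)))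

  record _≤T_ (Z Y : SetOf) : Set where
    constructor reduce
    field
      reduction : Rec Y {1} (λ ρ → Z (lookup ρ zero))
  open _≤T_

  ≤T-refl : ∀ {Z} → Z ≤T Z
  ≤T-refl = reduce (oracleʳ v0)

  ≤T-at : ∀ {Z Y k} {F : Vec ℕ k → ℕ} → Z ≤T Y → Comp Y F → Rec Y (λ ρ → Z (F ρ))
  ≤T-at r cf = subʳ (reduction r) (cf ∷ᵛ []ᵛ)

  haltsᵉ : ∀ {Z Y k} {F G : Vec ℕ k → ℕ} → Z ≤T Y → Comp Y F → Comp Y G → CE Y (λ ρ → Halts Z (decode (F ρ)) (G ρ))
  haltsᵉ {Z} {Y} {F = F} {G} r cf cg = ce-ext (λ ρ → mk⇔ (λ { (y , d) → y , run→eval d }) (λ { (y , d) → y , eval→run d }))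
    (∃ᵉ (subᵉ (runᵉ {k = 0} (rec→ce (≤T-at r v0)) (rec→ce (¬ʳ ≤T-at r v0))) (subᶜ cf (tailᵛ idᵛ) ∷ᵛ subᶜ cg (tailᵛ idᵛ) ∷ᵛ v0 ∷ᵛ []ᵛ)))

  ce-relative : ∀ {Z Y k} {R : Vec ℕ k → Set} → Z ≤T Y → CE Z R → CE Y R
  ce-relative {Z} {Y} {k} {R} r cr = go (halting-index cr)
    where
    go : (Σ ℕ λ e → ∀ ρ → R ρ ⇔ Halts Z (decode e) (enc ρ)) → CE Y R
    go (e , h) = ce-ext (λ ρ → mk⇔ (from (h ρ)) (to (h ρ))) (haltsᵉ r (litᶜ e) encᶜ)

  rec-relative : ∀ {Z Y k} {R : Vec ℕ k → Set} → Z ≤T Y → Rec Z R → Rec Y R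
  rec-relative r cr = ce-co-ce→rec (ce-relative r (rec→ce cr)) (ce-relative r (rec→ce (¬ʳ cr)))

  ≤T-trans : ∀ {X Y Z} → X ≤T Y → Y ≤T Z → X ≤T Z
  ≤T-trans p q = reduce (rec-relative q (reduction p))

  ce→rec-jump : ∀ {Z k} {R : Vec ℕ k → Set} → CE Z R → Rec (jump Z) R
  ce→rec-jump {Z} {k} {R} cr = go (halting-index cr)
    where
    go : (Σ ℕ λ e → ∀ ρ → R ρ ⇔ Halts Z (decode e) (enc ρ)) → Rec (jump Z) R
    go (e , h) = rec-ext {R = λ ρ → jump Z (node 6 e (constN (enc ρ)))}
      (λ ρ → let g = constN-halts {Z} e (enc ρ) (node 6 e (constN (enc ρ))) in mk⇔ (from (h ρ) ∘ to g) (from g ∘ to (h ρ)))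
      (oracleʳ {jump Z} {F = λ ρ → node 6 e (constN (enc ρ))} (pairᶜ {F = λ _ → 6} {G = λ ρ → pair e (constN (enc ρ))} (litᶜ 6) (pairᶜ {F = λ _ → e} {G = λ ρ → constN (enc ρ)} (litᶜ e) (constNᶜ {F = enc} encᶜ))))

  ≤T-jump : ∀ {Z} → Z ≤T jump Z
  ≤T-jump = reduce (ce→rec-jump (rec→ce (oracleʳ v0)))

  jump-mono : ∀ {Z Y} → Z ≤T Y → jump Z ≤T jump Y
  jump-mono r = reduce (ce→rec-jump (haltsᵉ r v0 v0))

  jumpN-mono : ∀ j {Z Y} → Z ≤T Y → jumpN j Z ≤T jumpN j Y
  jumpN-mono zero    r = r
  jumpN-mono (suc j) r = jump-mono (jumpN-mono j r)

  jumpN-jump : ∀ j Z → jumpN (suc j) Z ≡ jumpN j (jump Z)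
  jumpN-jump zero    Z = refl
  jumpN-jump (suc j) Z = cong jump (jumpN-jump j Z)

  data _⊕_ (Z Y : SetOf) (z : ℕ) : Set where
    left  : unpair₁ z ≡ 0 → Z (unpair₂ z) → (Z ⊕ Y) z
    right : ¬ (unpair₁ z ≡ 0) → Y (unpair₂ z) → (Z ⊕ Y) z

  ⊕-left : ∀ {Z Y} → Z ≤T (Z ⊕ Y)
  ⊕-left {Z} {Y} = reduce (rec-ext (λ { (x ∷ []) → mk⇔ (λ { (left _ z) → subst Z (unpair₂-pair 0 x) z ; (right n _) → ⊥-elim (n (unpair₁-pair 0 x)) })
      (λ z → left (unpair₁-pair 0 x) (subst Z (sym (unpair₂-pair 0 x)) z)) })
    (oracleʳ (pairᶜ (litᶜ 0) v0)))

  ⊕-right : ∀ {Z Y} → Y ≤T (Z ⊕ Y)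
  ⊕-right {Z} {Y} = reduce (rec-ext (λ { (x ∷ []) → mk⇔ (λ { (right _ z) → subst Y (unpair₂-pair 1 x) z ; (left n _) → ⊥-elim (1+n≢0 (trans (sym (unpair₁-pair 1 x)) n)) })
      (λ z → right (λ e → 1+n≢0 (trans (sym (unpair₁-pair 1 x)) e)) (subst Y (sym (unpair₂-pair 1 x)) z)) })
    (oracleʳ (pairᶜ (litᶜ 1) v0)))

  ⊕-lub : ∀ {Z Y W} → Z ≤T W → Y ≤T W → (Z ⊕ Y) ≤T W
  ⊕-lub r s = reduce (rec-ext (λ { (x ∷ []) → mk⇔ (λ { (inj₁ (e , z)) → left e z ; (inj₂ (n , y)) → right n y }) (λ { (left e z) → inj₁ (e , z) ; (right n y) → inj₂ (n , y) }) })
    ((fstᶜ v0 =ʳ litᶜ 0 ×ʳ ≤T-at r (sndᶜ v0)) ⊎ʳ ((¬ʳ (fstᶜ v0 =ʳ litᶜ 0)) ×ʳ ≤T-at s (sndᶜ v0))))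

  CE₁ : SetOf → (ℕ → Set) → Set
  CE₁ Z Q = CE Z {1} (λ ρ → Q (lookup ρ zero))

  CE₂ : SetOf → (ℕ → ℕ → Set) → Set
  CE₂ Z Q = CE Z {2} (λ ρ → Q (lookup ρ zero) (lookup ρ (suc zero)))

  CE₃ : SetOf → (ℕ → ℕ → ℕ → Set) → Set
  CE₃ Z Q = CE Z {3} (λ ρ → Q (lookup ρ zero) (lookup ρ (suc zero)) (lookup ρ (suc (suc zero))))

  at₁ : ∀ {Z k} {F : Vec ℕ k → ℕ} (Q : ℕ → Set) → CE₁ Z Q → Comp Z F → CE Z (λ ρ → Q (F ρ))
  at₁ Q c f = subᵉ c (f ∷ᵛ []ᵛ)

  at₂ : ∀ {Z k} {F G : Vec ℕ k → ℕ} (Q : ℕ → ℕ → Set) → CE₂ Z Q → Comp Z F → Comp Z G → CE Z (λ ρ → Q (F ρ) (G ρ))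
  at₂ Q c f g = subᵉ c (f ∷ᵛ g ∷ᵛ []ᵛ)

  at₃ : ∀ {Z k} {F G H : Vec ℕ k → ℕ} (Q : ℕ → ℕ → ℕ → Set) → CE₃ Z Q → Comp Z F → Comp Z G → Comp Z H → CE Z (λ ρ → Q (F ρ) (G ρ) (H ρ))
  at₃ Q c f g h = subᵉ c (f ∷ᵛ g ∷ᵛ h ∷ᵛ []ᵛ)

  ⟦_⟧ : (ℕ → Bool) → SetOf
  ⟦ y ⟧ x = y x ≡ true

  -- Compactness of Cantor space

  Agree : ℕ → ℕ → SetOf → Set
  Agree ℓ E Y = ∀ x → x < ℓ → Bit E x ⇔ Y x

  -- Q E ℓ is a property of the string of length ℓ coded by E, inherited by longer strings:
  -- the strings with Q form an open set, and Avoids Q is its complement.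
  Local : (ℕ → ℕ → Set) → Set
  Local Q = ∀ {E E' ℓ ℓ'} → ℓ ≤ ℓ' → Agree ℓ E (Bit E') → Q E ℓ → Q E' ℓ'

  Avoids : (ℕ → ℕ → Set) → SetOf → Set
  Avoids Q Y = ∀ E ℓ → Agree ℓ E Y → ¬ Q E ℓ

  -- By compactness this says that the open set of `Q` is the whole of Cantor space, but it is c.e.
  -- when `Q` is: emptiness of a Π₁ class is noticed at a finite length.
  Covers : (ℕ → ℕ → Set) → Set
  Covers Q = Σ ℕ λ ℓ → ∀ E → E < 2 ^ ℓ → Q E ℓ

  agree-fin : ∀ Y ℓ → Agree ℓ (fin Y ℓ) Y
  agree-fin Y ℓ x l = mk⇔ (λ b → proj₂ (to (fin-bit Y ℓ x) b)) (λ y → from (fin-bit Y ℓ x) (l , y))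

  agree-via : ∀ {ℓ E E' Y} → Agree ℓ E Y → Agree ℓ E' Y → Agree ℓ E (Bit E')
  agree-via p q x l = mk⇔ (from (q x l) ∘ to (p x l)) (from (p x l) ∘ to (q x l))

  covers-avoids : ∀ {Q} → Covers Q → ∀ Y → ¬ Avoids Q Y
  covers-avoids (ℓ , c) Y a = a (fin Y ℓ) ℓ (agree-fin Y ℓ) (c (fin Y ℓ) (fin-< Y ℓ))

  module König {Q : ℕ → ℕ → Set} (loc : Local Q) (inf : ∀ ℓ → Σ ℕ λ E → ¬ Q E ℓ) where

    Extendible : ℕ → (ℕ → Bool) → Set
    Extendible ℓ p = ∀ ℓ' → Σ ℕ λ E → Agree ℓ E ⟦ p ⟧ × ¬ Q E ℓ'

    update : (ℕ → Bool) → ℕ → Bool → ℕ → Bool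
    update p ℓ b x with x ≟ ℓ
    ... | yes _ = b
    ... | no  _ = p x

    update-same : ∀ p ℓ b → update p ℓ b ℓ ≡ b
    update-same p ℓ b with ℓ ≟ ℓ
    ... | yes _ = refl
    ... | no  n = ⊥-elim (n refl)

    update-other : ∀ p ℓ b x → x < ℓ → update p ℓ b x ≡ p x
    update-other p ℓ b x l with x ≟ ℓ
    ... | yes refl = ⊥-elim (<-irrefl refl l)
    ... | no  _    = refl

    agree-update : ∀ {ℓ E p} b → Agree ℓ E ⟦ p ⟧ → (Bit E ℓ ⇔ (b ≡ true)) → Agree (suc ℓ) E ⟦ update p ℓ b ⟧
    agree-update {ℓ} {E} {p} b ag h x (s≤s x≤ℓ) with m≤n⇒m<n∨m≡n x≤ℓ
    ... | inj₁ l    = mk⇔ (λ bt → trans (update-other p ℓ b x l) (to (ag x l) bt)) (λ e → from (ag x l) (trans (sym (update-other p ℓ b x l)) e))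
    ... | inj₂ refl = mk⇔ (λ bt → trans (update-same p ℓ b) (to h bt)) (λ e → from h (trans (sym (update-same p ℓ b)) e))

    extend : ∀ ℓ p → Extendible ℓ p → Σ Bool λ b → Extendible (suc ℓ) (update p ℓ b)
    extend ℓ p ext with em {Extendible (suc ℓ) (update p ℓ true)}
    ... | yes e = true , e
    ... | no ne with ¬∀→∃¬ ne
    ...   | ℓ₁ , n₁ = false , go
      where
      go : Extendible (suc ℓ) (update p ℓ false)
      -- A string that avoids `Q` at length `ℓ₁ + ℓ'` avoids it at `ℓ₁`, hence cannot continue with
      -- `true`, and also at `ℓ'`, as asked for.
      go ℓ' with ext (ℓ₁ + ℓ')
      ... | E , ag , nq = E , agree-update false ag (mk⇔ (λ bt → ⊥-elim (n₁ (E , agree-update true ag (mk⇔ (λ _ → refl) (λ _ → bt)) ,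
                            λ q → nq (loc (m≤m+n ℓ₁ ℓ') (λ x _ → mk⇔ id id) q)))) (λ ()))
                          , λ q → nq (loc (m≤n+m ℓ' ℓ₁) (λ x _ → mk⇔ id id) q)

    prefixes : ∀ ℓ → Σ (ℕ → Bool) (Extendible ℓ)
    prefixes zero = (λ _ → false) , λ ℓ' → proj₁ (inf ℓ') , (λ x ()) , proj₂ (inf ℓ')
    prefixes (suc ℓ) with prefixes ℓ
    ... | p , ext with extend ℓ p ext
    ...   | b , ext' = update p ℓ b , ext'

    path : ℕ → Bool
    path x = proj₁ (prefixes (suc x)) x

    prefixes-path : ∀ ℓ x → x < ℓ → proj₁ (prefixes ℓ) x ≡ path x
    prefixes-path (suc ℓ) x (s≤s x≤ℓ) with m≤n⇒m<n∨m≡n x≤ℓ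
    ... | inj₁ l    = trans (update-other (proj₁ (prefixes ℓ)) ℓ _ x l) (prefixes-path ℓ x l)
    ... | inj₂ refl = refl

    path-avoids : Avoids Q ⟦ path ⟧
    path-avoids E ℓ ag q with proj₂ (prefixes ℓ) ℓ
    ... | E' , ag' , nq = nq (loc ≤-refl (agree-via {Y = ⟦ path ⟧} ag (λ x l → mk⇔ (λ b → trans (sym (prefixes-path ℓ x l)) (to (ag' x l) b))
                                                                   (λ e → from (ag' x l) (trans (prefixes-path ℓ x l) e)))) q)

  compact : ∀ {Q} → Local Q → ¬ Covers Q → Σ (ℕ → Bool) λ y → Avoids Q ⟦ y ⟧
  compact {Q} loc nc = path , path-avoids
    where
    inf : ∀ ℓ → Σ ℕ λ E → ¬ Q E ℓ
    inf ℓ with ¬∀→∃¬ {P = λ E → E < 2 ^ ℓ → Q E ℓ} (λ h → nc (ℓ , h))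
    ... | E , n = E , λ q → n (λ _ → q)
    open König loc inf

  bound-all : ∀ {R : ℕ → ℕ → Set} → (∀ {i j E} → i ≤ j → R i E → R j E) → ∀ b → (∀ E → E < b → Σ ℕ λ i → R i E) → Σ ℕ λ i → ∀ E → E < b → R i E
  bound-all mono zero    h = 0 , λ E ()
  bound-all {R} mono (suc b) h with bound-all {R} mono b (λ E l → h E (m<n⇒m<1+n l)) | h b ≤-refl
  ... | i , hi | j , hj = i + j , λ { E (s≤s E≤b) → [ (λ l → mono (m≤m+n i j) (hi E l)) , (λ { refl → mono (m≤n+m j i) hj }) ]′ (m≤n⇒m<n∨m≡n E≤b) }

  -- If the union covered, it would do so at one length. Only finitely many strings have that
  -- length, so by monotonicity a single member of the chain would already cover.
  compact-chain : (q : ℕ → ℕ → ℕ → Set) → (∀ i → Local (q i)) → (∀ {i j E ℓ} → i ≤ j → q i E ℓ → q j E ℓ) → (∀ i → ¬ Covers (q i))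
    → Σ (ℕ → Bool) λ y → ∀ i → Avoids (q i) ⟦ y ⟧
  compact-chain q loc mono nc with compact {λ E ℓ → Σ ℕ λ i → q i E ℓ} (λ le ag → λ { (i , h) → i , loc i le ag h })
      (λ { (ℓ , c) → let i , h = bound-all {λ i E → q i E ℓ} mono (2 ^ ℓ) c in nc i (ℓ , h) })
  ... | y , av = y , λ i E ℓ ag h → av E ℓ ag (i , h)

  coversᵉ : ∀ {Z k} (Q : ℕ → ℕ → Vec ℕ k → Set) → CE Z {suc (suc k)} (λ ρ → Q (lookup ρ zero) (lookup ρ (suc zero)) (tail (tail ρ))) → CE Z (λ ρ → Covers (λ E ℓ → Q E ℓ ρ))
  coversᵉ Q c = ∃ᵉ (∀<ᵉ (2^ᶜ v0) c)

  -- The use of a computation with oracle Z ⊕ Y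

  module Use (Z : SetOf) where

    Pos Neg : ℕ → ℕ → SetOf
    Pos E ℓ a = ((unpair₁ a ≡ 0) × Z (unpair₂ a)) ⊎ (¬ (unpair₁ a ≡ 0) × (unpair₂ a < ℓ) × Bit E (unpair₂ a))
    Neg E ℓ a = ((unpair₁ a ≡ 0) × ¬ Z (unpair₂ a)) ⊎ (¬ (unpair₁ a ≡ 0) × (unpair₂ a < ℓ) × ¬ Bit E (unpair₂ a))

    Conv : ℕ → ℕ → ℕ → ℕ → Set
    Conv e x E ℓ = Σ ℕ λ y → RunN (Pos E ℓ) (Neg E ℓ) e x y

    conv-local : ∀ e x → Local (Conv e x)
    conv-local e x {E} {E'} {ℓ} {ℓ'} le ag (y , r) = y , run-mono
      (λ { a (inj₁ p) → inj₁ p ; a (inj₂ (n , l , b)) → inj₂ (n , ≤-trans l le , to (ag _ l) b) })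
      (λ { a (inj₁ p) → inj₁ p ; a (inj₂ (n , l , b)) → inj₂ (n , ≤-trans l le , λ b' → b (from (ag _ l) b')) }) r

    convᵉ : CE Z {4} (λ ρ → Conv (lookup ρ zero) (lookup ρ (suc zero)) (lookup ρ (suc (suc zero))) (lookup ρ (suc (suc (suc zero)))))
    convᵉ = ce-ext (λ { (e ∷ x ∷ E ∷ ℓ ∷ []) → mk⇔ id id })
      (∃ᵉ (subᵉ (runᵉ {k = 2} {P = λ ρ → Pos (lookup ρ (suc zero)) (lookup ρ (suc (suc zero))) (lookup ρ zero)}
                              {N = λ ρ → Neg (lookup ρ (suc zero)) (lookup ρ (suc (suc zero))) (lookup ρ zero)}
        (rec→ce ((fstᶜ v0 =ʳ litᶜ 0 ×ʳ oracleʳ (sndᶜ v0)) ⊎ʳ ((¬ʳ (fstᶜ v0 =ʳ litᶜ 0)) ×ʳ sndᶜ v0 <ʳ v2 ×ʳ bitʳ v1 (sndᶜ v0))))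
        (rec→ce ((fstᶜ v0 =ʳ litᶜ 0 ×ʳ ¬ʳ oracleʳ (sndᶜ v0)) ⊎ʳ ((¬ʳ (fstᶜ v0 =ʳ litᶜ 0)) ×ʳ sndᶜ v0 <ʳ v2 ×ʳ ¬ʳ bitʳ v1 (sndᶜ v0)))))
        (v1 ∷ᵛ v2 ∷ᵛ v0 ∷ᵛ v3 ∷ᵛ v4 ∷ᵛ []ᵛ)))

    use : ∀ Y e x → Halts (Z ⊕ Y) (decode e) x → Σ ℕ λ ℓ → Conv e x (fin Y ℓ) ℓ
    use Y e x (y , ev) with run-eventually (λ j → Pos (fin Y j) j) (λ j → Neg (fin Y j) j)
        (λ { a (left e p) → 0 , λ j _ → inj₁ (e , p) ; a (right n p) → suc (unpair₂ a) , λ j l → inj₂ (n , l , from (fin-bit Y j _) (l , p)) })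
        (λ a na → neg a na (unpair₁ a ≟ 0)) (eval→run ev)
      where
      neg : ∀ a → ¬ (Z ⊕ Y) a → Dec (unpair₁ a ≡ 0) → Σ ℕ λ i → ∀ j → i ≤ j → Neg (fin Y j) j a
      neg a na (yes e) = 0 , λ j _ → inj₁ (e , λ z → na (left e z))
      neg a na (no n)  = suc (unpair₂ a) , λ j l → inj₂ (n , l , λ b → na (right n (proj₂ (to (fin-bit Y j _) b))))
    ... | ℓ , h = ℓ , y , h ℓ ≤-refl

    unuse : ∀ Y e x {E ℓ} → Agree ℓ E Y → Conv e x E ℓ → Halts (Z ⊕ Y) (decode e) x
    unuse Y e x ag (y , r) = y , run→eval (run-mono
      (λ { a (inj₁ (e , p)) → left e p ; a (inj₂ (n , l , b)) → right n (to (ag _ l) b) })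
      (λ { a (inj₁ (e , nz)) (left _ z) → nz z ; a (inj₁ (e , nz)) (right n _) → n e
         ; a (inj₂ (n , l , nb)) (left e _) → n e ; a (inj₂ (n , l , nb)) (right _ y) → nb (from (ag _ l) y) }) r)

  -- Basis theorems for the Π₁(Z) class of the sets avoiding Q₀

  module Basis (Z : SetOf) (Q₀ : ℕ → ℕ → Set) (Q₀-ce : CE₂ Z Q₀) (Q₀-local : Local Q₀) (Q₀-proper : ¬ Covers Q₀) where
    open Use Z

    K : ℕ → ℕ → ℕ → Set
    K a E ℓ = Conv (unpair₁ a) (unpair₂ a) E ℓ

    K-ce : CE₃ Z K
    K-ce = subᵉ convᵉ (fstᶜ v0 ∷ᵛ sndᶜ v0 ∷ᵛ v1 ∷ᵛ v2 ∷ᵛ []ᵛ)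

    K-halts : ∀ Y a {E ℓ} → Agree ℓ E Y → K a E ℓ → Halts (Z ⊕ Y) (decode (unpair₁ a)) (unpair₂ a)
    K-halts Y a = unuse Y (unpair₁ a) (unpair₂ a)

    halts-K : ∀ Y e x → Halts (Z ⊕ Y) (decode e) x → Σ ℕ λ ℓ → K (pair e x) (fin Y ℓ) ℓ
    halts-K Y e x h with use Y e x h
    ... | ℓ , k = ℓ , subst₂ (λ e x → Conv e x (fin Y ℓ) ℓ) (sym (unpair₁-pair e x)) (sym (unpair₂-pair e x)) k

    K-local : ∀ a → Local (K a)
    K-local a = conv-local (unpair₁ a) (unpair₂ a)

    -- Avoiding this means belonging to the class and making every computation listed in `D`
    -- diverge. Both basis theorems shrink the class in this way only.
    Forbid : SetOf → ℕ → ℕ → Set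
    Forbid D E ℓ = Q₀ E ℓ ⊎ Σ ℕ λ a → D a × K a E ℓ

    forbid-local : ∀ D → Local (Forbid D)
    forbid-local D le ag (inj₁ q)           = inj₁ (Q₀-local le ag q)
    forbid-local D le ag (inj₂ (a , d , k)) = inj₂ (a , d , K-local a le ag k)

    forbid-mono : ∀ {D D' E ℓ} → (∀ a → D a → D' a) → Forbid D E ℓ → Forbid D' E ℓ
    forbid-mono s (inj₁ q)           = inj₁ q
    forbid-mono s (inj₂ (a , d , k)) = inj₂ (a , s a d , k)

    covers-mono : ∀ {Q Q' : ℕ → ℕ → Set} → (∀ {E ℓ} → Q E ℓ → Q' E ℓ) → Covers Q → Covers Q'
    covers-mono s (ℓ , h) = ℓ , λ E l → s (h E l)

    module ConeAvoidance (B : SetOf) (B-hard : ¬ CE₁ Z B) where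

      -- the input of the e-th relation is enc (x ∷ [])
      Point : ℕ → ℕ → ℕ
      Point e x = pair e (pair x 0)

      Answer : ℕ → ℕ → ℕ → Set
      Answer e d x = (¬ B x × Covers (λ E ℓ → Forbid (Bit d) E ℓ ⊎ K (Point e x) E ℓ)) ⊎ (B x × Bit d (Point e x))

      abstract
        -- The set of `x` on which the computation converges throughout the current class is c.e. by
        -- compactness, hence is not `B`. At an `x` outside `B` in this set nothing has to be done;
        -- at an `x` of `B` outside it, forcing divergence keeps the class nonempty.
        step : ∀ e d → ¬ Covers (Forbid (Bit d)) → Σ ℕ λ d' → (∀ a → Bit d a → Bit d' a) × ¬ Covers (Forbid (Bit d')) × Σ ℕ (Answer e d')
        step e d nc = go (¬∀→∃¬ {P = λ x → B x ⇔ S x} (λ h → B-hard (ce-ext (λ { (x ∷ []) → mk⇔ (from (h x)) (to (h x)) }) S-ce)))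
          where
          S : ℕ → Set
          S x = Covers (λ E ℓ → Forbid (Bit d) E ℓ ⊎ K (Point e x) E ℓ)
          S-ce : CE₁ Z S
          S-ce = ce-ext (λ { (x ∷ []) → mk⇔ id id }) (coversᵉ {k = 1} (λ E ℓ ρ → Forbid (Bit d) E ℓ ⊎ K (Point e (lookup ρ zero)) E ℓ)
            (ce-ext (λ { (E ∷ ℓ ∷ x ∷ []) → mk⇔ id id })
              ((at₂ Q₀ Q₀-ce v0 v1 ⊎ᵉ ∃ᵉ (rec→ce (bitʳ (litᶜ d) v0) ×ᵉ at₃ K K-ce v0 v1 v2)) ⊎ᵉ at₃ K K-ce (pairᶜ (litᶜ e) (pairᶜ v2 (litᶜ 0))) v0 v1)))
          go : (Σ ℕ λ x → ¬ (B x ⇔ S x)) → Σ ℕ λ d' → (∀ a → Bit d a → Bit d' a) × ¬ Covers (Forbid (Bit d')) × Σ ℕ (Answer e d')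
          go (x , ne) with em {B x} | em {S x}
          ... | yes b | yes s = ⊥-elim (ne (mk⇔ (λ _ → s) (λ _ → b)))
          ... | no nb | no ns = ⊥-elim (ne (mk⇔ (λ b → ⊥-elim (nb b)) (λ s → ⊥-elim (ns s))))
          ... | no nb | yes s = d , (λ a → id) , nc , x , inj₁ (nb , s)
          ... | yes b | no ns = d' , (λ a bt → from (d'-bit a) (inj₁ bt)) , (λ c → ns (covers-mono back c)) , x , inj₂ (b , from (d'-bit p) (inj₂ refl))
            where
            p d' : ℕ
            p = Point e x
            New : SetOf
            New a = Bit d a ⊎ (a ≡ p)
            d' = fin New (suc (d + p))
            d'-bit : ∀ a → Bit d' a ⇔ New a
            d'-bit a = mk⇔ (λ bt → proj₂ (to (fin-bit New (suc (d + p)) a) bt)) (λ h → from (fin-bit New (suc (d + p)) a) (lt h , h))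
              where
              lt : New a → a < suc (d + p)
              lt (inj₁ bt)   = ≤-trans (Bit-< d a bt) (≤-trans (m≤m+n d p) (n≤1+n _))
              lt (inj₂ refl) = s≤s (m≤n+m p d)
            back : ∀ {E ℓ} → Forbid (Bit d') E ℓ → Forbid (Bit d) E ℓ ⊎ K p E ℓ
            back (inj₁ q) = inj₁ (inj₁ q)
            back (inj₂ (a , bt , k)) with to (d'-bit a) bt
            ... | inj₁ bt'  = inj₁ (inj₂ (a , bt' , k))
            ... | inj₂ refl = inj₂ k

      stages : (e : ℕ) → Σ ℕ λ d → ¬ Covers (Forbid (Bit d))
      stages zero = 0 , λ c → Q₀-proper (covers-mono (λ { (inj₁ q) → q ; (inj₂ (a , b , _)) → ⊥-elim (n≮0 (Bit-< 0 a b)) }) c)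
      stages (suc e) = let d' , _ , nc' , _ = step e (proj₁ (stages e)) (proj₂ (stages e)) in d' , nc'

      D : ℕ → SetOf
      D i a = Bit (proj₁ (stages i)) a

      D-suc : ∀ i a → D i a → D (suc i) a
      D-suc i = proj₁ (proj₂ (step i (proj₁ (stages i)) (proj₂ (stages i))))

      D-mono : ∀ {i j} → i ≤ j → ∀ a → D i a → D j a
      D-mono {i} {zero}  z≤n a h = h
      D-mono {i} {suc j} le  a h with m≤n⇒m<n∨m≡n le
      ... | inj₁ (s≤s l) = D-suc j a (D-mono l a h)
      ... | inj₂ refl    = h

      coneAvoiding : Σ (ℕ → Bool) λ y → Avoids Q₀ ⟦ y ⟧ × ¬ CE₁ (Z ⊕ ⟦ y ⟧) B
      coneAvoiding = go (compact-chain (λ i → Forbid (D i)) (λ i → forbid-local (D i)) (λ le → forbid-mono (D-mono le)) (λ i → proj₂ (stages i)))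
        where
        go : (Σ (ℕ → Bool) λ y → ∀ i → Avoids (Forbid (D i)) ⟦ y ⟧) → Σ (ℕ → Bool) λ y → Avoids Q₀ ⟦ y ⟧ × ¬ CE₁ (Z ⊕ ⟦ y ⟧) B
        go (y , av) = y , (λ E ℓ ag q → av 0 E ℓ ag (inj₁ q)) , λ c → contra (halting-index c)
          where
          contra : (Σ ℕ λ e → ∀ ρ → B (lookup ρ zero) ⇔ Halts (Z ⊕ ⟦ y ⟧) (decode e) (enc ρ)) → ⊥
          contra (e , h) with proj₂ (proj₂ (proj₂ (step e (proj₁ (stages e)) (proj₂ (stages e)))))
          ... | x , inj₂ (b , bt) = let ℓ , k = halts-K ⟦ y ⟧ e (pair x 0) (to (h (x ∷ [])) b)
                                    in av (suc e) (fin ⟦ y ⟧ ℓ) ℓ (agree-fin ⟦ y ⟧ ℓ) (inj₂ (Point e x , bt , k))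
          ... | x , inj₁ (nb , ℓ , cov) with cov (fin ⟦ y ⟧ ℓ) (fin-< ⟦ y ⟧ ℓ)
          ...   | inj₁ f = av (suc e) (fin ⟦ y ⟧ ℓ) ℓ (agree-fin ⟦ y ⟧ ℓ) f
          ...   | inj₂ k = nb (from (h (x ∷ [])) (subst₂ (λ e x → Halts (Z ⊕ ⟦ y ⟧) (decode e) x) (unpair₁-pair e (pair x 0)) (unpair₂-pair e (pair x 0))
                              (K-halts ⟦ y ⟧ (Point e x) (agree-fin ⟦ y ⟧ ℓ) k)))

    module LowBasis where

      -- `Covers (Try d i)` says that computation `i` converges on all that is left of the class
      -- after the earlier choices in `d`. It is c.e. in `Z`, so `jump Z` decides whether divergence
      -- of `i` can be added.
      Try : ℕ → ℕ → ℕ → ℕ → Set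
      Try d i E ℓ = Forbid (λ a → (a < i) × Bit d a) E ℓ ⊎ K i E ℓ

      Decided : ℕ → ℕ → Set
      Decided d i = (Bit d i × ¬ Covers (Try d i)) ⊎ (¬ Bit d i × Covers (Try d i))

      -- d lists the jump facts below s that the construction of the low set makes false.
      Correct : ℕ → ℕ → Set
      Correct d s = ∀ i → i < s → Decided d i

      try-cong : ∀ {d d' i E ℓ} → (∀ a → a < i → Bit d a → Bit d' a) → Try d i E ℓ → Try d' i E ℓ
      try-cong s (inj₁ f) = inj₁ (forbid-mono (λ { a (l , b) → l , s a l b }) f)
      try-cong s (inj₂ k) = inj₂ k

      decided-cong : ∀ {d d' i} → (∀ a → a < suc i → Bit d a ⇔ Bit d' a) → Decided d i → Decided d' i
      decided-cong {d} {d'} {i} ag (inj₁ (b , nc)) = inj₁ (to (ag i ≤-refl) b , λ c → nc (covers-mono (try-cong (λ a l → from (ag a (m<n⇒m<1+n l)))) c))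
      decided-cong {d} {d'} {i} ag (inj₂ (nb , c)) = inj₂ ((λ b → nb (from (ag i ≤-refl) b)) , covers-mono (try-cong (λ a l → to (ag a (m<n⇒m<1+n l)))) c)

      correct-exists : ∀ s → Σ ℕ λ d → Correct d s
      correct-exists zero = 0 , λ i ()
      correct-exists (suc s) with correct-exists s
      ... | d , c = d' , λ { i (s≤s i≤s) → [ (λ l → decided-cong (λ a l' → agree a (≤-trans l' l)) (c i l)) , (λ { refl → last }) ]′ (m≤n⇒m<n∨m≡n i≤s) }
        where
        New : SetOf
        New a = ((a < s) × Bit d a) ⊎ ((a ≡ s) × ¬ Covers (Try d s))
        d' : ℕ
        d' = fin New (suc s)
        d'-bit : ∀ a → a < suc s → Bit d' a ⇔ New a
        d'-bit a l = mk⇔ (λ b → proj₂ (to (fin-bit New (suc s) a) b)) (λ n → from (fin-bit New (suc s) a) (l , n))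
        agree : ∀ a → a < s → Bit d a ⇔ Bit d' a
        agree a l = mk⇔ (λ b → from (d'-bit a (m<n⇒m<1+n l)) (inj₁ (l , b)))
          (λ b → [ proj₂ , (λ { (refl , _) → ⊥-elim (<-irrefl refl l) }) ]′ (to (d'-bit a (m<n⇒m<1+n l)) b))
        last : Decided d' s
        last with em {Covers (Try d s)}
        ... | yes c' = inj₂ ((λ b → [ (λ { (l , _) → <-irrefl refl l }) , (λ { (_ , n) → n c' }) ]′ (to (d'-bit s ≤-refl) b)) , covers-mono (try-cong (λ a l → to (agree a l))) c')
        ... | no nc' = inj₁ (from (d'-bit s ≤-refl) (inj₂ (refl , nc')) , λ c'' → nc' (covers-mono (try-cong (λ a l → from (agree a l))) c''))

      correct-unique : ∀ {d d'} s → Correct d s → Correct d' s → ∀ a → a < s → Bit d a ⇔ Bit d' a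
      correct-unique (suc s) c c' a (s≤s a≤s) with m≤n⇒m<n∨m≡n a≤s
      ... | inj₁ l = correct-unique s (λ i l → c i (m<n⇒m<1+n l)) (λ i l → c' i (m<n⇒m<1+n l)) a l
      correct-unique {d} {d'} (suc s) c c' a (s≤s a≤s) | inj₂ refl = go (c a ≤-refl) (c' a ≤-refl)
        where
        ih : ∀ i → i < a → Bit d i ⇔ Bit d' i
        ih = correct-unique a (λ i l → c i (m<n⇒m<1+n l)) (λ i l → c' i (m<n⇒m<1+n l))
        go : Decided d a → Decided d' a → Bit d a ⇔ Bit d' a
        go (inj₁ (b , _))  (inj₁ (b' , _))  = mk⇔ (λ _ → b') (λ _ → b)
        go (inj₂ (b , _))  (inj₂ (b' , _))  = mk⇔ (λ x → ⊥-elim (b x)) (λ x → ⊥-elim (b' x))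
        go (inj₁ (_ , nc)) (inj₂ (_ , cv)) = ⊥-elim (nc (covers-mono (try-cong (λ i l → from (ih i l))) cv))
        go (inj₂ (_ , cv)) (inj₁ (_ , nc)) = ⊥-elim (nc (covers-mono (try-cong (λ i l → to (ih i l))) cv))

      Omit : SetOf
      Omit a = Σ ℕ λ d → Correct d (suc a) × Bit d a

      correctʳ : Rec (jump Z) {2} (λ ρ → Correct (lookup ρ zero) (lookup ρ (suc zero)))
      correctʳ = rec-ext (λ { (d ∷ s ∷ []) → mk⇔ id id })
          (∀<ʳ v1 ((bitʳ v1 v0 ×ʳ ¬ʳ tryʳ) ⊎ʳ ((¬ʳ bitʳ v1 v0) ×ʳ tryʳ)))
        where
        tryʳ : Rec (jump Z) {3} (λ ρ → Covers (Try (lookup ρ (suc zero)) (lookup ρ zero)))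
        tryʳ = ce→rec-jump (ce-ext (λ { (i ∷ d ∷ s ∷ []) → mk⇔ id id })
          (coversᵉ {k = 3} (λ E ℓ ρ → Try (lookup ρ (suc zero)) (lookup ρ zero) E ℓ) (ce-ext (λ { (E ∷ ℓ ∷ i ∷ d ∷ s ∷ []) → mk⇔ id id })
            ((at₂ Q₀ Q₀-ce v0 v1 ⊎ᵉ ∃ᵉ (rec→ce (v0 <ʳ v3 ×ʳ bitʳ v4 v0) ×ᵉ at₃ K K-ce v0 v1 v2)) ⊎ᵉ at₃ K K-ce v2 v0 v1))))

      -- Membership is witnessed by a correct `d` containing `a`, non-membership by a correct `d`
      -- without it. Correct lists exist and agree below their bound, so both are c.e. in `jump Z`.
      omitʳ : Rec (jump Z) {1} (λ ρ → Omit (lookup ρ zero))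
      omitʳ = ce-co-ce→rec
        (ce-ext (λ { (a ∷ []) → mk⇔ id id }) (∃ᵉ (rec→ce (subʳ correctʳ (v0 ∷ᵛ sucᶜ v1 ∷ᵛ []ᵛ) ×ʳ bitʳ v0 v1))))
        (ce-ext (λ { (a ∷ []) → mk⇔ (λ { (d , c , nb) (d' , c' , b') → nb (from (correct-unique (suc a) c c' a ≤-refl) b') })
                                      (λ nj → let d , c = correct-exists (suc a) in d , c , λ b → nj (d , c , b)) })
                (∃ᵉ (rec→ce (subʳ correctʳ (v0 ∷ᵛ sucᶜ v1 ∷ᵛ []ᵛ) ×ʳ ¬ʳ bitʳ v0 v1))))

      omit-bit : ∀ {d} s → Correct d s → ∀ a → a < s → Omit a ⇔ Bit d a
      omit-bit {d} s c a l = mk⇔ (λ { (d' , c' , b) → to (correct-unique (suc a) c' c↓ a ≤-refl) b }) (λ b → d , c↓ , b)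
        where
        c↓ : Correct d (suc a)
        c↓ i i≤a = c i (≤-trans i≤a l)

      Chain : ℕ → ℕ → ℕ → Set
      Chain i = Forbid (λ a → (a < i) × Omit a)

      chain-proper : ∀ i → ¬ Covers (Chain i)
      chain-proper zero c = Q₀-proper (covers-mono (λ { (inj₁ q) → q }) c)
      chain-proper (suc i) c with em {Omit i}
      ... | no nj = chain-proper i (covers-mono (forbid-mono (λ { a (s≤s l , j) → [ (λ l' → l' , j) , (λ { refl → ⊥-elim (nj j) }) ]′ (m≤n⇒m<n∨m≡n l) })) c)
      ... | yes (d , cor , b) with cor i ≤-refl
      ...   | inj₂ (nb , _) = nb b
      ...   | inj₁ (_ , nc) = nc (covers-mono back c)
        where
        back : ∀ {E ℓ} → Chain (suc i) E ℓ → Try d i E ℓ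
        back (inj₁ q) = inj₁ (inj₁ q)
        back (inj₂ (a , (s≤s l , j) , k)) with m≤n⇒m<n∨m≡n l
        ... | inj₁ l'   = inj₁ (inj₂ (a , (l' , to (omit-bit (suc i) cor a (m<n⇒m<1+n l')) j) , k))
        ... | inj₂ refl = inj₂ k

      low : Σ (ℕ → Bool) λ y → Avoids Q₀ ⟦ y ⟧ × (jump (Z ⊕ ⟦ y ⟧) ≤T jump Z)
      low = go (compact-chain Chain (λ i → forbid-local _) (λ le → forbid-mono (λ { a (l , j) → ≤-trans l le , j })) chain-proper)
        where
        go : (Σ (ℕ → Bool) λ y → ∀ i → Avoids (Chain i) ⟦ y ⟧) → Σ (ℕ → Bool) λ y → Avoids Q₀ ⟦ y ⟧ × (jump (Z ⊕ ⟦ y ⟧) ≤T jump Z)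
        go (y , av) = y , (λ E ℓ ag q → av 0 E ℓ ag (inj₁ q)) ,
            reduce (rec-ext (λ { (e ∷ []) → mk⇔ (from (jump-omit e)) (to (jump-omit e)) }) (¬ʳ subʳ omitʳ (pairᶜ v0 v0 ∷ᵛ []ᵛ)))
          where
          Y : SetOf
          Y = ⟦ y ⟧
          jump-omit : ∀ e → jump (Z ⊕ Y) e ⇔ (¬ Omit (pair e e))
          jump-omit e = mk⇔ fwd bwd
            where
            p : ℕ
            p = pair e e
            fwd : jump (Z ⊕ Y) e → ¬ Omit p
            fwd h j = let ℓ , k = halts-K Y e e h in av (suc p) (fin Y ℓ) ℓ (agree-fin Y ℓ) (inj₂ (p , (≤-refl , j) , k))
            bwd : ¬ Omit p → jump (Z ⊕ Y) e
            bwd nj with correct-exists (suc p)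
            ... | d , cor with cor p ≤-refl
            ...   | inj₁ (b , _) = ⊥-elim (nj (d , cor , b))
            ...   | inj₂ (_ , ℓ , cov) with cov (fin Y ℓ) (fin-< Y ℓ)
            ...     | inj₁ f = ⊥-elim (av p (fin Y ℓ) ℓ (agree-fin Y ℓ) (forbid-mono (λ { a (l , b) → l , from (omit-bit (suc p) cor a (m<n⇒m<1+n l)) b }) f))
            ...     | inj₂ k = subst₂ (λ e x → Halts (Z ⊕ Y) (decode e) x) (unpair₁-pair e e) (unpair₂-pair e e) (K-halts Y p (agree-fin Y ℓ) k)

    -- With a jump to spare, lowness is enough: the later jumps of `Z ⊕ ⟦ y ⟧` are then computable
    -- in those of `Z`. Only for `j = 0` does the construction have to diagonalise against `B`.
    basis : ∀ (B : SetOf) j → ¬ CE₁ (jumpN j Z) B → Σ (ℕ → Bool) λ y → Avoids Q₀ ⟦ y ⟧ × ¬ CE₁ (jumpN j (Z ⊕ ⟦ y ⟧)) B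
    basis B zero    h = ConeAvoidance.coneAvoiding B h
    basis B (suc j) h = go LowBasis.low
      where
      go : (Σ (ℕ → Bool) λ y → Avoids Q₀ ⟦ y ⟧ × (jump (Z ⊕ ⟦ y ⟧) ≤T jump Z)) → Σ (ℕ → Bool) λ y → Avoids Q₀ ⟦ y ⟧ × ¬ CE₁ (jumpN (suc j) (Z ⊕ ⟦ y ⟧)) B
      go (y , av , le) = y , av , λ c → h (subst (λ X → CE₁ X B) (sym (jumpN-jump j Z)) (ce-relative (jumpN-mono j le) (subst (λ X → CE₁ X B) (jumpN-jump j (Z ⊕ ⟦ y ⟧)) c)))

  -- Upward closed open classes, given by the finite sets that generate them

  Meets : (ℕ → Set) → SetOf → Set
  Meets O Y = Σ ℕ λ G → O G × (∀ x → Bit G x → Y x)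

  _∩_ _∖_ : SetOf → SetOf → SetOf
  (X ∩ Y) x = X x × Y x
  (X ∖ Y) x = X x × ¬ Y x

  Whole : SetOf
  Whole _ = ⊤

  meets-mono : ∀ {O Y Y'} → Y ⊆ Y' → Meets O Y → Meets O Y'
  meets-mono s (G , o , h) = G , o , λ x b → s x (h x b)

  -- The open set of those partitions of `X` whose first piece is in the class of `O₀` or whose
  -- second piece is in that of `O₁`; avoiding it is a Π₁ condition on the partition.
  Split : (ℕ → Set) → (ℕ → Set) → SetOf → ℕ → ℕ → Set
  Split O₀ O₁ X P ℓ = (Σ ℕ λ G → O₀ G × (∀ x → Bit G x → (x < ℓ) × X x × Bit P x)) ⊎ (Σ ℕ λ G → O₁ G × (∀ x → Bit G x → (x < ℓ) × X x × ¬ Bit P x))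

  module _ {O₀ O₁ : ℕ → Set} {X : SetOf} where

    split-local : Local (Split O₀ O₁ X)
    split-local le ag (inj₁ (G , o , h)) = inj₁ (G , o , λ x b → let l , xx , p = h x b in ≤-trans l le , xx , to (ag x l) p)
    split-local le ag (inj₂ (G , o , h)) = inj₂ (G , o , λ x b → let l , xx , p = h x b in ≤-trans l le , xx , λ p' → p (from (ag x l) p'))

    split-avoids : ∀ P → Avoids (Split O₀ O₁ X) P → ¬ Meets O₀ (X ∩ P) × ¬ Meets O₁ (X ∖ P)
    split-avoids P av =
      (λ { (G , o , h) → av (fin P G) G (agree-fin P G) (inj₁ (G , o , λ x b → Bit-< G x b , proj₁ (h x b) , from (agree-fin P G x (Bit-< G x b)) (proj₂ (h x b)))) }) ,
      (λ { (G , o , h) → av (fin P G) G (agree-fin P G) (inj₂ (G , o , λ x b → Bit-< G x b , proj₁ (h x b) , λ p → proj₂ (h x b) (to (agree-fin P G x (Bit-< G x b)) p))) })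

    split-covers : Covers (Split O₀ O₁ X) → ∀ P → Meets O₀ (X ∩ P) ⊎ Meets O₁ (X ∖ P)
    split-covers (ℓ , h) P with h (fin P ℓ) (fin-< P ℓ)
    ... | inj₁ (G , o , g) = inj₁ (G , o , λ x b → let l , xx , p = g x b in xx , to (agree-fin P ℓ x l) p)
    ... | inj₂ (G , o , g) = inj₂ (G , o , λ x b → let l , xx , p = g x b in xx , λ p' → p (from (agree-fin P ℓ x l) p'))

  -- Large is one of the classes 𝓛ₘ; its requirements form a co-c.e. set relative to Z.
  record Lev (Z : SetOf) : Set₁ where
    field
      V : ℕ → ℕ → Set
      N : ℕ → Set
      V-ce : CE₂ Z V
      N-ce : CE₁ Z N

    Large : SetOf → Set
    Large Y = ∀ i → ¬ N i → Meets (V i) Y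

    field
      regular  : ∀ {Y Y₀ Y₁} → Large Y → (∀ x → Y x → Y₀ x ⊎ Y₁ x) → Large Y₀ ⊎ Large Y₁
      full     : Large Whole
      infinite : ∀ {Y} → Large Y → Infinite Y

    large-mono : ∀ {Y Y'} → Y ⊆ Y' → Large Y → Large Y'
    large-mono s l i n = meets-mono s (l i n)

  -- The index e consists of a program and a parameter, so that parametrised families need no s-m-n theorem.
  Universal : SetOf → ℕ → ℕ → Set
  Universal Z e G = Halts Z (decode (unpair₁ e)) (enc (unpair₂ e ∷ G ∷ []))

  universalᵉ : ∀ Z → CE₂ Z (Universal Z)
  universalᵉ Z = haltsᵉ ≤T-refl (fstᶜ v0) (pairᶜ (sndᶜ v0) (pairᶜ v1 (litᶜ 0)))

  universal-index : ∀ {Z} (Q : ℕ → ℕ → Set) → CE₂ Z Q → Σ ℕ λ e → ∀ p G → Q p G ⇔ Universal Z (pair e p) G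
  universal-index {Z} Q c = go (halting-index c)
    where
    go : (Σ ℕ λ e → ∀ ρ → Q (lookup ρ zero) (lookup ρ (suc zero)) ⇔ Halts Z (decode e) (enc ρ)) → Σ ℕ λ e → ∀ p G → Q p G ⇔ Universal Z (pair e p) G
    go (e , h) = e , λ p G → subst₂ (λ a b → Q p G ⇔ Halts Z (decode a) (enc (b ∷ G ∷ []))) (sym (unpair₁-pair e p)) (sym (unpair₂-pair e p)) (h (p ∷ G ∷ []))

  open-index : ∀ {Z} (O : ℕ → Set) → CE₁ Z O → Σ ℕ λ e → ∀ G → O G ⇔ Universal Z e G
  open-index O c = go (universal-index (λ _ → O) (at₁ O c v1))
    where
    go : (Σ ℕ λ e → ∀ p G → O G ⇔ Universal _ (pair e p) G) → Σ ℕ λ e → ∀ G → O G ⇔ Universal _ e G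
    go (e , h) = pair e 0 , h 0

  _⇔ʳ_ : ∀ {Z k} {R S : Vec ℕ k → Set} → Rec Z R → Rec Z S → Rec Z (λ ρ → R ρ ⇔ S ρ)
  _⇔ʳ_ {R = R} {S} r s = rec-ext (λ ρ → mk⇔ fwd bwd) ((r ×ʳ s) ⊎ʳ ((¬ʳ r) ×ʳ (¬ʳ s)))
    where
    fwd : ∀ {ρ} → (R ρ × S ρ) ⊎ (¬ R ρ × ¬ S ρ) → R ρ ⇔ S ρ
    fwd (inj₁ (a , b)) = mk⇔ (λ _ → b) (λ _ → a)
    fwd (inj₂ (a , b)) = mk⇔ (λ x → ⊥-elim (a x)) (λ x → ⊥-elim (b x))
    bwd : ∀ {ρ} → R ρ ⇔ S ρ → (R ρ × S ρ) ⊎ (¬ R ρ × ¬ S ρ)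
    bwd {ρ} h with em {R ρ}
    ... | yes a = inj₁ (a , to h a)
    ... | no na = inj₂ (na , λ b → na (from h b))

  _→ʳ_ : ∀ {Z k} {R S : Vec ℕ k → Set} → Rec Z R → Rec Z S → Rec Z (λ ρ → R ρ → S ρ)
  _→ʳ_ {R = R} r s = rec-ext (λ ρ → mk⇔ (λ { (inj₁ n) a → ⊥-elim (n a) ; (inj₂ b) _ → b }) (λ h → bwd ρ h)) ((¬ʳ r) ⊎ʳ s)
    where
    bwd : ∀ {S : Set} ρ → (R ρ → S) → ¬ R ρ ⊎ S
    bwd ρ h with em {R ρ}
    ... | yes a = inj₂ (h a)
    ... | no n  = inj₁ n

  -- An atom of the Boolean algebra generated by the first `s` columns of `M`, with `f` choosing the
  -- sides.
  Cell : SetOf → SetOf → ℕ → SetOf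
  Cell M f s x = ∀ i → i < s → f i ⇔ M (pair i x)

  cell-cong : ∀ M M' {f f' s} x → (∀ i → i < s → f i ⇔ f' i) → (∀ i → i < s → M (pair i x) ⇔ M' (pair i x)) → Cell M f s x → Cell M' f' s x
  cell-cong M M' x hf hm c i l = mk⇔ (to (hm i l) ∘ to (c i l) ∘ from (hf i l)) (to (hf i l) ∘ from (c i l) ∘ from (hm i l))

  -- Splitting columns: column s of M splits every cell of length s into two pieces outside the class
  -- of index unpair₁ s, whenever this is possible.  "Possible" is a Π₁ condition, so to get a Π₁ class
  -- of M's a column is only asked to be as good as any other set at every finite stage t.
  module Columns (Z : SetOf) where

    U : ℕ → ℕ → Set
    U = Universal Z

    abstract
      stage : Vec ℕ 3 → ℕ
      stage = CE.fun (universalᵉ Z)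

      stageᶜ : Comp Z stage
      stageᶜ = CE.isComp (universalᵉ Z)

      stage-spec : ∀ e G → U e G ⇔ (Σ ℕ λ y → stage (y ∷ e ∷ G ∷ []) ≡ 0)
      stage-spec e G = CE.spec (universalᵉ Z) (e ∷ G ∷ [])

    -- Only generators found by stage `t`, and only points below `t`, are consulted. So the
    -- condition is decidable from finite data and becomes stronger with `t`.
    Good : ℕ → ℕ → SetOf → SetOf → Set
    Good t e X P = ∀ G → G < t → ∀ y → y < t → stage (y ∷ e ∷ G ∷ []) ≡ 0
      → ¬ (∀ x → Bit G x → X x × P x) × ¬ (∀ x → Bit G x → X x × ¬ P x)

    good-down : ∀ {t t' e X P} → t ≤ t' → Good t' e X P → Good t e X P
    good-down le g G lG y ly = g G (≤-trans lG le) y (≤-trans ly le)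

    good-cong : ∀ {t e X X' P P'} → (∀ x → x < t → X x ⇔ X' x) → (∀ x → x < t → X x → P x ⇔ P' x) → Good t e X P → Good t e X' P'
    good-cong {t} hX hP g G lG y ly s =
        (λ h → proj₁ (g G lG y ly s) (λ x b → let l = <-trans (Bit-< G x b) lG ; xx = from (hX x l) (proj₁ (h x b)) in xx , from (hP x l xx) (proj₂ (h x b))))
      , (λ h → proj₂ (g G lG y ly s) (λ x b → let l = <-trans (Bit-< G x b) lG ; xx = from (hX x l) (proj₁ (h x b)) in xx , λ p → proj₂ (h x b) (to (hP x l xx) p)))

    avoids→good : ∀ {e X P} → ¬ Meets (U e) (X ∩ P) → ¬ Meets (U e) (X ∖ P) → ∀ t → Good t e X P
    avoids→good {e} n₀ n₁ t G _ y _ s = (λ h → n₀ (G , u , h)) , (λ h → n₁ (G , u , h))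
      where
      u : U e G
      u = from (stage-spec e G) (y , s)

    good→avoids : ∀ {e X P} → (∀ t → Good t e X P) → ¬ Meets (U e) (X ∩ P) × ¬ Meets (U e) (X ∖ P)
    good→avoids {e} {X} {P} g = (λ { (G , u , h) → proj₁ (at G u) h }) , (λ { (G , u , h) → proj₂ (at G u) h })
      where
      at : ∀ G → U e G → ¬ (∀ x → Bit G x → X x × P x) × ¬ (∀ x → Bit G x → X x × ¬ P x)
      at G u with to (stage-spec e G) u
      ... | y , s = g (suc (G + y)) G (s≤s (m≤m+n G y)) y (s≤s (m≤n+m y G)) s

    -- If some stage defeats every set, take one that survives up to the stage before the first such
    -- stage; otherwise compactness gives a set that survives all stages.
    best : ∀ e X → Σ (ℕ → Bool) λ p → ∀ t → Good t e X ⟦ p ⟧ ⊎ (∀ P → ¬ Good t e X (Bit P))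
    best e X with em {Σ ℕ λ t → ∀ P → ¬ Good t e X (Bit P)}
    ... | yes (t₀ , none) = bounded t₀ none
      where
      bounded : ∀ t₀ → (∀ P → ¬ Good t₀ e X (Bit P)) → Σ (ℕ → Bool) λ p → ∀ t → Good t e X ⟦ p ⟧ ⊎ (∀ P → ¬ Good t e X (Bit P))
      bounded zero none = (λ _ → false) , λ t → inj₂ (λ P g → none P (good-down z≤n g))
      bounded (suc t₀) none with em {Σ ℕ λ P → Good t₀ e X (Bit P)}
      ... | no np = bounded t₀ (λ P g → np (P , g))
      ... | yes (P , g) = χ (Bit P) , λ t → [ (λ { (s≤s le) → inj₁ (good-down le (good-cong (λ x _ → mk⇔ id id) (λ x _ _ → mk⇔ (from (χ-spec (Bit P) x)) (to (χ-spec (Bit P) x))) g)) })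
                                              , (λ le → inj₂ (λ P' g' → none P' (good-down le g'))) ]′ (<-≤-connex t (suc t₀))
    ... | no np = go (compact {λ P ℓ → ¬ Good ℓ e X (Bit P)} (λ le ag ng g → ng (good-cong (λ x _ → mk⇔ id id) (λ x l _ → mk⇔ (from (ag x l)) (to (ag x l))) (good-down le g)))
                       (λ { (ℓ , h) → np (ℓ , λ P g → h (fin (Bit P) ℓ) (fin-< (Bit P) ℓ)
                              (good-cong (λ x _ → mk⇔ id id) (λ x l _ → mk⇔ (from (agree-fin (Bit P) ℓ x l)) (to (agree-fin (Bit P) ℓ x l))) g)) }))
      where
      go : (Σ (ℕ → Bool) λ p → Avoids (λ P ℓ → ¬ Good ℓ e X (Bit P)) ⟦ p ⟧) → Σ (ℕ → Bool) λ p → ∀ t → Good t e X ⟦ p ⟧ ⊎ (∀ P → ¬ Good t e X (Bit P))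
      go (p , av) = p , λ t → inj₁ (dne (λ ng → av (fin ⟦ p ⟧ t) t (agree-fin ⟦ p ⟧ t)
        (λ g → ng (good-cong (λ x _ → mk⇔ id id) (λ x l _ → agree-fin ⟦ p ⟧ t x l) g))))

    -- The first clause keeps all column entries consulted by the other two inside the string, so
    -- that a flaw persists in longer strings.
    FlawAt : ℕ → ℕ → ℕ → ℕ → ℕ → ℕ → Set
    FlawAt P F s t E ℓ = (∀ i → i < suc s → ∀ x → x < t → pair i x < ℓ)
      × ¬ Good t (unpair₁ s) (Cell (Bit E) (Bit F) s) (λ x → Bit E (pair s x)) × Good t (unpair₁ s) (Cell (Bit E) (Bit F) s) (Bit P)

    -- column s of the set coded by E is seen to be worse than P at stage t
    Flaw : ℕ → ℕ → Set
    Flaw E ℓ = Σ ℕ λ t → Σ ℕ λ s → Σ ℕ λ F → Σ ℕ λ P → FlawAt P F s t E ℓ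

    cell-agree : ∀ (M M' : SetOf) {ℓ s t f} x → (∀ z → z < ℓ → M z ⇔ M' z) → (∀ i → i < suc s → ∀ x → x < t → pair i x < ℓ) → x < t → Cell M f s x ⇔ Cell M' f s x
    cell-agree M M' x ag bd lx = mk⇔
      (cell-cong M M' x (λ i _ → mk⇔ id id) (λ i l → ag (pair i x) (bd i (m<n⇒m<1+n l) x lx)))
      (cell-cong M' M x (λ i _ → mk⇔ id id) (λ i l → let q = ag (pair i x) (bd i (m<n⇒m<1+n l) x lx) in mk⇔ (from q) (to q)))

    flaw-local : Local Flaw
    flaw-local {E} {E'} le ag (t , s , F , P , bd , ng , g) = t , s , F , P , (λ i li x lx → ≤-trans (bd i li x lx) le)
      , (λ g' → ng (good-cong (λ x l → let c = cell-agree (Bit E) (Bit E') {f = Bit F} x ag bd l in mk⇔ (from c) (to c))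
                              (λ x l _ → let q = ag (pair s x) (bd s ≤-refl x l) in mk⇔ (from q) (to q)) g'))
      , good-cong (λ x l → cell-agree (Bit E) (Bit E') {f = Bit F} x ag bd l) (λ x _ _ → mk⇔ id id) g

    cellʳ : ∀ {Y k} {E F S X : Vec ℕ k → ℕ} → Comp Y E → Comp Y F → Comp Y S → Comp Y X → Rec Y (λ ρ → Cell (Bit (E ρ)) (Bit (F ρ)) (S ρ) (X ρ))
    cellʳ e f s x = ∀<ʳ s (bitʳ (subᶜ f (tailᵛ idᵛ)) v0 ⇔ʳ bitʳ (subᶜ e (tailᵛ idᵛ)) (pairᶜ v0 (subᶜ x (tailᵛ idᵛ))))

    stageʳ : ∀ {k} {Y E G : Vec ℕ k → ℕ} → Comp Z Y → Comp Z E → Comp Z G → Rec Z (λ ρ → stage (Y ρ ∷ E ρ ∷ G ρ ∷ []) ≡ 0)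
    stageʳ y e g = subᶜ stageᶜ (y ∷ᵛ e ∷ᵛ g ∷ᵛ []ᵛ) =ʳ litᶜ 0

    v7 : ∀ {k} → Comp Z {suc (suc (suc (suc (suc (suc (suc (suc k)))))))} (λ ρ → lookup ρ (suc (suc (suc (suc (suc (suc (suc zero))))))))
    v7 = varᶜ (suc (suc (suc (suc (suc (suc (suc zero)))))))

    goodʳ : {P : Vec ℕ 7 → Set} → Rec Z P → Rec Z {6} (λ { ρ@(_ ∷ F ∷ s ∷ t ∷ E ∷ ℓ ∷ []) → Good t (unpair₁ s) (Cell (Bit E) (Bit F) s) (λ x → P (x ∷ ρ)) })
    goodʳ p = rec-ext (λ { (_ ∷ F ∷ s ∷ t ∷ E ∷ ℓ ∷ []) → mk⇔ id id }) (∀<ʳ v3 (∀<ʳ v4 (stageʳ v0 (fstᶜ v4) v1 →ʳ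
        ((¬ʳ ∀bitʳ v1 (cellʳ v7 v4 v5 v0 ×ʳ subʳ p (v0 ∷ᵛ tailᵛ (tailᵛ (tailᵛ idᵛ))))) ×ʳ
         (¬ʳ ∀bitʳ v1 (cellʳ v7 v4 v5 v0 ×ʳ ¬ʳ subʳ p (v0 ∷ᵛ tailᵛ (tailᵛ (tailᵛ idᵛ)))))))))

    boundʳ : Rec Z {6} (λ { ρ@(_ ∷ F ∷ s ∷ t ∷ E ∷ ℓ ∷ []) → ∀ i → i < suc s → ∀ x → x < t → pair i x < ℓ })
    boundʳ = rec-ext (λ { (_ ∷ F ∷ s ∷ t ∷ E ∷ ℓ ∷ []) → mk⇔ id id }) (∀<ʳ (sucᶜ v2) (∀<ʳ v4 (pairᶜ v1 v0 <ʳ v7)))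

    flawAtʳ : Rec Z {6} (λ { (P ∷ F ∷ s ∷ t ∷ E ∷ ℓ ∷ []) → FlawAt P F s t E ℓ })
    flawAtʳ = rec-ext (λ { (P ∷ F ∷ s ∷ t ∷ E ∷ ℓ ∷ []) → mk⇔ id id }) (boundʳ ×ʳ (¬ʳ goodʳ (bitʳ v5 (pairᶜ v3 v0))) ×ʳ goodʳ (bitʳ v1 v0))

    flawᵉ : CE₂ Z Flaw
    flawᵉ = ce-ext (λ { (E ∷ ℓ ∷ []) → mk⇔ id id }) (∃ᵉ (∃ᵉ (∃ᵉ (∃ᵉ (rec→ce flawAtʳ)))))

  module ColumnsExist (Z : SetOf) where
    open Columns Z

    ⟪_⟫ : (ℕ → ℕ → Bool) → SetOf
    ⟪ T ⟫ z = T (unpair₁ z) (unpair₂ z) ≡ true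

    column : (ℕ → ℕ → Bool) → ℕ → ℕ → ℕ → Bool
    column T s F = proj₁ (best (unpair₁ s) (Cell ⟪ T ⟫ (Bit F) s))

    table : ℕ → ℕ → ℕ → Bool
    table zero    i x = false
    table (suc s) i x with i ≟ s
    -- The row of `x` in the first `s` columns names its cell, and `x` follows the set that is best
    -- for that cell. The cells are disjoint, so one column serves them all.
    ... | yes _ = column (table s) s (res (λ i → table s i x) s) x
    ... | no  _ = table s i x

    table-new : ∀ s x → table (suc s) s x ≡ column (table s) s (res (λ i → table s i x) s) x
    table-new s x with s ≟ s
    ... | yes _ = refl
    ... | no n  = ⊥-elim (n refl)

    table-stable : ∀ {s i} x → i < s → table s i x ≡ table (suc i) i x
    table-stable {suc s} {i} x (s≤s i≤s) with m≤n⇒m<n∨m≡n i≤s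
    ... | inj₂ refl = refl
    ... | inj₁ l    = trans old (table-stable x l)
      where
      old : table (suc s) i x ≡ table s i x
      old with i ≟ s
      ... | yes refl = ⊥-elim (<-irrefl refl l)
      ... | no _     = refl

    M : ℕ → Bool
    M z = table (suc (unpair₁ z)) (unpair₁ z) (unpair₂ z)

    M-pair : ∀ i x → M (pair i x) ≡ table (suc i) i x
    M-pair i x = cong₂ (λ a b → table (suc a) a b) (unpair₁-pair i x) (unpair₂-pair i x)

    M-table : ∀ {s i} x → i < s → ⟦ M ⟧ (pair i x) ⇔ (table s i x ≡ true)
    M-table {s} {i} x l = mk⇔ (trans (sym eq)) (trans eq)
      where
      eq : M (pair i x) ≡ table s i x
      eq = trans (M-pair i x) (sym (table-stable x l))

    table-pair : ∀ s i x → (table s i x ≡ true) ⇔ ⟪ table s ⟫ (pair i x)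
    table-pair s i x = mk⇔ (trans (sym eq)) (trans eq)
      where
      eq : table s i x ≡ table s (unpair₁ (pair i x)) (unpair₂ (pair i x))
      eq = sym (cong₂ (table s) (unpair₁-pair i x) (unpair₂-pair i x))

    ⇔→≡ : ∀ {a b : Bool} → (a ≡ true) ⇔ (b ≡ true) → a ≡ b
    ⇔→≡ {true}  {b}     h = sym (to h refl)
    ⇔→≡ {false} {true}  h = from h refl
    ⇔→≡ {false} {false} h = refl

    M-avoids : Avoids Flaw ⟦ M ⟧
    M-avoids E ℓ ag (t , s , F , P , bd , ng , g) = [ (λ gd → ng (good-cong X°→E agreeE gd)) , (λ none → none P (good-cong (λ x l → let c = X°→E x l in mk⇔ (from c) (to c)) (λ x _ _ → mk⇔ id id) g)) ]′ (proj₂ (best e X°) t)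
      where
      e F° : ℕ
      e = unpair₁ s
      -- `F` may have bits from `s` on, whereas rows are coded without them.
      F° = fin (Bit F) s
      X° : SetOf
      X° = Cell ⟪ table s ⟫ (Bit F°) s
      X°→E : ∀ x → x < t → X° x ⇔ Cell (Bit E) (Bit F) s x
      X°→E x l = mk⇔
          (cell-cong ⟪ table s ⟫ (Bit E) x (λ i li → agree-fin (Bit F) s i li) (λ i li → mk⇔ (from (eq i li)) (to (eq i li))))
          (cell-cong (Bit E) ⟪ table s ⟫ x (λ i li → let q = agree-fin (Bit F) s i li in mk⇔ (from q) (to q)) eq)
        where
        eq : ∀ i → i < s → Bit E (pair i x) ⇔ ⟪ table s ⟫ (pair i x)
        eq i li = mk⇔ (to (table-pair s i x) ∘ to (M-table x li) ∘ to q) (from q ∘ from (M-table x li) ∘ from (table-pair s i x))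
          where
          q : Bit E (pair i x) ⇔ ⟦ M ⟧ (pair i x)
          q = ag (pair i x) (bd i (m<n⇒m<1+n li) x l)
      agreeE : ∀ x → x < t → X° x → ⟦ proj₁ (best e X°) ⟧ x ⇔ Bit E (pair s x)
      agreeE x l xx = mk⇔ (λ b → from q (trans eq b)) (λ b → trans (sym eq) (to q b))
        where
        q : Bit E (pair s x) ⇔ ⟦ M ⟧ (pair s x)
        q = ag (pair s x) (bd s ≤-refl x l)
        row : res (λ i → table s i x) s ≡ F°
        row = res-cong s (λ i li → ⇔→≡ (mk⇔
          (λ h → from (χ-spec (Bit F) i) (to (agree-fin (Bit F) s i li) (from (xx i li) (to (table-pair s i x) h))))
          (λ h → from (table-pair s i x) (to (xx i li) (from (agree-fin (Bit F) s i li) (to (χ-spec (Bit F) i) h))))))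
        eq : M (pair s x) ≡ proj₁ (best e X°) x
        eq = trans (M-pair s x) (trans (table-new s x) (cong (λ F → column (table s) s F x) row))

  -- From one partition regular class to the next.

  -- The interface for control of one more jump. `refutedᵉ` and `kept` form a dichotomy for the open
  -- classes over `Z`: a failure at some `X t`, which `Z⁺` enumerates, or a guarantee for every
  -- large set. By `thick`, cutting down to that `X t` costs nothing.
  record Next {Z : SetOf} (lev : Lev Z) (B : SetOf) (j : ℕ) : Set₁ where
    field
      Z⁺   : SetOf
      hard : ¬ CE₁ (jumpN j Z⁺) B
      Z≤Z⁺ : Z ≤T Z⁺
      lev⁺ : Lev Z⁺
      sub  : ∀ {Y} → Lev.Large lev⁺ Y → Lev.Large lev Y
      X    : ℕ → SetOf
      X-rec : ∀ t → X t ≤T Z⁺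
      thick : ∀ {Y} t → Lev.Large lev⁺ Y → Lev.Large lev⁺ (Y ∩ X t)
      refutedᵉ : CE₁ Z⁺ (λ e → Σ ℕ λ t → ¬ Meets (Universal Z e) (X t))
      kept  : ∀ e → ¬ (Σ ℕ λ t → ¬ Meets (Universal Z e) (X t)) → ∀ {Y} → Lev.Large lev⁺ Y → Meets (Universal Z e) Y

  module Build {Z : SetOf} (lev : Lev Z) (m : ℕ → Bool) (m-avoids : Avoids (Columns.Flaw Z) ⟦ m ⟧) where
    open Columns Z
    open Lev lev

    M : SetOf
    M = ⟦ m ⟧

    ZM W : SetOf
    ZM = Z ⊕ M
    W = jump ZM

    Z≤W : Z ≤T W
    Z≤W = ≤T-trans ⊕-left ≤T-jump

    M≤W : M ≤T W
    M≤W = ≤T-trans ⊕-right ≤T-jump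

    bound-pairs : ∀ a t → Σ ℕ λ ℓ → ∀ i → i < a → ∀ x → x < t → pair i x < ℓ
    bound-pairs a t = bound-all {λ ℓ i → ∀ x → x < t → pair i x < ℓ} (λ le h x l → ≤-trans (h x l) le) a
      (λ i _ → bound-all {λ ℓ x → pair i x < ℓ} (λ le h → ≤-trans h le) t (λ x _ → suc (pair i x) , ≤-refl))

    -- A `P` that splits the cell is good at every stage. Were column `s` worse at stage `t`, the
    -- restriction of `P` to `t` would exhibit a flaw of `M`.
    splits : ∀ s F P → ¬ Meets (U (unpair₁ s)) (Cell M (Bit F) s ∩ P) → ¬ Meets (U (unpair₁ s)) (Cell M (Bit F) s ∖ P)
      → ¬ Meets (U (unpair₁ s)) (Cell M (Bit F) s ∩ (λ x → M (pair s x))) × ¬ Meets (U (unpair₁ s)) (Cell M (Bit F) s ∖ (λ x → M (pair s x)))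
    splits s F P n₀ n₁ = good→avoids (λ t → dne (flawed t))
      where
      e : ℕ
      e = unpair₁ s
      flawed : ∀ t → ¬ ¬ Good t e (Cell M (Bit F) s) (λ x → M (pair s x))
      flawed t ng = go (bound-pairs (suc s) t)
        where
        go : (Σ ℕ λ ℓ → ∀ i → i < suc s → ∀ x → x < t → pair i x < ℓ) → ⊥
        go (ℓ , bd) = m-avoids (fin M ℓ) ℓ (agree-fin M ℓ) (t , s , F , fin P t , bd
            , (λ g → ng (good-cong (λ x l → cell-agree (Bit (fin M ℓ)) M {f = Bit F} x (agree-fin M ℓ) bd l) (λ x l _ → agree-fin M ℓ (pair s x) (bd s ≤-refl x l)) g))
            , good-cong (λ x l → let c = cell-agree (Bit (fin M ℓ)) M {f = Bit F} x (agree-fin M ℓ) bd l in mk⇔ (from c) (to c))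
                        (λ x l _ → let q = agree-fin P t x l in mk⇔ (from q) (to q)) (avoids→good n₀ n₁ t))

    cell-down : ∀ {f s s'} x → s ≤ s' → Cell M f s' x → Cell M f s x
    cell-down x le c i l = c i (≤-trans l le)

    meets-cellᵉ : (O : ℕ → ℕ → Set) → CE₂ Z O → CE ZM {3} (λ ρ → Meets (O (lookup ρ zero)) (Cell M (Bit (lookup ρ (suc zero))) (lookup ρ (suc (suc zero)))))
    meets-cellᵉ O c = ce-ext (λ { (i ∷ E ∷ s ∷ []) → mk⇔ id id }) (∃ᵉ (at₂ O (ce-relative ⊕-left c) v1 v0 ×ᵉ
      ∀bitᵉ v0 (rec→ce (∀<ʳ v4 (bitʳ v4 v0 ⇔ʳ ≤T-at ⊕-right (pairᶜ v0 v1))))))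

    -- Paths avoiding this run through large cells only. For a given cell and index, failing a
    -- requirement is co-c.e. over `ZM`, so the jump `W` is what makes `Dead` c.e. The clause
    -- `s ≤ ℓ` lets a failure persist in longer strings.
    Dead : ℕ → ℕ → Set
    Dead E ℓ = Σ ℕ λ s → (s ≤ ℓ) × Σ ℕ λ i → ¬ N i × ¬ Meets (V i) (Cell M (Bit E) s)

    dead-local : Local Dead
    dead-local {E} {E'} le ag (s , s≤ℓ , i , ni , nm) = s , ≤-trans s≤ℓ le , i , ni ,
      λ mt → nm (meets-mono (λ x → cell-cong M M x (λ i l → let q = ag i (≤-trans l s≤ℓ) in mk⇔ (from q) (to q)) (λ _ _ → mk⇔ id id)) mt)

    deadᵉ : CE₂ W Dead
    deadᵉ = ce-ext (λ { (E ∷ ℓ ∷ []) → mk⇔ id id }) (∃ᵉ (rec→ce (v0 ≤ʳ v2) ×ᵉ ∃ᵉ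
      (rec→ce ((¬ʳ subʳ (ce→rec-jump (ce-relative ⊕-left N-ce)) (v0 ∷ᵛ []ᵛ))
               ×ʳ ¬ʳ subʳ (ce→rec-jump (meets-cellᵉ V V-ce)) (v0 ∷ᵛ v2 ∷ᵛ v1 ∷ᵛ []ᵛ)))))

    large-cell : ∀ ℓ → Σ ℕ λ E → (E < 2 ^ ℓ) × Large (Cell M (Bit E) ℓ)
    large-cell zero = 0 , s≤s z≤n , large-mono (λ _ _ i ()) full
    large-cell (suc ℓ) with large-cell ℓ
    ... | E , _ , lg with regular {Y₀ = Cell M (Bit E) ℓ ∩ (λ x → M (pair ℓ x))} {Y₁ = Cell M (Bit E) ℓ ∖ (λ x → M (pair ℓ x))} lg
                        (λ x c → [ (λ h → inj₁ (c , h)) , (λ h → inj₂ (c , h)) ]′ (toSum (em {M (pair ℓ x)})))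
    ...   | inj₁ l₀ = fin S (suc ℓ) , fin-< S (suc ℓ) , large-mono ext l₀
      where
      S : SetOf
      S i = ((i < ℓ) × Bit E i) ⊎ (i ≡ ℓ)
      ext : (Cell M (Bit E) ℓ ∩ (λ x → M (pair ℓ x))) ⊆ Cell M (Bit (fin S (suc ℓ))) (suc ℓ)
      ext x (c , h) i (s≤s i≤ℓ) with m≤n⇒m<n∨m≡n i≤ℓ
      ... | inj₁ l = mk⇔ (λ b → [ (λ { (_ , b') → to (c i l) b' }) , (λ { refl → h }) ]′ (to (agree-fin S (suc ℓ) i (s≤s i≤ℓ)) b))
                         (λ h' → from (agree-fin S (suc ℓ) i (s≤s i≤ℓ)) (inj₁ (l , from (c i l) h')))
      ... | inj₂ refl = mk⇔ (λ _ → h) (λ _ → from (agree-fin S (suc ℓ) i (s≤s i≤ℓ)) (inj₂ refl))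
    ...   | inj₂ l₁ = fin S (suc ℓ) , fin-< S (suc ℓ) , large-mono ext l₁
      where
      S : SetOf
      S i = (i < ℓ) × Bit E i
      ext : (Cell M (Bit E) ℓ ∖ (λ x → M (pair ℓ x))) ⊆ Cell M (Bit (fin S (suc ℓ))) (suc ℓ)
      ext x (c , h) i (s≤s i≤ℓ) with m≤n⇒m<n∨m≡n i≤ℓ
      ... | inj₁ l = mk⇔ (λ b → to (c i l) (proj₂ (to (agree-fin S (suc ℓ) i (s≤s i≤ℓ)) b)))
                         (λ h' → from (agree-fin S (suc ℓ) i (s≤s i≤ℓ)) (l , from (c i l) h'))
      ... | inj₂ refl = mk⇔ (λ b → ⊥-elim (<-irrefl refl (proj₁ (to (agree-fin S (suc ℓ) i (s≤s i≤ℓ)) b)))) (λ h' → ⊥-elim (h h'))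

    dead-proper : ¬ Covers Dead
    dead-proper (ℓ , h) with large-cell ℓ
    ... | E , l , lg with h E l
    ...   | s , s≤ℓ , i , ni , nm = nm (meets-mono (λ x → cell-down {Bit E} x s≤ℓ) (lg i ni))

    module Along (f : ℕ → Bool) (f-avoids : Avoids Dead ⟦ f ⟧) where

      Z⁺ : SetOf
      Z⁺ = W ⊕ ⟦ f ⟧

      W≤Z⁺ : W ≤T Z⁺
      W≤Z⁺ = ⊕-left

      X : ℕ → SetOf
      X = Cell M ⟦ f ⟧

      X-fin : ∀ s x → Cell M (Bit (fin ⟦ f ⟧ s)) s x ⇔ X s x
      X-fin s x = mk⇔ (cell-cong M M x (λ i l → agree-fin ⟦ f ⟧ s i l) (λ _ _ → mk⇔ id id))
                      (cell-cong M M x (λ i l → let q = agree-fin ⟦ f ⟧ s i l in mk⇔ (from q) (to q)) (λ _ _ → mk⇔ id id))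

      X-large : ∀ s → Large (X s)
      X-large s i ni = dne (λ nm → f-avoids (fin ⟦ f ⟧ s) s (agree-fin ⟦ f ⟧ s) (s , ≤-refl , i , ni , λ mt → nm (meets-mono (λ x → to (X-fin s x)) mt)))

      Xʳ : Rec Z⁺ {2} (λ ρ → X (lookup ρ zero) (lookup ρ (suc zero)))
      Xʳ = rec-ext (λ { (s ∷ x ∷ []) → mk⇔ id id }) (∀<ʳ v0 (≤T-at ⊕-right v0 ⇔ʳ ≤T-at (≤T-trans M≤W W≤Z⁺) (pairᶜ v0 v2)))

      Refuted : ℕ → Set
      Refuted e = Σ ℕ λ t → ¬ Meets (U e) (X t)

      refutedᵉ : CE₁ Z⁺ Refuted
      refutedᵉ = ce-ext (λ { (e ∷ []) → mk⇔
          (λ { (t , E , ag , nm) → t , λ mt → nm (meets-mono (λ x → cell-cong M M x (λ i l → let q = ag i l in mk⇔ (from q) (to q)) (λ _ _ → mk⇔ id id)) mt) })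
          (λ { (t , nm) → t , fin ⟦ f ⟧ t , agree-fin ⟦ f ⟧ t , λ mt → nm (meets-mono (λ x → to (X-fin t x)) mt) }) })
        (∃ᵉ (∃ᵉ (rec→ce (∀<ʳ v1 (bitʳ v1 v0 ⇔ʳ ≤T-at ⊕-right v0)
           ×ʳ ¬ʳ subʳ (rec-relative W≤Z⁺ (ce→rec-jump (meets-cellᵉ U (universalᵉ Z)))) (v2 ∷ᵛ v0 ∷ᵛ v1 ∷ᵛ []ᵛ)))))

      -- An index pairs a cell number with an open class. The class has to be met inside every `X s`
      -- and not just somewhere, which is why intersecting with a cell preserves largeness.
      V⁺ : ℕ → ℕ → Set
      V⁺ i G = U (unpair₂ i) G × (∀ x → Bit G x → X (unpair₁ i) x)

      N⁺ : ℕ → Set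
      N⁺ i = Refuted (unpair₂ i)

      Large⁺ : SetOf → Set
      Large⁺ Y = ∀ i → ¬ N⁺ i → Meets (V⁺ i) Y

      large⁺-at : ∀ {Y} → Large⁺ Y → ∀ s e → ¬ Refuted e → Meets (U e) (Y ∩ X s)
      large⁺-at lg s e ne with lg (pair s e) (λ r → ne (subst Refuted (unpair₂-pair s e) r))
      ... | G , (u , hx) , hy = G , subst (λ e → U e G) (unpair₂-pair s e) u , λ x b → hy x b , subst (λ s → X s x) (unpair₁-pair s e) (hx x b)

      at-large⁺ : ∀ {Y} → (∀ s e → ¬ Refuted e → Meets (U e) (Y ∩ X s)) → Large⁺ Y
      at-large⁺ h i ni with h (unpair₁ i) (unpair₂ i) ni
      ... | G , u , g = G , (u , λ x b → proj₂ (g x b)) , λ x b → proj₁ (g x b)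

      kept-at : ∀ {e} → ¬ Refuted e → ∀ s → Meets (U e) (X s)
      kept-at ne s = dne (λ nm → ne (s , nm))

      module Pair (e₀ e₁ : ℕ) (k₀ : ¬ Refuted e₀) (k₁ : ¬ Refuted e₁) where

        both : Σ ℕ λ e → ∀ G → (Meets (U e₀) (Bit G) × Meets (U e₁) (Bit G)) ⇔ U e G
        both = open-index (λ G → Meets (U e₀) (Bit G) × Meets (U e₁) (Bit G)) (ce-ext (λ { (G ∷ []) → mk⇔ id id })
          (∃ᵉ (at₂ U (universalᵉ Z) (litᶜ e₀) v0 ×ᵉ ∀bitᵉ v0 (rec→ce (bitʳ v2 v0))) ×ᵉ ∃ᵉ (at₂ U (universalᵉ Z) (litᶜ e₁) v0 ×ᵉ ∀bitᵉ v0 (rec→ce (bitʳ v2 v0)))))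

        both-kept : (b : Σ ℕ λ e → ∀ G → (Meets (U e₀) (Bit G) × Meets (U e₁) (Bit G)) ⇔ U e G) → ¬ Refuted (proj₁ b)
        both-kept (e , h) (t , nm) with kept-at k₀ t | kept-at k₁ t
        ... | G₀ , u₀ , g₀ | G₁ , u₁ , g₁ = nm (G , to (h G) ((G₀ , u₀ , λ x b → from (agree x) (inj₁ b)) , (G₁ , u₁ , λ x b → from (agree x) (inj₂ b)))
              , λ x b → [ g₀ x , g₁ x ]′ (to (agree x) b))
          where
          S : SetOf
          S x = Bit G₀ x ⊎ Bit G₁ x
          G : ℕ
          G = fin S (G₀ + G₁)
          agree : ∀ x → Bit G x ⇔ S x
          agree x = mk⇔ (λ b → proj₂ (to (fin-bit S (G₀ + G₁) x) b))
            (λ s → from (fin-bit S (G₀ + G₁) x) ([ (λ b → ≤-trans (Bit-< G₀ x b) (m≤m+n G₀ G₁)) , (λ b → ≤-trans (Bit-< G₁ x b) (m≤n+m G₁ G₀)) ]′ s , s))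

        SplitAt : ℕ → Set
        SplitAt G = Covers (Split (U e₀) (U e₁) (Bit G))

        split-index : Σ ℕ λ e → ∀ G → SplitAt G ⇔ U e G
        split-index = open-index SplitAt (coversᵉ {k = 1} (λ P ℓ ρ → Split (U e₀) (U e₁) (Bit (lookup ρ zero)) P ℓ) (ce-ext (λ { (P ∷ ℓ ∷ G ∷ []) → mk⇔ id id })
          (∃ᵉ (at₂ U (universalᵉ Z) (litᶜ e₀) v0 ×ᵉ ∀bitᵉ v0 (rec→ce (v0 <ʳ v3 ×ʳ bitʳ v4 v0 ×ʳ bitʳ v2 v0)))
            ⊎ᵉ ∃ᵉ (at₂ U (universalᵉ Z) (litᶜ e₁) v0 ×ᵉ ∀bitᵉ v0 (rec→ce (v0 <ʳ v3 ×ʳ bitʳ v4 v0 ×ʳ ¬ʳ bitʳ v2 v0))))))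

        -- A cell X t with no finite subset in SplitAt splits into two pieces, neither of which is in both classes;
        -- the column of a later stage devoted to their intersection then refutes the intersection.
        covered : ∀ t → Covers (Split (U e₀) (U e₁) (X t))
        covered t = dne (λ nc → go both (both-kept both) (compact split-local nc))
          where
          go : (b : Σ ℕ λ e → ∀ G → (Meets (U e₀) (Bit G) × Meets (U e₁) (Bit G)) ⇔ U e G) → ¬ Refuted (proj₁ b)
            → (Σ (ℕ → Bool) λ p → Avoids (Split (U e₀) (U e₁) (X t)) ⟦ p ⟧) → ⊥
          go (e , h) ke (p , av) = ke (suc r , piece (em {⟦ f ⟧ r}))
            where
            r : ℕ
            r = pair e t
            t≤r : t ≤ r
            t≤r = subst (_≤ r) (unpair₂-pair e t) (unpair₂-≤ r)
            in₀ : ∀ {Y} → Meets (U e) Y → Meets (U e₀) Y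
            in₀ (G , u , g) = meets-mono g (proj₁ (from (h G) u))
            in₁ : ∀ {Y} → Meets (U e) Y → Meets (U e₁) Y
            in₁ (G , u , g) = meets-mono g (proj₂ (from (h G) u))
            F : ℕ
            F = fin ⟦ f ⟧ r
            C : SetOf
            C = Cell M (Bit F) r
            down : ∀ x → C x → X t x
            down x c = cell-down x t≤r (to (X-fin r x) c)
            n₀ : ¬ Meets (U (unpair₁ r)) (C ∩ ⟦ p ⟧)
            n₀ mt = proj₁ (split-avoids ⟦ p ⟧ av) (meets-mono (λ { x (c , q) → down x c , q }) (in₀ (subst (λ a → Meets (U a) (C ∩ ⟦ p ⟧)) (unpair₁-pair e t) mt)))
            n₁ : ¬ Meets (U (unpair₁ r)) (C ∖ ⟦ p ⟧)
            n₁ mt = proj₂ (split-avoids ⟦ p ⟧ av) (meets-mono (λ { x (c , q) → down x c , q }) (in₁ (subst (λ a → Meets (U a) (C ∖ ⟦ p ⟧)) (unpair₁-pair e t) mt)))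
            piece : Dec (⟦ f ⟧ r) → ¬ Meets (U e) (X (suc r))
            piece (yes y) mt = proj₁ (splits r F ⟦ p ⟧ n₀ n₁) (subst (λ a → Meets (U a) (C ∩ (λ x → M (pair r x)))) (sym (unpair₁-pair e t))
              (meets-mono (λ x c → from (X-fin r x) (cell-down x (n≤1+n r) c) , to (c r ≤-refl) y) mt))
            piece (no n) mt = proj₂ (splits r F ⟦ p ⟧ n₀ n₁) (subst (λ a → Meets (U a) (C ∖ (λ x → M (pair r x)))) (sym (unpair₁-pair e t))
              (meets-mono (λ x c → from (X-fin r x) (cell-down x (n≤1+n r) c) , λ my → n (from (c r ≤-refl) my)) mt))

        -- A cover at length `ℓ` consults only the points of `X t` below `ℓ`.
        split-finite : ∀ t → Σ ℕ λ G → SplitAt G × (∀ x → Bit G x → X t x)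
        split-finite t = go (covered t)
          where
          shrink : ∀ {P ℓ} → Split (U e₀) (U e₁) (X t) P ℓ → Split (U e₀) (U e₁) (Bit (fin (X t) ℓ)) P ℓ
          shrink {ℓ = ℓ} (inj₁ (G , u , g)) = inj₁ (G , u , λ x b → let l , xx , p = g x b in l , from (fin-bit (X t) ℓ x) (l , xx) , p)
          shrink {ℓ = ℓ} (inj₂ (G , u , g)) = inj₂ (G , u , λ x b → let l , xx , p = g x b in l , from (fin-bit (X t) ℓ x) (l , xx) , p)
          go : Covers (Split (U e₀) (U e₁) (X t)) → Σ ℕ λ G → SplitAt G × (∀ x → Bit G x → X t x)
          go (ℓ , h) = fin (X t) ℓ , (ℓ , λ P l → shrink (h P l)) , λ x b → proj₂ (to (fin-bit (X t) ℓ x) b)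

        -- The finite sets in `SplitAt` generate an open class met by every `X t`, hence a
        -- requirement on `Y`. Its witness inside `Y ∩ X s` is then cut by `P`.
        split-large : ∀ {Y} s → Large⁺ Y → ∀ P → Meets (U e₀) ((Y ∩ X s) ∩ P) ⊎ Meets (U e₁) ((Y ∩ X s) ∖ P)
        split-large {Y} s lg P = go split-index
          where
          go : (Σ ℕ λ e → ∀ G → SplitAt G ⇔ U e G) → Meets (U e₀) ((Y ∩ X s) ∩ P) ⊎ Meets (U e₁) ((Y ∩ X s) ∖ P)
          go (e , h) = pick (large⁺-at lg s e (λ { (t , nm) → let G , sp , g = split-finite t in nm (G , to (h G) sp , g) }))
            where
            pick : Meets (U e) (Y ∩ X s) → Meets (U e₀) ((Y ∩ X s) ∩ P) ⊎ Meets (U e₁) ((Y ∩ X s) ∖ P)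
            pick (G , u , g) = [ (λ mt → inj₁ (meets-mono (λ { x (b , p) → g x b , p }) mt))
                               , (λ mt → inj₂ (meets-mono (λ { x (b , p) → g x b , p }) mt)) ]′ (split-covers (from (h G) u) P)

      X-anti : ∀ {s s'} → s ≤ s' → X s' ⊆ X s
      X-anti le x = cell-down x le

      -- Suppose `Y₁` fails class `e₁` at cell `s₁`. For any requirement on `Y₀` at cell `s₀`, split
      -- along `Y₀` inside the cell `s₀ + s₁`, which lies in both: the alternative for `Y₁` is
      -- excluded.
      regular⁺ : ∀ {Y Y₀ Y₁} → Large⁺ Y → (∀ x → Y x → Y₀ x ⊎ Y₁ x) → Large⁺ Y₀ ⊎ Large⁺ Y₁
      regular⁺ {Y} {Y₀} {Y₁} lg cov with em {Large⁺ Y₀}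
      ... | yes l₀ = inj₁ l₀
      ... | no n₀  = inj₂ (at-large⁺ (λ s₁ e₁ k₁ → dne (λ nm₁ → n₀ (at-large⁺ (λ s₀ e₀ k₀ → [ (λ mt → meets-mono (λ { x ((_ , xx) , y) → y , X-anti (m≤m+n s₀ s₁) x xx }) mt)
                , (λ mt → ⊥-elim (nm₁ (meets-mono (λ { x ((y , xx) , ny) → [ (λ y₀ → ⊥-elim (ny y₀)) , id ]′ (cov x y) , X-anti (m≤n+m s₁ s₀) x xx }) mt))) ]′
                  (Pair.split-large e₀ e₁ k₀ k₁ (s₀ + s₁) lg Y₀))))))

      -- All cells on the path are large for the old class, so no old requirement is ever refuted;
      -- each is therefore among the new ones.
      sub⁺ : ∀ {Y} → Large⁺ Y → Large Y
      sub⁺ {Y} lg i ni = go (open-index (V i) (at₂ V V-ce (litᶜ i) v0))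
        where
        go : (Σ ℕ λ e → ∀ G → V i G ⇔ U e G) → Meets (V i) Y
        go (e , h) = let G , u , g = large⁺-at lg 0 e (λ { (t , nm) → let G , v , g = X-large t i ni in nm (G , to (h G) v , g) })
                     in G , from (h G) u , λ x b → proj₁ (g x b)

      lev⁺ : Lev Z⁺
      lev⁺ = record
        { V = V⁺
        ; N = N⁺
        ; V-ce = ce-ext (λ { (i ∷ G ∷ []) → mk⇔ id id }) (at₂ U (ce-relative (≤T-trans Z≤W W≤Z⁺) (universalᵉ Z)) (sndᶜ v0) v1 ×ᵉ ∀bitᵉ v1 (rec→ce (subʳ Xʳ (fstᶜ v1 ∷ᵛ v0 ∷ᵛ []ᵛ))))
        ; N-ce = at₁ Refuted refutedᵉ (sndᶜ v0)
        ; regular = regular⁺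
        ; full = at-large⁺ (λ s e ke → meets-mono (λ x xx → tt , xx) (kept-at ke s))
        ; infinite = λ lg → infinite (sub⁺ lg)
        }

      next : ∀ B j → ¬ CE₁ (jumpN j Z⁺) B → Next lev B j
      next B j hd = record
        { Z⁺ = Z⁺
        ; hard = hd
        ; Z≤Z⁺ = ≤T-trans Z≤W W≤Z⁺
        ; lev⁺ = lev⁺
        ; sub = sub⁺
        ; X = X
        ; X-rec = λ t → reduce (subʳ Xʳ (litᶜ t ∷ᵛ v0 ∷ᵛ []ᵛ))
        ; thick = λ {Y} t lg → at-large⁺ (λ s e ke → meets-mono (λ { x (y , xx) → (y , X-anti (m≤n+m t s) x xx) , X-anti (m≤m+n s t) x xx }) (large⁺-at lg (s + t) e ke))
        ; refutedᵉ = refutedᵉ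
        ; kept = λ e ke {Y} lg → meets-mono (λ _ → proj₁) (large⁺-at lg 0 e ke)
        }

  -- `M` is chosen over `Z` with `suc j` jumps in reserve, hence low, and the path over `W` with `j`
  -- in reserve: `jumpN (suc j) (Z ⊕ M)` is `jumpN j W`.
  nextLevel : ∀ {Z} (lev : Lev Z) B j → ¬ CE₁ (jumpN (suc j) Z) B → Next lev B j
  nextLevel {Z} lev B j hd = go (Basis.basis Z Flaw flawᵉ flaw-local (λ c → covers-avoids c ⟦ ColumnsExist.M Z ⟧ (ColumnsExist.M-avoids Z)) B (suc j) hd)
    where
    open Columns Z
    go : (Σ (ℕ → Bool) λ m → Avoids Flaw ⟦ m ⟧ × ¬ CE₁ (jumpN (suc j) (Z ⊕ ⟦ m ⟧)) B) → Next lev B j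
    go (m , avm , hm) = go′ (Basis.basis W Dead deadᵉ dead-local dead-proper B j (λ c → hm (subst (λ X → CE₁ X B) (sym (jumpN-jump j (Z ⊕ ⟦ m ⟧))) c)))
      where
      open Build lev m avm
      go′ : (Σ (ℕ → Bool) λ f → Avoids Dead ⟦ f ⟧ × ¬ CE₁ (jumpN j (W ⊕ ⟦ f ⟧)) B) → Next lev B j
      go′ (f , avf , hf) = Along.next f avf B j hf

  -- Finite strings and descending sequences of conditions

  len set : ℕ → ℕ
  len σ = unpair₂ σ
  set σ = unpair₁ σ

  -- Extension in Mathias forcing. Bits of `set σ` from `len σ` on are junk that no clause reads.
  record Ext (σ τ : ℕ) (Y : SetOf) : Set where
    constructor ext
    field
      longer : len σ ≤ len τ
      old    : ∀ x → x < len σ → Bit (set σ) x ⇔ Bit (set τ) x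
      new    : ∀ x → x < len τ → len σ ≤ x → Bit (set τ) x → Y x
  open Ext

  ext-refl : ∀ {σ Y} → Ext σ σ Y
  ext-refl = ext ≤-refl (λ x _ → mk⇔ id id) (λ x l le _ → ⊥-elim (<-irrefl refl (≤-trans l le)))

  ext-mono : ∀ {σ τ Y Y'} → Y ⊆ Y' → Ext σ τ Y → Ext σ τ Y'
  ext-mono s e = ext (longer e) (old e) (λ x l le b → s x (new e x l le b))

  ext-trans : ∀ {σ τ υ Y} → Ext σ τ Y → Ext τ υ Y → Ext σ υ Y
  ext-trans {σ} {τ} {υ} {Y} e f = ext (≤-trans (longer e) (longer f))
    (λ x l → let p = old e x l ; q = old f x (≤-trans l (longer e)) in mk⇔ (to q ∘ to p) (from p ∘ from q)) nw
    where
    nw : ∀ x → x < len υ → len σ ≤ x → Bit (set υ) x → Y x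
    nw x l le b with <-≤-connex x (len τ)
    ... | inj₁ l' = new e x l' le (from (old f x l') b)
    ... | inj₂ ge = new f x l ge b

  -- Only finitely many points are added, so having an extension of a given kind inside `Y` is an
  -- open condition on `Y`, of the form `Meets`.
  ext-finite : ∀ {σ τ Y} → Ext σ τ Y → Σ ℕ λ G → (∀ x → Bit G x → Y x) × Ext σ τ (Bit G)
  ext-finite {σ} {τ} {Y} e = fin S (len τ) , (λ x b → let l , le , b' = to (fin-bit S (len τ) x) b in new e x l le b')
      , ext (longer e) (old e) (λ x l le b → from (fin-bit S (len τ) x) (l , le , b))
    where
    S : SetOf
    S x = (len σ ≤ x) × Bit (set τ) x

  extʳ : ∀ {Z k} {S T G : Vec ℕ k → ℕ} → Comp Z S → Comp Z T → Comp Z G → Rec Z (λ ρ → Ext (S ρ) (T ρ) (Bit (G ρ)))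
  extʳ {Z} s t g = rec-ext (λ ρ → mk⇔ (λ { (a , b , c) → ext a b c }) (λ { (ext a b c) → a , b , c }))
    ((sndᶜ s ≤ʳ sndᶜ t) ×ʳ ∀<ʳ (sndᶜ s) (bitʳ (fstᶜ (up s)) v0 ⇔ʳ bitʳ (fstᶜ (up t)) v0)
      ×ʳ ∀<ʳ (sndᶜ t) ((sndᶜ (up s) ≤ʳ v0) →ʳ (bitʳ (fstᶜ (up t)) v0 →ʳ bitʳ (up g) v0)))
    where
    up : ∀ {k} {F : Vec ℕ k → ℕ} → Comp Z F → Comp Z {suc k} (λ ρ → F (tail ρ))
    up c = subᶜ c (tailᵛ idᵛ)

  record Descent : Set₁ where
    field
      σ : ℕ → ℕ
      X : ℕ → SetOf
      σ-step : ∀ i → Ext (σ i) (σ (suc i)) (X i)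
      X-step : ∀ i → X (suc i) ⊆ X i

    X-desc : ∀ {i j} → i ≤ j → X j ⊆ X i
    X-desc {i} {zero}  z≤n x h = h
    X-desc {i} {suc j} le  x h with m≤n⇒m<n∨m≡n le
    ... | inj₁ (s≤s l) = X-desc l x (X-step j x h)
    ... | inj₂ refl    = h

    σ-desc : ∀ {i j} → i ≤ j → Ext (σ i) (σ j) (X i)
    σ-desc {i} {zero}  z≤n = ext-refl
    σ-desc {i} {suc j} le with m≤n⇒m<n∨m≡n le
    ... | inj₁ (s≤s l) = ext-trans (σ-desc l) (ext-mono (X-desc l) (σ-step j))
    ... | inj₂ refl    = ext-refl

    H : SetOf
    H x = Σ ℕ λ i → (x < len (σ i)) × Bit (set (σ i)) x

  -- Control of the m-th jump of the set H under construction.  Pos σ k and Neg σ k say that the string σ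
  -- suggests k ∈ H⁽ᵐ⁾ or k ∉ H⁽ᵐ⁾; both are c.e. in Z.  P σ R k and N′ σ R k say that the condition with
  -- reservoir R forces these facts.
  record Stage (B : SetOf) (m j : ℕ) : Set₁ where
    field
      Z    : SetOf
      hard : ¬ CE₁ (jumpN j Z) B
      lev  : Lev Z
    open Lev lev public

    Thick : SetOf → Set₁
    Thick R = (∀ {Y} → Large Y → Large (Y ∩ R))

    field
      Pos Neg : ℕ → ℕ → Set
      Pos-ce  : CE₂ Z Pos
      Neg-ce  : CE₂ Z Neg
      P N′ : ℕ → SetOf → ℕ → Set
      P-mono : ∀ {σ τ R R' k} → Ext σ τ R → R' ⊆ R → P σ R k → P τ R' k
      N-mono : ∀ {σ τ R R' k} → Ext σ τ R → R' ⊆ R → N′ σ R k → N′ τ R' k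
      Pos→P : ∀ {σ k} → Pos σ k → Σ SetOf λ R → (Thick R × (R ≤T Z)) × P σ R k
      Neg→N : ∀ {σ k} → Neg σ k → Σ SetOf λ R → (Thick R × (R ≤T Z)) × N′ σ R k
      Task  : ℕ → ℕ → SetOf → Set
      Task-mono : ∀ {t σ τ R R'} → Ext σ τ R → R' ⊆ R → Task t σ R → Task t τ R'
      dense : ∀ t σ {Y} → Large Y → Σ ℕ λ τ → Ext σ τ Y × Σ SetOf λ R → (Thick R × (R ≤T Z)) × Task t τ R

    Generic : Descent → Set
    Generic d = ∀ t → Σ ℕ λ i → Task t (Descent.σ d i) (Descent.X d i)

    field
      true-Pos : ∀ d → Generic d → ∀ {k} → jumpN m (Descent.H d) k → Σ ℕ λ i → ∀ j → i ≤ j → Pos (Descent.σ d j) k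
      true-Neg : ∀ d → Generic d → ∀ {k} → ¬ jumpN m (Descent.H d) k → Σ ℕ λ i → ∀ j → i ≤ j → Neg (Descent.σ d j) k
      P-true   : ∀ d → Generic d → ∀ {i k} → P (Descent.σ d i) (Descent.X d i) k → jumpN m (Descent.H d) k
      N-true   : ∀ d → Generic d → ∀ {i k} → N′ (Descent.σ d i) (Descent.X d i) k → ¬ jumpN m (Descent.H d) k
      unbounded : ∀ d → Generic d → Infinite (Descent.H d)

  module Base where

    V : ℕ → ℕ → Set
    V i G = Σ ℕ λ x → (i ≤ x) × Bit G x

    -- Infinity in the format of `Lev`: requirement `i` asks for an element from `i` on, and the
    -- empty set of exceptions is written `0 ≡ 1`.
    Large : SetOf → Set
    Large Y = ∀ i → ¬ (0 ≡ 1) → Meets (V i) Y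

    large→∞ : ∀ {Y} → Large Y → Infinite Y
    large→∞ lg i with lg i (λ ())
    ... | G , (x , le , b) , h = x , le , h x b

    ∞→large : ∀ {Y} → Infinite Y → Large Y
    ∞→large inf i _ with inf i
    ... | x , le , y = fin (_≡ x) (suc x) , (x , le , from (fin-bit (_≡ x) (suc x) x) (≤-refl , refl))
        , λ z b → subst _ (sym (proj₂ (to (fin-bit (_≡ x) (suc x) z) b))) y

    lev₀ : Lev ∅
    lev₀ = record
      { V = V
      ; N = λ _ → 0 ≡ 1
      ; V-ce = ce-ext (λ { (i ∷ G ∷ []) → mk⇔ id id }) (∃ᵉ (rec→ce (v1 ≤ʳ v0 ×ʳ bitʳ v2 v0)))
      ; N-ce = rec→ce (litᶜ 0 =ʳ litᶜ 1)
      ; regular = reg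
      ; full = ∞→large (λ m → m , ≤-refl , tt)
      ; infinite = large→∞
      }
      where
      reg : ∀ {Y Y₀ Y₁} → Large Y → (∀ x → Y x → Y₀ x ⊎ Y₁ x) → Large Y₀ ⊎ Large Y₁
      reg {Y} {Y₀} {Y₁} lg cov with em {Infinite Y₀}
      ... | yes inf = inj₁ (∞→large inf)
      ... | no fi with ¬∀→∃¬ fi
      ...   | b , nb = inj₂ (∞→large (λ i → let x , le , y = large→∞ lg (i + b) in x , ≤-trans (m≤m+n i b) le ,
                  [ (λ y₀ → ⊥-elim (nb (x , ≤-trans (m≤n+m b i) le , y₀))) , id ]′ (cov x y)))

    Pos Neg : ℕ → ℕ → Set
    Pos σ k = (k < len σ) × Bit (set σ) k
    Neg σ k = (k < len σ) × ¬ Bit (set σ) k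

    Pos-ext : ∀ {σ τ Y k} → Ext σ τ Y → Pos σ k → Pos τ k
    Pos-ext e (l , b) = ≤-trans l (longer e) , to (old e _ l) b

    Neg-ext : ∀ {σ τ Y k} → Ext σ τ Y → Neg σ k → Neg τ k
    Neg-ext e (l , b) = ≤-trans l (longer e) , λ b' → b (from (old e _ l) b')

    Task : ℕ → ℕ → Set
    Task t σ = Σ ℕ λ x → (t ≤ x) × Pos σ x

    whole : (∀ {Y} → Large Y → Large (Y ∩ Whole)) × (Whole ≤T ∅)
    whole = (λ lg i n → meets-mono (λ x y → y , tt) (lg i n)) , reduce (rec-ext (λ ρ → mk⇔ (λ _ → tt) (λ _ → refl)) (litᶜ 0 =ʳ litᶜ 0))

    dense : ∀ t σ {Y} → Large Y → Σ ℕ λ τ → Ext σ τ Y × Task t τ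
    dense t σ {Y} lg with large→∞ lg (len σ + t)
    ... | y , le , yy = τ , ext lon od nw , y , ≤-trans (m≤n+m t (len σ)) le , subst (y <_) (sym lenτ) ≤-refl , from (bits y ≤-refl) (inj₂ refl)
      where
      S : SetOf
      S x = ((x < len σ) × Bit (set σ) x) ⊎ (x ≡ y)
      τ : ℕ
      τ = pair (fin S (suc y)) (suc y)
      lenτ : len τ ≡ suc y
      lenτ = unpair₂-pair (fin S (suc y)) (suc y)
      setτ : set τ ≡ fin S (suc y)
      setτ = unpair₁-pair (fin S (suc y)) (suc y)
      σ≤y : len σ ≤ y
      σ≤y = ≤-trans (m≤m+n (len σ) t) le
      bits : ∀ x → x < suc y → Bit (set τ) x ⇔ S x
      bits x l = mk⇔ (λ b → to (agree-fin S (suc y) x l) (subst (λ E → Bit E x) setτ b)) (λ s → subst (λ E → Bit E x) (sym setτ) (from (agree-fin S (suc y) x l) s))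
      lon : len σ ≤ len τ
      lon = subst (len σ ≤_) (sym lenτ) (≤-trans σ≤y (n≤1+n y))
      od : ∀ x → x < len σ → Bit (set σ) x ⇔ Bit (set τ) x
      od x l = mk⇔ (λ b → from (bits x x<) (inj₁ (l , b))) (λ b → [ proj₂ , (λ { refl → ⊥-elim (<-irrefl refl (≤-trans l σ≤y)) }) ]′ (to (bits x x<) b))
        where
        x< : x < suc y
        x< = ≤-trans l (≤-trans σ≤y (n≤1+n y))
      nw : ∀ x → x < len τ → len σ ≤ x → Bit (set τ) x → Y x
      nw x l ge b = [ (λ { (l' , _) → ⊥-elim (<-irrefl refl (≤-trans l' ge)) }) , (λ { refl → yy }) ]′ (to (bits x (subst (x <_) lenτ l)) b)

    module _ (d : Descent) where
      open Descent d

      pos-H : ∀ {k} → H k → Σ ℕ λ i → ∀ j → i ≤ j → Pos (σ j) k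
      pos-H (i , p) = i , λ j le → Pos-ext (σ-desc le) p

      neg-H : ∀ {i k} → Neg (σ i) k → ¬ H k
      neg-H {i} {k} n h with pos-H h
      ... | i' , p = proj₂ (Neg-ext (σ-desc (m≤m+n i i')) n) (proj₂ (p (i + i') (m≤n+m i' i)))

    stage₀ : ∀ B j → ¬ CE₁ (jumpN j ∅) B → Stage B 0 j
    stage₀ B j hd = record
      { Z = ∅ ; hard = hd ; lev = lev₀ ; Pos = Pos ; Neg = Neg
      ; Pos-ce = rec→ce (v1 <ʳ sndᶜ v0 ×ʳ bitʳ (fstᶜ v0) v1)
      ; Neg-ce = rec→ce (v1 <ʳ sndᶜ v0 ×ʳ ¬ʳ bitʳ (fstᶜ v0) v1)
      ; P = λ σ _ k → Pos σ k ; N′ = λ σ _ k → Neg σ k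
      ; P-mono = λ e _ → Pos-ext e ; N-mono = λ e _ → Neg-ext e
      ; Pos→P = λ p → Whole , whole , p ; Neg→N = λ n → Whole , whole , n
      ; Task = λ t σ _ → Task t σ
      ; Task-mono = λ { e _ (x , le , p) → x , le , Pos-ext e p }
      ; dense = λ t σ lg → let τ , e , tk = dense t σ lg in τ , e , Whole , whole , tk
      ; true-Pos = λ d _ → pos-H d
      ; true-Neg = λ d g {k} nh → let i , x , le , l , b = g k in i , λ j i≤j →
          ≤-trans (s≤s le) (≤-trans l (longer (Descent.σ-desc d i≤j))) , λ b' → nh (j , ≤-trans (s≤s le) (≤-trans l (longer (Descent.σ-desc d i≤j))) , b')
      ; P-true = λ d _ {i} p → i , p
      ; N-true = λ d _ n → neg-H d n
      ; unbounded = λ d g m → let i , x , le , p = g m in x , le , i , p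
      }

  module Forced {B : SetOf} {m j : ℕ} (st : Stage B m j) where
    open Stage st

    Res : Set₁
    Res = Σ SetOf λ R → Thick R × (R ≤T Z)

    ∩-≤T : ∀ {R R' Y} → R ≤T Y → R' ≤T Y → (R ∩ R') ≤T Y
    ∩-≤T r r' = reduce (≤T-at r v0 ×ʳ ≤T-at r' v0)

    res∩ : Res → Res → Res
    res∩ (R , th , r) (R' , th' , r') = R ∩ R' , (λ lg → large-mono (λ { x ((y , a) , b) → y , a , b }) (th' (th lg))) , ∩-≤T r r'

    res-whole : Res
    res-whole = Whole , (λ lg → large-mono (λ x y → y , tt) lg) , reduce (rec-ext (λ ρ → mk⇔ (λ _ → tt) (λ _ → refl)) (litᶜ 0 =ʳ litᶜ 0))

    -- Each suggested answer becomes forced on a thick reservoir of its own. A run uses finitely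
    -- many answers, and thick reservoirs are closed under intersection.
    run-forced : ∀ {σ c x y} → Run (Pos σ) (Neg σ) c x y → Σ Res λ R → Run (P σ (proj₁ R)) (N′ σ (proj₁ R)) c x y
    run-forced {σ} = Directed.run-finite {I = Res} (λ R → P σ (proj₁ R)) (λ R → N′ σ (proj₁ R))
      (λ R R' → res∩ R R' , ((λ _ → P-mono ext-refl (λ _ → proj₁)) , (λ _ → N-mono ext-refl (λ _ → proj₁)))
                          , ((λ _ → P-mono ext-refl (λ _ → proj₂)) , (λ _ → N-mono ext-refl (λ _ → proj₂)))) res-whole
      (λ k p → let R , a , q = Pos→P p in (R , a) , q) (λ k n → let R , a , q = Neg→N n in (R , a) , q)

  -- From control of one jump to control of the next.

  module Climb {B : SetOf} {m j : ℕ} (st : Stage B m (suc j)) (nx : Next (Stage.lev st) B j) where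
    open Stage st
    open Forced st
    open Next nx using (Z⁺; Z≤Z⁺; lev⁺; sub; X; X-rec; thick; refutedᵉ; kept) renaming (hard to hard⁺)

    Large⁺ : SetOf → Set
    Large⁺ = Lev.Large lev⁺

    U : ℕ → ℕ → Set
    U = Universal Z

    Halt : SetOf → SetOf → ℕ → Set
    Halt P N k = Σ ℕ λ y → RunN P N k k y

    Pos⁺ : ℕ → ℕ → Set
    Pos⁺ τ k = Halt (Pos τ) (Neg τ) k

    Pos⁺-ce : CE₂ Z Pos⁺
    Pos⁺-ce = ∃ᵉ (subᵉ (runᵉ {k = 1} (at₂ Pos Pos-ce v1 v0) (at₂ Neg Neg-ce v1 v0)) (v2 ∷ᵛ v2 ∷ᵛ v0 ∷ᵛ v1 ∷ᵛ []ᵛ))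

    -- For `p` the pair of `σ` and `k`, this generates the open class of sets inside which `σ` has
    -- an extension suggesting `k`. Whether some `X t` refutes it is the forcing question of this
    -- level.
    Reach : ℕ → ℕ → Set
    Reach p G = Σ ℕ λ τ → Ext (unpair₁ p) τ (Bit G) × Pos⁺ τ (unpair₂ p)

    Reach-ce : CE₂ Z Reach
    Reach-ce = ∃ᵉ (rec→ce (extʳ (fstᶜ v1) v0 v2) ×ᵉ at₂ Pos⁺ Pos⁺-ce v0 (sndᶜ v1))

    -- Otherwise `Y ∖ R` would be large, for the old class too; its intersection with the thick `R`
    -- would then be infinite, yet it is empty.
    thick⁺ : ∀ {R} → Thick R → ∀ {Y} → Large⁺ Y → Large⁺ (Y ∩ R)
    thick⁺ {R} th {Y} lg with Lev.regular lev⁺ {Y₀ = Y ∩ R} {Y₁ = Y ∖ R} lg (λ x y → [ (λ r → inj₁ (y , r)) , (λ r → inj₂ (y , r)) ]′ (toSum (em {R x})))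
    ... | inj₁ l = l
    ... | inj₂ l with infinite (th (sub l)) 0
    ...   | x , _ , (_ , nr) , r = ⊥-elim (nr r)

    P⁺ N⁺ : ℕ → SetOf → ℕ → Set
    P⁺ σ R k = Halt (P σ R) (N′ σ R) k
    N⁺ σ R k = ∀ τ → Ext σ τ R → ¬ Pos⁺ τ k

    P⁺-mono : ∀ {σ τ R R' k} → Ext σ τ R → R' ⊆ R → P⁺ σ R k → P⁺ τ R' k
    P⁺-mono e s (y , r) = y , run-mono (λ _ → P-mono e s) (λ _ → N-mono e s) r

    Pos→P⁺ : ∀ {σ k} → Pos⁺ σ k → Σ SetOf λ R → ((∀ {Y} → Large⁺ Y → Large⁺ (Y ∩ R)) × (R ≤T Z⁺)) × P⁺ σ R k
    Pos→P⁺ (y , r) = let (R , th , le) , r' = run-forced r in R , (thick⁺ th , ≤T-trans le Z≤Z⁺) , y , r'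

    module Indexed (e₀ : ℕ) (e₀-spec : ∀ p G → Reach p G ⇔ U (pair e₀ p) G) where

      idx : ℕ → ℕ → ℕ
      idx σ k = pair e₀ (pair σ k)

      meets-reach : ∀ σ k {Y} → Meets (U (idx σ k)) Y ⇔ (Σ ℕ λ τ → Ext σ τ Y × Pos⁺ τ k)
      meets-reach σ k {Y} = mk⇔
        (λ { (G , u , h) → let τ , e , p = from (e₀-spec (pair σ k) G) u in
               τ , ext-mono h (subst (λ s → Ext s τ (Bit G)) (unpair₁-pair σ k) e) , subst (Pos⁺ τ) (unpair₂-pair σ k) p })
        (λ { (τ , e , p) → let G , h , e' = ext-finite e in
               G , to (e₀-spec (pair σ k) G) (τ , subst (λ s → Ext s τ (Bit G)) (sym (unpair₁-pair σ k)) e' , subst (Pos⁺ τ) (sym (unpair₂-pair σ k)) p) , h })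

      Neg⁺ : ℕ → ℕ → Set
      Neg⁺ σ k = Σ ℕ λ t → ¬ Meets (U (idx σ k)) (X t)

      Neg⁺-ce : CE₂ Z⁺ Neg⁺
      Neg⁺-ce = at₁ (λ e → Σ ℕ λ t → ¬ Meets (U e) (X t)) refutedᵉ (pairᶜ (litᶜ e₀) (pairᶜ v0 v1))

      refuted-ext : ∀ {σ τ R k t} → Ext σ τ R → R ⊆ X t → ¬ Meets (U (idx σ k)) (X t) → ¬ Meets (U (idx τ k)) (X t)
      refuted-ext {σ} {τ} {k = k} e s nm mt = let υ , f , p = to (meets-reach τ k) mt in nm (from (meets-reach σ k) (υ , ext-trans (ext-mono s e) f , p))

      -- The negative alternative names a `t` instead of asking just for `N⁺`: a generic descent has
      -- to make the c.e. fact `Neg⁺` true, and later strings keep the same `t` because they grow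
      -- inside `X t`.
      Decide : ℕ → ℕ → SetOf → Set
      Decide k σ R = P⁺ σ R k ⊎ Σ ℕ λ t → (R ⊆ X t) × ¬ Meets (U (idx σ k)) (X t)

      Decide-mono : ∀ {k σ τ R R'} → Ext σ τ R → R' ⊆ R → Decide k σ R → Decide k τ R'
      Decide-mono e s (inj₁ p) = inj₁ (P⁺-mono e s p)
      Decide-mono {k} e s (inj₂ (t , q , nm)) = inj₂ (t , (λ x r → q x (s x r)) , refuted-ext {k = k} e q nm)

      -- Tasks accumulate, so that a descent generic at this level is generic at all lower ones.
      Task⁺ : ℕ → ℕ → SetOf → Set
      Task⁺ t σ R = Task t σ R × Decide t σ R

      -- If the reaching class is refuted, the reservoir is cut to the refuting `X s`. If not,
      -- `Y ∩ R` meets it by `kept`, which gives an extension suggesting `t` and then a reservoir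
      -- forcing it.
      dense⁺ : ∀ t σ {Y} → Large⁺ Y → Σ ℕ λ τ → Ext σ τ Y × Σ SetOf λ R → ((∀ {Y} → Large⁺ Y → Large⁺ (Y ∩ R)) × (R ≤T Z⁺)) × Task⁺ t τ R
      dense⁺ t σ {Y} lg with dense t σ (sub lg)
      ... | τ , e , R , (th , le) , tk with em {Neg⁺ τ t}
      ...   | yes (s , nm) = τ , e , R ∩ X s , ((λ lg → Lev.large-mono lev⁺ (λ { x ((y , a) , b) → y , a , b }) (thick s (thick⁺ th lg))) , ∩-≤T (≤T-trans le Z≤Z⁺) (X-rec s))
                             , Task-mono ext-refl (λ _ → proj₁) tk , inj₂ (s , (λ _ → proj₂) , nm)
      ...   | no nn = let υ , f , p = to (meets-reach τ t) (kept (idx τ t) nn (thick⁺ th lg))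
                          R' , (th' , le') , q = Pos→P⁺ p
                      in υ , ext-trans e (ext-mono (λ _ → proj₁) f) , R ∩ R'
                         , ((λ lg → Lev.large-mono lev⁺ (λ { x ((y , a) , b) → y , a , b }) (th' (thick⁺ th lg))) , ∩-≤T (≤T-trans le Z≤Z⁺) le')
                         , Task-mono (ext-mono (λ _ → proj₂) f) (λ _ → proj₁) tk , inj₁ (P⁺-mono ext-refl (λ _ → proj₂) q)

      module _ (d : Descent) (g : ∀ t → Σ ℕ λ i → Task⁺ t (Descent.σ d i) (Descent.X d i)) where
        open Descent d using (σ; σ-desc; H) renaming (X to R)

        generic : Generic d
        generic t = let i , tk , _ = g t in i , tk

        true-Pos⁺ : ∀ {k} → jumpN (suc m) H k → Σ ℕ λ i → ∀ j → i ≤ j → Pos⁺ (σ j) k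
        true-Pos⁺ (y , ev) = let i , h = run-eventually (λ j → Pos (σ j)) (λ j → Neg (σ j)) (λ _ → true-Pos d generic) (λ _ → true-Neg d generic) (eval→run ev)
                             in i , λ j le → y , h j le

        P-true⁺ : ∀ {i k} → P⁺ (σ i) (R i) k → jumpN (suc m) H k
        P-true⁺ (y , r) = y , run→eval (run-mono (λ _ → P-true d generic) (λ _ → N-true d generic) r)

        N-true⁺ : ∀ {i k} → N⁺ (σ i) (R i) k → ¬ jumpN (suc m) H k
        N-true⁺ {i} n h = let i' , p = true-Pos⁺ h in n (σ (i + i')) (σ-desc (m≤m+n i i')) (p (i + i') (m≤n+m i' i))

        true-Neg⁺ : ∀ {k} → ¬ jumpN (suc m) H k → Σ ℕ λ i → ∀ j → i ≤ j → Neg⁺ (σ j) k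
        true-Neg⁺ {k} nh = go (g k)
          where
          go : (Σ ℕ λ i → Task⁺ k (σ i) (R i)) → Σ ℕ λ i → ∀ j → i ≤ j → Neg⁺ (σ j) k
          go (i , _ , inj₁ p) = ⊥-elim (nh (P-true⁺ p))
          go (i , _ , inj₂ (t , s , nm)) = i , λ j le → t , refuted-ext {k = k} (σ-desc le) s nm

      stage⁺ : Stage B (suc m) j
      stage⁺ = record
        { Z = Z⁺ ; hard = hard⁺ ; lev = lev⁺ ; Pos = Pos⁺ ; Neg = Neg⁺
        ; Pos-ce = ce-relative Z≤Z⁺ Pos⁺-ce
        ; Neg-ce = Neg⁺-ce
        ; P = P⁺ ; N′ = N⁺
        ; P-mono = P⁺-mono
        ; N-mono = λ e s n τ f → n τ (ext-trans e (ext-mono s f))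
        ; Pos→P = Pos→P⁺
        ; Neg→N = λ { {σ} {k} (t , nm) → X t , (thick t , X-rec t) , λ τ e p → nm (from (meets-reach σ k) (τ , e , p)) }
        ; Task = Task⁺
        ; Task-mono = λ { e s (a , b) → Task-mono e s a , Decide-mono e s b }
        ; dense = dense⁺
        ; true-Pos = true-Pos⁺
        ; true-Neg = true-Neg⁺
        ; P-true = P-true⁺
        ; N-true = N-true⁺
        ; unbounded = λ d g → unbounded d (generic d g)
        }

  -- Level plus remaining jumps is constant; each level gained consumes one jump of the hardness of
  -- `B`.
  climb : ∀ {B} m j → ¬ CE₁ (jumpN (m + j) ∅) B → Stage B m j
  climb {B} zero    j h = Base.stage₀ B j h
  climb {B} (suc m) j h = up (climb m (suc j) (subst (λ a → ¬ CE₁ (jumpN a ∅) B) (sym (+-suc m j)) h))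
    where
    up : Stage B m (suc j) → Stage B (suc m) j
    up st = go (nextLevel (Stage.lev st) B j (Stage.hard st))
      where
      go : Next (Stage.lev st) B j → Stage B (suc m) j
      go nx = fin′ (universal-index (Climb.Reach st nx) (Climb.Reach-ce st nx))
        where
        fin′ : (Σ ℕ λ e → ∀ p G → Climb.Reach st nx p G ⇔ Universal (Stage.Z st) (pair e p) G) → Stage B (suc m) j
        fin′ (e , h) = Climb.Indexed.stage⁺ st nx e h

  -- Diagonalisation at the top level.

  module Top {B : SetOf} {n : ℕ} (st : Stage B n 0) (v : ℕ) where
    open Stage st
    open Forced st

    PosT : ℕ → ℕ → ℕ → Set
    PosT e τ x = RunN (Pos τ) (Neg τ) e x v

    PT NT : ℕ → ℕ → SetOf → ℕ → Set
    PT e σ R x = RunN (P σ R) (N′ σ R) e x v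
    NT e σ R x = ∀ τ → Ext σ τ R → ¬ PosT e τ x

    Hit : ℕ → ℕ → ℕ → ℕ → Set
    Hit e σ x G = Σ ℕ λ τ → Ext σ τ (Bit G) × PosT e τ x

    Hit-ce : ∀ e σ → CE₂ Z (Hit e σ)
    Hit-ce e σ = ∃ᵉ (rec→ce (extʳ (litᶜ σ) v0 v2) ×ᵉ
      subᵉ (runᵉ {k = 1} (at₂ Pos Pos-ce v1 v0) (at₂ Neg Neg-ce v1 v0)) (litᶜ e ∷ᵛ v1 ∷ᵛ litᶜ v ∷ᵛ v0 ∷ᵛ []ᵛ))

    meets-hit : ∀ {e σ x Y} → Meets (Hit e σ x) Y → Σ ℕ λ τ → Ext σ τ Y × PosT e τ x
    meets-hit (G , (τ , e , p) , h) = τ , ext-mono h e , p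

    hit-meets : ∀ {e σ x Y τ} → Ext σ τ Y → PosT e τ x → Meets (Hit e σ x) Y
    hit-meets {τ = τ} e p = let G , h , e' = ext-finite e in G , (τ , e' , p) , h

    Sat : ℕ → ℕ → SetOf → Set
    Sat e σ R = Σ ℕ λ x → (¬ B x × PT e σ R x) ⊎ (B x × NT e σ R x)

    -- Top reservoirs are cut along partitions chosen against the requirements and need not be
    -- computable in `Z`; what has to survive is only that `B` is not c.e. over them.
    Ok : SetOf → Set
    Ok X = ¬ CE₁ (Z ⊕ X) B

    ok-below : ∀ {X Y} → Ok X → Y ≤T (Z ⊕ X) → Ok Y
    ok-below ok le c = ok (ce-relative (⊕-lub ⊕-left le) c)

    χ-≤T : ∀ {Y W} → Y ≤T W → ⟦ χ Y ⟧ ≤T W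
    χ-≤T {Y} (reduce r) = reduce (rec-ext (λ { (x ∷ []) → mk⇔ (from (χ-spec Y x)) (to (χ-spec Y x)) }) r)

    χ-⊆ : ∀ Y → ⟦ χ Y ⟧ ⊆ Y
    χ-⊆ Y x = to (χ-spec Y x)

    ⊆-χ : ∀ Y → Y ⊆ ⟦ χ Y ⟧
    ⊆-χ Y x = from (χ-spec Y x)

    -- Reservoirs are Boolean functions so that this statement and `Failure` quantify over a small
    -- type, to which excluded middle applies.
    Sol : SetOf → ℕ → ℕ → (ℕ → Bool) → Set
    Sol A e σ X = Σ ℕ λ τ → Σ (ℕ → Bool) λ X' → Ext σ τ (A ∩ ⟦ X ⟧) × (⟦ X' ⟧ ⊆ ⟦ X ⟧) × Ok ⟦ X' ⟧ × Large (A ∩ ⟦ X' ⟧) × Sat e τ ⟦ X' ⟧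

    sol-weaken : ∀ {A e σ X X'} → ⟦ X' ⟧ ⊆ ⟦ X ⟧ → Sol A e σ X' → Sol A e σ X
    sol-weaken s (τ , Y , e , s' , ok , lg , sat) = τ , Y , ext-mono (λ { x (a , y) → a , s x y }) e , (λ x y → s x (s' x y)) , ok , lg , sat

    sol-yes : ∀ {A e σ X x} → Ok ⟦ X ⟧ → Large (A ∩ ⟦ X ⟧) → ¬ B x → Meets (Hit e σ x) (A ∩ ⟦ X ⟧) → Sol A e σ X
    sol-yes {A} {e} {σ} {X} {x} ok lg nb mt = go (meets-hit mt)
      where
      go : (Σ ℕ λ τ → Ext σ τ (A ∩ ⟦ X ⟧) × PosT e τ x) → Sol A e σ X
      go (τ , ex , p) = go′ (run-forced p)
        where
        go′ : (Σ Res λ R → Run (P τ (proj₁ R)) (N′ τ (proj₁ R)) (decode e) x v) → Sol A e σ X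
        go′ ((R , th , le) , r) = τ , χ (⟦ X ⟧ ∩ R) , ex , (λ y h → proj₁ (χ-⊆ (⟦ X ⟧ ∩ R) y h))
          , ok-below ok (χ-≤T (∩-≤T ⊕-right (≤T-trans le ⊕-left)))
          , large-mono (λ { y ((a , xx) , r) → a , ⊆-χ (⟦ X ⟧ ∩ R) y (xx , r) }) (th lg)
          , x , inj₁ (nb , run-mono (λ _ → P-mono ext-refl sub) (λ _ → N-mono ext-refl sub) r)
          where
          sub : ⟦ χ (⟦ X ⟧ ∩ R) ⟧ ⊆ R
          sub y h = proj₂ (χ-⊆ (⟦ X ⟧ ∩ R) y h)

    sol-no : ∀ {A e σ X x} Y → Y ⊆ ⟦ X ⟧ → Ok ⟦ χ Y ⟧ → Large (A ∩ Y) → B x → ¬ Meets (Hit e σ x) Y → Sol A e σ X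
    sol-no {σ = σ} {x = x} Y s ok lg b nm = σ , χ Y , ext-refl , (λ y h → s y (χ-⊆ Y y h)) , ok , large-mono (λ { y (a , h) → a , ⊆-χ Y y h }) lg
      , x , inj₂ (b , λ τ e p → nm (hit-meets (ext-mono (χ-⊆ Y) e) p))

    -- For an `x` outside `B` all partitions succeed, in particular the one along `A₀`; this set
    -- enters in no other way and may be arbitrarily complex. For an `x` in `B` one failing
    -- partition is enough, chosen so that `B` stays hard over it.
    data TwoClass (O₀ O₁ : ℕ → ℕ → Set) (A₀ A₁ X : SetOf) : Set where
      in₀  : ∀ x → ¬ B x → Meets (O₀ x) (A₀ ∩ X) → TwoClass O₀ O₁ A₀ A₁ X
      in₁  : ∀ x → ¬ B x → Meets (O₁ x) (A₁ ∩ X) → TwoClass O₀ O₁ A₀ A₁ X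
      cut  : ∀ x → B x → (p : ℕ → Bool) → ¬ Meets (O₀ x) (X ∩ ⟦ p ⟧) → ¬ Meets (O₁ x) (X ∖ ⟦ p ⟧) → ¬ CE₁ ((Z ⊕ X) ⊕ ⟦ p ⟧) B → TwoClass O₀ O₁ A₀ A₁ X

    -- The set of x for which every partition of X has a piece in O₀ x or O₁ x is c.e. in Z ⊕ X, hence differs from B.
    two-class : ∀ {O₀ O₁ A₀ A₁ X} → CE₂ Z O₀ → CE₂ Z O₁ → (∀ x → A₀ x ⊎ A₁ x) → Ok X → TwoClass O₀ O₁ A₀ A₁ X
    two-class {O₀} {O₁} {A₀} {A₁} {X} c₀ c₁ cov ok = go (¬∀→∃¬ {P = λ x → B x ⇔ S x} (λ h → ok (ce-ext (λ { (x ∷ []) → mk⇔ (from (h x)) (to (h x)) }) S-ce)))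
      where
      S : ℕ → Set
      S x = Covers (Split (O₀ x) (O₁ x) X)
      splitᵉ : CE₃ (Z ⊕ X) (λ p ℓ x → Split (O₀ x) (O₁ x) X p ℓ)
      splitᵉ = ce-ext (λ { (p ∷ ℓ ∷ x ∷ []) → mk⇔ id id })
        (∃ᵉ (at₂ O₀ (ce-relative ⊕-left c₀) v3 v0 ×ᵉ ∀bitᵉ v0 (rec→ce (v0 <ʳ v3 ×ʳ ≤T-at ⊕-right v0 ×ʳ bitʳ v2 v0)))
          ⊎ᵉ ∃ᵉ (at₂ O₁ (ce-relative ⊕-left c₁) v3 v0 ×ᵉ ∀bitᵉ v0 (rec→ce (v0 <ʳ v3 ×ʳ ≤T-at ⊕-right v0 ×ʳ ¬ʳ bitʳ v2 v0))))
      S-ce : CE₁ (Z ⊕ X) S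
      S-ce = coversᵉ {k = 1} (λ p ℓ ρ → Split (O₀ (lookup ρ zero)) (O₁ (lookup ρ zero)) X p ℓ)
        (ce-ext (λ { (p ∷ ℓ ∷ x ∷ []) → mk⇔ id id }) splitᵉ)
      go : (Σ ℕ λ x → ¬ (B x ⇔ S x)) → TwoClass O₀ O₁ A₀ A₁ X
      go (x , ne) with em {B x} | em {S x}
      ... | yes b | yes s = ⊥-elim (ne (mk⇔ (λ _ → s) (λ _ → b)))
      ... | no nb | no ns = ⊥-elim (ne (mk⇔ (λ b → ⊥-elim (nb b)) (λ s → ⊥-elim (ns s))))
      ... | no nb | yes s = [ (λ mt → in₀ x nb (meets-mono (λ { y (xx , a) → a , xx }) mt))
                            , (λ mt → in₁ x nb (meets-mono (λ { y (xx , na) → [ (λ a → ⊥-elim (na a)) , id ]′ (cov y) , xx }) mt)) ]′ (split-covers s A₀)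
      ... | yes b | no ns = done (Basis.basis (Z ⊕ X) (Split (O₀ x) (O₁ x) X) (at₃ (λ p ℓ x → Split (O₀ x) (O₁ x) X p ℓ) splitᵉ v0 v1 (litᶜ x)) split-local ns B 0 ok)
        where
        done : (Σ (ℕ → Bool) λ p → Avoids (Split (O₀ x) (O₁ x) X) ⟦ p ⟧ × ¬ CE₁ ((Z ⊕ X) ⊕ ⟦ p ⟧) B) → TwoClass O₀ O₁ A₀ A₁ X
        done (p , av , ok') = cut x b p (proj₁ (split-avoids ⟦ p ⟧ av)) (proj₂ (split-avoids ⟦ p ⟧ av)) ok'

    ok-∩ : ∀ {X p} → ¬ CE₁ ((Z ⊕ X) ⊕ p) B → Ok ⟦ χ (X ∩ p) ⟧
    ok-∩ {X} {p} ok c = ok (ce-relative (⊕-lub (≤T-trans ⊕-left ⊕-left) (χ-≤T (∩-≤T (≤T-trans ⊕-right ⊕-left) ⊕-right))) c)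

    ok-∖ : ∀ {X p} → ¬ CE₁ ((Z ⊕ X) ⊕ p) B → Ok ⟦ χ (X ∖ p) ⟧
    ok-∖ {X} {p} ok c = ok (ce-relative (⊕-lub (≤T-trans ⊕-left ⊕-left)
      (χ-≤T (reduce (≤T-at (≤T-trans ⊕-right ⊕-left) v0 ×ʳ ¬ʳ ≤T-at ⊕-right v0)))) c)

    large-split : ∀ {A X} p → Large (A ∩ X) → Large (A ∩ (X ∩ p)) ⊎ Large (A ∩ (X ∖ p))
    large-split p lg = regular lg (λ { x (a , xx) → [ (λ h → inj₁ (a , xx , h)) , (λ h → inj₂ (a , xx , h)) ]′ (toSum (em {p x})) })

    -- A requirement `V i` failed by `A₁ ∩ X` serves as the second class. Then `in₁` is impossible,
    -- and in a `cut` the second piece avoids `V i`, so the first piece inherits largeness.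
    sol-one-sided : ∀ {A₀ A₁ X} → (∀ x → A₀ x ⊎ A₁ x) → Ok ⟦ X ⟧ → Large (A₀ ∩ ⟦ X ⟧) → ¬ Large (A₁ ∩ ⟦ X ⟧) → ∀ e σ → Sol A₀ e σ X
    sol-one-sided {A₀} {A₁} {X} cov ok lg nl e σ = go (¬∀→∃¬ nl)
      where
      go : (Σ ℕ λ i → ¬ (¬ N i → Meets (V i) (A₁ ∩ ⟦ X ⟧))) → Sol A₀ e σ X
      go (i , nh) = go′ (two-class {O₁ = λ _ → V i} {A₁ = A₁} (Hit-ce e σ) (at₂ V V-ce (litᶜ i) v1) cov ok)
        where
        ni : ¬ N i
        ni h = nh (λ k → ⊥-elim (k h))
        nm : ¬ Meets (V i) (A₁ ∩ ⟦ X ⟧)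
        nm h = nh (λ _ → h)
        go′ : TwoClass (Hit e σ) (λ _ → V i) A₀ A₁ ⟦ X ⟧ → Sol A₀ e σ X
        go′ (in₀ x nb mt) = sol-yes ok lg nb mt
        go′ (in₁ x nb mt) = ⊥-elim (nm mt)
        go′ (cut x b p n₀ n₁ ok') = sol-no (⟦ X ⟧ ∩ ⟦ p ⟧) (λ _ → proj₁) (ok-∩ ok')
          ([ id , (λ l → ⊥-elim (n₁ (meets-mono (λ _ → proj₂) (l i ni)))) ]′ (large-split ⟦ p ⟧ lg)) b n₀

    Failure : SetOf → Set
    Failure A = Σ ℕ λ σ → Σ (ℕ → Bool) λ X → Σ ℕ λ e → Ok ⟦ X ⟧ × Large (A ∩ ⟦ X ⟧) × ¬ Sol A e σ X

    -- The failed requirement is the first class, played against each new requirement on the side of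
    -- `A₁`. An outcome that solved it would contradict the failure, so every outcome benefits `A₁`.
    sol-other-side : ∀ {A₀ A₁ σ₀ X₀ e₀} → (∀ x → A₀ x ⊎ A₁ x) → ¬ Sol A₀ e₀ σ₀ X₀
      → ∀ {X} → ⟦ X ⟧ ⊆ ⟦ X₀ ⟧ → Ok ⟦ X ⟧ → Large (A₁ ∩ ⟦ X ⟧) → ∀ e σ → Sol A₁ e σ X
    sol-other-side {A₀} {A₁} {σ₀} {X₀} {e₀} cov fail {X} s ok lg e σ with em {Large (A₀ ∩ ⟦ X ⟧)}
    ... | no n   = sol-one-sided (λ x → swap (cov x)) ok lg n e σ
    ... | yes l₀ = go (two-class (Hit-ce e₀ σ₀) (Hit-ce e σ) cov ok)
      where
      fail′ : ¬ Sol A₀ e₀ σ₀ X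
      fail′ sol = fail (sol-weaken s sol)
      go : TwoClass (Hit e₀ σ₀) (Hit e σ) A₀ A₁ ⟦ X ⟧ → Sol A₁ e σ X
      go (in₀ x nb mt) = ⊥-elim (fail′ (sol-yes ok l₀ nb mt))
      go (in₁ x nb mt) = sol-yes ok lg nb mt
      go (cut x b p n₀ n₁ ok') with em {Large (A₀ ∩ (⟦ X ⟧ ∩ ⟦ p ⟧))} | large-split ⟦ p ⟧ lg
      ... | yes l | _      = ⊥-elim (fail′ (sol-no (⟦ X ⟧ ∩ ⟦ p ⟧) (λ _ → proj₁) (ok-∩ ok') l b n₀))
      ... | no _  | inj₂ l = sol-no (⟦ X ⟧ ∖ ⟦ p ⟧) (λ _ → proj₁) (ok-∖ ok') l b n₁
      -- Here `X ∩ p` is large on the side of `A₁` only, so the one-sided argument applies inside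
      -- it.
      ... | no nl | inj₁ l = sol-weaken (λ y h → proj₁ (χ-⊆ XP y h)) (sol-one-sided {X = χ XP} (λ x → swap (cov x)) (ok-∩ ok')
                               (large-mono (λ { y (a , h) → a , ⊆-χ XP y h }) l) (λ l' → nl (large-mono (λ { y (a , h) → a , χ-⊆ XP y h }) l')) e σ)
        where
        XP : SetOf
        XP = ⟦ X ⟧ ∩ ⟦ p ⟧

    Solution : SetOf → Set₁
    Solution A = Σ SetOf λ H → Infinite H × (H ⊆ A) × (∀ e → ¬ (∀ x → B x ⇔ Eval (jumpN n H) (decode e) x v))

    module Construct (A : SetOf) (X₀ : ℕ → Bool) (ok₀ : Ok ⟦ X₀ ⟧) (lg₀ : Large (A ∩ ⟦ X₀ ⟧))
      (solve : ∀ {X} → ⟦ X ⟧ ⊆ ⟦ X₀ ⟧ → Ok ⟦ X ⟧ → Large (A ∩ ⟦ X ⟧) → ∀ e σ → Sol A e σ X) where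

      record Cond : Set where
        field
          σ : ℕ
          X : ℕ → Bool
          sub : ⟦ X ⟧ ⊆ ⟦ X₀ ⟧
          ok  : Ok ⟦ X ⟧
          lg  : Large (A ∩ ⟦ X ⟧)
      open Cond

      Succ : ℕ → Cond → Cond → Set
      Succ t c c' = Ext (σ c) (σ c') (A ∩ ⟦ X c ⟧) × (⟦ X c' ⟧ ⊆ ⟦ X c ⟧) × Task t (σ c') ⟦ X c' ⟧ × Sat t (σ c') ⟦ X c' ⟧

      abstract
        next : ∀ t c → Σ Cond (Succ t c)
        next t c = go (dense t (σ c) (lg c))
          where
          go : (Σ ℕ λ τ → Ext (σ c) τ (A ∩ ⟦ X c ⟧) × Σ SetOf λ R → (Thick R × (R ≤T Z)) × Task t τ R) → Σ Cond (Succ t c)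
          -- Solving inside `R` lets the task just achieved survive, by `Task-mono`.
          go (τ , e , R , (th , le) , tk) = go′ (solve (λ x h → sub c x (Y⊆X x h)) okY lgY t τ)
            where
            Y : ℕ → Bool
            Y = χ (⟦ X c ⟧ ∩ R)
            Y⊆X : ⟦ Y ⟧ ⊆ ⟦ X c ⟧
            Y⊆X x h = proj₁ (χ-⊆ (⟦ X c ⟧ ∩ R) x h)
            Y⊆R : ⟦ Y ⟧ ⊆ R
            Y⊆R x h = proj₂ (χ-⊆ (⟦ X c ⟧ ∩ R) x h)
            okY : Ok ⟦ Y ⟧
            okY = ok-below (ok c) (χ-≤T (∩-≤T ⊕-right (≤T-trans le ⊕-left)))
            lgY : Large (A ∩ ⟦ Y ⟧)
            lgY = large-mono (λ { x ((a , xx) , r) → a , ⊆-χ (⟦ X c ⟧ ∩ R) x (xx , r) }) (th (lg c))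
            go′ : Sol A t τ Y → Σ Cond (Succ t c)
            go′ (υ , X' , e' , s' , ok' , lg' , sat) =
              record { σ = υ ; X = X' ; sub = λ x h → sub c x (Y⊆X x (s' x h)) ; ok = ok' ; lg = lg' }
              , ext-trans e (ext-mono (λ { x (a , h) → a , Y⊆X x h }) e')
              , (λ x h → Y⊆X x (s' x h))
              , Task-mono (ext-mono (λ { x (a , h) → Y⊆R x h }) e') (λ x h → Y⊆R x (s' x h)) tk
              , sat

      conds : ℕ → Cond
      conds zero    = record { σ = pair 0 0 ; X = X₀ ; sub = λ _ → id ; ok = ok₀ ; lg = lg₀ }
      conds (suc t) = proj₁ (next t (conds t))

      succ : ∀ t → Succ t (conds t) (conds (suc t))
      succ t = proj₂ (next t (conds t))

      d : Descent
      d = record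
        { σ = λ i → σ (conds i)
        ; X = λ i → ⟦ X (conds i) ⟧
        ; σ-step = λ i → ext-mono (λ _ → proj₂) (proj₁ (succ i))
        ; X-step = λ i → proj₁ (proj₂ (succ i))
        }
      open Descent d using (H; σ-desc)

      generic : Generic d
      generic t = suc t , proj₁ (proj₂ (proj₂ (succ t)))

      inside : ∀ i x → x < len (σ (conds i)) → Bit (set (σ (conds i))) x → A x
      inside zero    x l b = ⊥-elim (n≮0 (subst (x <_) (unpair₂-pair 0 0) l))
      inside (suc i) x l b with <-≤-connex x (len (σ (conds i)))
      ... | inj₁ l' = inside i x l' (from (old (proj₁ (succ i)) x l') b)
      ... | inj₂ ge = proj₁ (new (proj₁ (succ i)) x l ge b)

      diagonal : ∀ e → ¬ (∀ x → B x ⇔ Eval (jumpN n H) (decode e) x v)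
      diagonal e h = go (proj₂ (proj₂ (proj₂ (succ e))))
        where
        go : Sat e (σ (conds (suc e))) ⟦ X (conds (suc e)) ⟧ → ⊥
        go (x , inj₁ (nb , p)) = nb (from (h x) (run→eval (run-mono (λ _ → P-true d generic {suc e}) (λ _ → N-true d generic {suc e}) p)))
        go (x , inj₂ (b , nt)) = let i , r = run-eventually (λ j → Pos (σ (conds j))) (λ j → Neg (σ (conds j))) (λ _ → true-Pos d generic) (λ _ → true-Neg d generic)
                                               (eval→run (to (h x) b))
                                 in nt (σ (conds (suc e + i))) (σ-desc (m≤m+n (suc e) i)) (r (suc e + i) (m≤n+m i (suc e)))

      solution : Solution A
      solution = H , unbounded d generic , (λ { x (i , l , b) → inside i x l b }) , diagonal

    whole : ℕ → Bool
    whole _ = true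

    ok-whole : Ok ⟦ whole ⟧
    ok-whole c = hard (ce-relative (⊕-lub ≤T-refl (reduce (litᶜ 0 =ʳ litᶜ 0 ↦ refl))) c)
      where
      infix 1 _↦_
      _↦_ : ∀ {R : Vec ℕ 1 → Set} → Rec Z R → (∀ {ρ} → R ρ) → Rec Z (λ ρ → ⟦ whole ⟧ (lookup ρ zero))
      r ↦ h = rec-ext (λ ρ → mk⇔ (λ _ → refl) (λ _ → h)) r

    -- A failure on the side of `A` also supplies the reservoir from which the construction for
    -- `∁ A` starts. If `A` is not large at all, then `∁ A` is, and every reservoir is one-sided.
    solution : ∀ A → Solution A ⊎ Solution (∁ A)
    solution A with em {Large (A ∩ ⟦ whole ⟧)} | em {Failure A}
    ... | no n | _ = inj₂ (Construct.solution (∁ A) whole ok-whole lg∁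
          (λ s ok lg → sol-one-sided cov ok lg (λ l → n (large-mono (λ { x (a , h) → a , refl }) l))))
      where
      cov : ∀ x → ¬ A x ⊎ A x
      cov x = swap (toSum em)
      lg∁ : Large (∁ A ∩ ⟦ whole ⟧)
      lg∁ = [ id , (λ l → ⊥-elim (n l)) ]′ (regular full (λ x _ → [ (λ a → inj₁ (a , refl)) , (λ a → inj₂ (a , refl)) ]′ (cov x)))
    ... | yes lg | no nf = inj₁ (Construct.solution A whole ok-whole lg (λ {X} _ ok l e σ → dne (λ ns → nf (σ , X , e , ok , l , ns))))
    ... | yes _  | yes (σ₀ , X₀ , e₀ , ok , l , ns) = inj₂ (Construct.solution (∁ A) X₀ ok lg∁ (sol-other-side (λ x → toSum em) ns))
      where
      lg∁ : Large (∁ A ∩ ⟦ X₀ ⟧)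
      -- Were this side not large, the one-sided argument would solve the very requirement that
      -- failed.
      lg∁ = dne (λ n → ns (sol-one-sided (λ x → toSum em) ok l n e₀ σ₀))

  -- Back to computability.

  -- `B*` stands for `B` or its complement, and `v` for the value of the characteristic function of
  -- `B` on it. Computing `B` from the jump would make `B*` the set of inputs with output `v`.
  pigeonhole : ∀ (n : ℕ) (B B* : SetOf) (v : ℕ) → ¬ CE₁ (jumpN n ∅) B* → (∀ {X c} → (∀ x → (B x → Eval X c x 1) × (¬ B x → Eval X c x 0)) → ∀ x → B* x ⇔ Eval X c x v)
    → (A : SetOf) → Σ SetOf λ H → Infinite H × ((H ⊆ A) ⊎ (H ⊆ ∁ A)) × ¬ Computable (jumpN n H) B
  pigeonhole n B B* v hd red A = [ (λ { (H , inf , s , dg) → H , inf , inj₁ s , noncomp H dg }) , (λ { (H , inf , s , dg) → H , inf , inj₂ s , noncomp H dg }) ]′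
      (Top.solution (climb n 0 (subst (λ a → ¬ CE₁ (jumpN a ∅) B*) (sym (+-identityʳ n)) hd)) v A)
    where
    noncomp : ∀ H → (∀ e → ¬ (∀ x → B* x ⇔ Eval (jumpN n H) (decode e) x v)) → ¬ Computable (jumpN n H) B
    noncomp H dg (c , h) = dg (encode c) (λ x → subst (λ C → B* x ⇔ Eval (jumpN n H) C x v) (sym (decode-encode c)) (red h x))

  strong-jump-avoidance : (n : ℕ) (B : SetOf) → ¬ Computable (jumpN n ∅) B →
      (A : SetOf) → Σ SetOf λ H → Infinite H × ((H ⊆ A) ⊎ (H ⊆ ∁ A)) × ¬ Computable (jumpN n H) B
  strong-jump-avoidance n B nc A with em {CE₁ (jumpN n ∅) B} | em {CE₁ (jumpN n ∅) (∁ B)}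
  ... | no h  | _     = pigeonhole n B B 1 h (λ cs x → mk⇔ (proj₁ (cs x)) (λ e → dne (λ nb → 1+n≢0 (eval-deterministic e (proj₂ (cs x) nb))))) A
  ... | yes _ | no h  = pigeonhole n B (∁ B) 0 h (λ cs x → mk⇔ (proj₂ (cs x)) (λ e b → 0≢1+n (eval-deterministic e (proj₁ (cs x) b)))) A
  ... | yes p | yes q = ⊥-elim (nc (rec→computable (ce-co-ce→rec p q)))

theorem1 : ExcludedMiddle 0ℓ →
    (n : ℕ) (B : SetOf) → ¬ Computable (jumpN n ∅) B →
    (A : SetOf) → Σ SetOf λ H → Infinite H × ((H ⊆ A) ⊎ (H ⊆ ∁ A)) × ¬ Computable (jumpN n H) B
theorem1 em = Classical.strong-jump-avoidance em
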